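{- Every $\alpha\in K$ has a unique continued fraction expansion; that is, for every $\alpha\in K$ there is exactly one finite or infinite sequence $(c_j)_{j\ge 0}$ with $c_0\in Z$ and $c_j\in Z^*$ for all $j\ge 1$ such that $\alpha=[c_0;c_1,\dots,c_n]$ (if the sequence is finite with last term $c_n$) or $\alpha=\lim_{n\to\infty}[c_0;c_1,\dots,c_n]$ in $K$ (if the sequence is infinite).
   Context: Let $p$ be a prime and let $K$ be a finite extension of $\mathbb{Q}_p$ of degree $m$, with ramification index $e$ and residue degree $f$ (so $m=ef$). Let $|\cdot|$ be the unique extension to $K$ of the $p$-adic absolute value with $|p|=p^{ -1}$. Let $L\subseteq K$ be the unramified subextension of degree $f$ over $\mathbb{Q}_p$, write $L=\mathbb{Q}_p(\gamma)$ with $\gamma$ a primitive $(p^f-1)$-th root of unity, and fix $\beta\in K$ with $K=L(\beta)$ and $|\beta|=p^{1/e}$. Let $D$ be either $\{0,1,\dots,p-1\}$ or (for $p$ odd) $\{ -\frac{p-1}{2},\dots,\frac{p-1}{2}\}$; the claim is made for each choice. Let $X=\{\sum_{j=0}^{k}a_jp^{ -j} : k\in\mathbb{N}\cup\{0\},\ a_j\in D\}$, $Z=\{\sum_{i=0}^{e-1}\sum_{j=0}^{f-1}b_{i,j}\gamma^j\beta^i : b_{i,j}\in X\}$, and $Z^*=\{c\in Z : |c|>1\}$. Here $[c_0;c_1,\dots,c_n]=c_0+\cfrac{1}{c_1+\cfrac{1}{\ddots+\cfrac{1}{c_n}}}$. -}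

module Defs where

open import Algebra.Bundles using (CommutativeRing)
open import Algebra.Morphism.Structures using (module RingMorphisms)
import Algebra.Definitions.RawMonoid as RawMonoidDefs
import Algebra.Properties.Ring as RingProperties
import Algebra.Properties.Semiring.Exp as Exp
import Algebra.Solver.Ring.NaturalCoefficients.Default as NatSolver
open import Data.Fin.Base using (Fin; toℕ)
open import Data.Integer.Base as ℤ using (ℤ; +_)
open import Data.Integer.Divisibility.Signed
  using (_∣_; divides; ∣m∣n⇒∣m+n; ∣m⇒∣-m; ∣n⇒∣m*n; ∣m⇒∣m*n)
import Data.Integer.Properties as ℤ-props
import Data.Integer.Tactic.RingSolver as ℤ-Solver
open import Data.List.Base using (List; []; _∷_; applyUpTo)
open import Data.List.NonEmpty.Base using (List⁺; _∷_)
open import Data.List.Relation.Binary.Pointwise.Base using (Pointwise)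
open import Data.List.Relation.Unary.All using (All)
open import Data.Nat.Base as ℕ using (ℕ; zero; suc; NonZero)
import Data.Nat.Divisibility as ℕ∣
import Data.Nat.DivMod as ℕ/
open import Data.Product using (Σ; ∃; ∃₂; ∃!; _×_; _,_)
open import Data.Rational.Base as ℚ using (ℚ; 0ℚ)
open import Data.Sum.Base using (_⊎_)
open import Function.Base using (_∘_)
open import Level using (Level; Lift; 0ℓ; _⊔_) renaming (suc to lsuc)
import Relation.Binary.Construct.Add.Infimum.NonStrict as NonStrict
import Relation.Binary.Construct.Add.Infimum.Strict as Strict
open import Relation.Binary.PropositionalEquality.Core
  using (_≡_; refl; sym; cong)
open import Relation.Nullary.Construct.Add.Infimum using (_₋; ⊥₋; [_])
open import Relation.Nullary.Negation.Core using (¬_)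

private
  variable
    a b c ℓ ℓ₁ ℓ₂ : Level

module Localisation (R : CommutativeRing c ℓ)
                    (s : CommutativeRing.Carrier R) where

  open CommutativeRing R renaming (refl to ≈-refl; sym to ≈-sym; trans to ≈-trans)
  open Exp semiring using (_^_; ^-homo-*)
  open RingProperties ring using (-‿distribˡ-*; -‿distribʳ-*)
  open NatSolver commutativeSemiring using (solve; _:=_; _:+_; _:*_)
  open import Relation.Binary.Reasoning.Setoid setoid

  infix 8 _/s^_

  record Fraction : Set c where
    constructor _/s^_
    field
      numerator : Carrier
      exponent  : ℕ

  open Fraction

  infix 4 _≃_
  record _≃_ (x y : Fraction) : Set ℓ where
    constructor equal
    field
      power         : ℕ
      cross-product : s ^ power * (numerator x * s ^ exponent y)
                    ≈ s ^ power * (numerator y * s ^ exponent x)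

  infixl 6 _⊕_
  infixl 7 _⊗_
  _⊕_ _⊗_ : Fraction → Fraction → Fraction
  (x /s^ k) ⊕ (y /s^ l) = (x * s ^ l + y * s ^ k) /s^ (k ℕ.+ l)
  (x /s^ k) ⊗ (y /s^ l) = (x * y) /s^ (k ℕ.+ l)

  ⊖_ : Fraction → Fraction
  ⊖ (x /s^ k) = (- x) /s^ k

  private
    ≃-refl : ∀ {x} → x ≃ x
    ≃-refl = equal 0 ≈-refl

    ≃-sym : ∀ {x y} → x ≃ y → y ≃ x
    ≃-sym (equal t eq) = equal t (≈-sym eq)

    ≃-trans : ∀ {x y z} → x ≃ y → y ≃ z → x ≃ z
    ≃-trans {x /s^ k} {y /s^ l} {z /s^ m} (equal t e) (equal u f) = equal (t ℕ.+ (u ℕ.+ l)) (begin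
      s ^ (t ℕ.+ (u ℕ.+ l)) * (x * s ^ m)             ≈⟨ *-congʳ pow ⟩
      (s ^ t * (s ^ u * s ^ l)) * (x * s ^ m)         ≈⟨ r₁ (s ^ t) (s ^ u) (s ^ l) x (s ^ m) ⟩
      (s ^ u * s ^ m) * (s ^ t * (x * s ^ l))         ≈⟨ *-congˡ e ⟩
      (s ^ u * s ^ m) * (s ^ t * (y * s ^ k))         ≈⟨ r₂ (s ^ t) (s ^ u) (s ^ m) y (s ^ k) ⟩
      (s ^ t * s ^ k) * (s ^ u * (y * s ^ m))         ≈⟨ *-congˡ f ⟩
      (s ^ t * s ^ k) * (s ^ u * (z * s ^ l))         ≈⟨ r₃ (s ^ t) (s ^ u) (s ^ l) z (s ^ k) ⟩
      (s ^ t * (s ^ u * s ^ l)) * (z * s ^ k)         ≈⟨ *-congʳ pow ⟨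
      s ^ (t ℕ.+ (u ℕ.+ l)) * (z * s ^ k)             ∎)
      where
      pow : s ^ (t ℕ.+ (u ℕ.+ l)) ≈ s ^ t * (s ^ u * s ^ l)
      pow = ≈-trans (^-homo-* s t (u ℕ.+ l)) (*-congˡ (^-homo-* s u l))
      r₁ : ∀ T U L x M → (T * (U * L)) * (x * M) ≈ (U * M) * (T * (x * L))
      r₁ = solve 5 (λ T U L x M →
        (T :* (U :* L)) :* (x :* M)
        := (U :* M) :* (T :* (x :* L))) ≈-refl
      r₂ : ∀ T U M y K → (U * M) * (T * (y * K)) ≈ (T * K) * (U * (y * M))
      r₂ = solve 5 (λ T U M y K →
        (U :* M) :* (T :* (y :* K))
        := (T :* K) :* (U :* (y :* M))) ≈-refl
      r₃ : ∀ T U L z K → (T * K) * (U * (z * L)) ≈ (T * (U * L)) * (z * K)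
      r₃ = solve 5 (λ T U L z K →
        (T :* K) :* (U :* (z :* L))
        := (T :* (U :* L)) :* (z :* K)) ≈-refl

    cross : ∀ {x y k l} → x * s ^ l ≈ y * s ^ k → (x /s^ k) ≃ (y /s^ l)
    cross eq = equal 0 (*-congˡ eq)

    ⊕-cong : ∀ {x x′ y y′} → x ≃ x′ → y ≃ y′ → (x ⊕ y) ≃ (x′ ⊕ y′)
    ⊕-cong {x /s^ k} {x′ /s^ k′} {y /s^ l} {y′ /s^ l′} (equal t e) (equal u f) = equal (t ℕ.+ u) (begin
      s ^ (t ℕ.+ u) * ((x * s ^ l + y * s ^ k) * s ^ (k′ ℕ.+ l′))
        ≈⟨ *-cong (^-homo-* s t u) (*-congˡ (^-homo-* s k′ l′)) ⟩
      (s ^ t * s ^ u) * ((x * s ^ l + y * s ^ k) * (s ^ k′ * s ^ l′))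
        ≈⟨ r (s ^ t) (s ^ u) x (s ^ l) y (s ^ k) (s ^ k′) (s ^ l′) ⟩
      (s ^ u * s ^ l * s ^ l′) * (s ^ t * (x * s ^ k′)) + (s ^ t * s ^ k * s ^ k′) * (s ^ u * (y * s ^ l′))
        ≈⟨ +-cong (*-congˡ e) (*-congˡ f) ⟩
      (s ^ u * s ^ l * s ^ l′) * (s ^ t * (x′ * s ^ k)) + (s ^ t * s ^ k * s ^ k′) * (s ^ u * (y′ * s ^ l))
        ≈⟨ r′ (s ^ t) (s ^ u) x′ (s ^ l′) y′ (s ^ k′) (s ^ k) (s ^ l) ⟨
      (s ^ t * s ^ u) * ((x′ * s ^ l′ + y′ * s ^ k′) * (s ^ k * s ^ l))
        ≈⟨ *-cong (^-homo-* s t u) (*-congˡ (^-homo-* s k l)) ⟨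
      s ^ (t ℕ.+ u) * ((x′ * s ^ l′ + y′ * s ^ k′) * s ^ (k ℕ.+ l)) ∎)
      where
      r : ∀ T U x L y K K′ L′ → (T * U) * ((x * L + y * K) * (K′ * L′))
          ≈ (U * L * L′) * (T * (x * K′)) + (T * K * K′) * (U * (y * L′))
      r = solve 8 (λ T U x L y K K′ L′ →
        (T :* U) :* ((x :* L :+ y :* K) :* (K′ :* L′))
        := (U :* L :* L′) :* (T :* (x :* K′)) :+ (T :* K :* K′) :* (U :* (y :* L′))) ≈-refl
      r′ : ∀ T U x L y K K′ L′ → (T * U) * ((x * L + y * K) * (K′ * L′))
          ≈ (U * L′ * L) * (T * (x * K′)) + (T * K′ * K) * (U * (y * L′))
      r′ = solve 8 (λ T U x L y K K′ L′ →
        (T :* U) :* ((x :* L :+ y :* K) :* (K′ :* L′))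
        := (U :* L′ :* L) :* (T :* (x :* K′)) :+ (T :* K′ :* K) :* (U :* (y :* L′))) ≈-refl

    ⊗-cong : ∀ {x x′ y y′} → x ≃ x′ → y ≃ y′ → (x ⊗ y) ≃ (x′ ⊗ y′)
    ⊗-cong {x /s^ k} {x′ /s^ k′} {y /s^ l} {y′ /s^ l′} (equal t e) (equal u f) = equal (t ℕ.+ u) (begin
      s ^ (t ℕ.+ u) * ((x * y) * s ^ (k′ ℕ.+ l′))
        ≈⟨ *-cong (^-homo-* s t u) (*-congˡ (^-homo-* s k′ l′)) ⟩
      (s ^ t * s ^ u) * ((x * y) * (s ^ k′ * s ^ l′))
        ≈⟨ r (s ^ t) (s ^ u) x y (s ^ k′) (s ^ l′) ⟩
      (s ^ t * (x * s ^ k′)) * (s ^ u * (y * s ^ l′))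
        ≈⟨ *-cong e f ⟩
      (s ^ t * (x′ * s ^ k)) * (s ^ u * (y′ * s ^ l))
        ≈⟨ r (s ^ t) (s ^ u) x′ y′ (s ^ k) (s ^ l) ⟨
      (s ^ t * s ^ u) * ((x′ * y′) * (s ^ k * s ^ l))
        ≈⟨ *-cong (^-homo-* s t u) (*-congˡ (^-homo-* s k l)) ⟨
      s ^ (t ℕ.+ u) * ((x′ * y′) * s ^ (k ℕ.+ l)) ∎)
      where
      r : ∀ T U x y K L → (T * U) * ((x * y) * (K * L)) ≈ (T * (x * K)) * (U * (y * L))
      r = solve 6 (λ T U x y K L →
        (T :* U) :* ((x :* y) :* (K :* L))
        := (T :* (x :* K)) :* (U :* (y :* L))) ≈-refl

    ⊖-cong : ∀ {x x′} → x ≃ x′ → (⊖ x) ≃ (⊖ x′)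
    ⊖-cong {x /s^ k} {x′ /s^ k′} (equal t e) = equal t (begin
      s ^ t * (- x * s ^ k′)     ≈⟨ *-congˡ (-‿distribˡ-* x (s ^ k′)) ⟨
      s ^ t * (- (x * s ^ k′))   ≈⟨ -‿distribʳ-* (s ^ t) (x * s ^ k′) ⟨
      - (s ^ t * (x * s ^ k′))   ≈⟨ -‿cong e ⟩
      - (s ^ t * (x′ * s ^ k))   ≈⟨ -‿distribʳ-* (s ^ t) (x′ * s ^ k) ⟩
      s ^ t * (- (x′ * s ^ k))   ≈⟨ *-congˡ (-‿distribˡ-* x′ (s ^ k)) ⟩
      s ^ t * (- x′ * s ^ k)     ∎)

    ⊕-assoc : ∀ x y z → ((x ⊕ y) ⊕ z) ≃ (x ⊕ (y ⊕ z))
    ⊕-assoc (x /s^ k) (y /s^ l) (z /s^ m) = cross (begin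
      ((x * s ^ l + y * s ^ k) * s ^ m + z * s ^ (k ℕ.+ l)) * s ^ (k ℕ.+ (l ℕ.+ m))
        ≈⟨ *-cong (+-congˡ (*-congˡ (^-homo-* s k l)))
                  (≈-trans (^-homo-* s k (l ℕ.+ m)) (*-congˡ (^-homo-* s l m))) ⟩
      ((x * s ^ l + y * s ^ k) * s ^ m + z * (s ^ k * s ^ l)) * (s ^ k * (s ^ l * s ^ m))
        ≈⟨ r x y z (s ^ k) (s ^ l) (s ^ m) ⟩
      (x * (s ^ l * s ^ m) + (y * s ^ m + z * s ^ l) * s ^ k) * ((s ^ k * s ^ l) * s ^ m)
        ≈⟨ *-cong (+-congʳ (*-congˡ (^-homo-* s l m)))
                  (≈-trans (^-homo-* s (k ℕ.+ l) m) (*-congʳ (^-homo-* s k l))) ⟨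
      (x * s ^ (l ℕ.+ m) + (y * s ^ m + z * s ^ l) * s ^ k) * s ^ ((k ℕ.+ l) ℕ.+ m) ∎)
      where
      r : ∀ x y z K L M → ((x * L + y * K) * M + z * (K * L)) * (K * (L * M))
          ≈ (x * (L * M) + (y * M + z * L) * K) * ((K * L) * M)
      r = solve 6 (λ x y z K L M →
        ((x :* L :+ y :* K) :* M :+ z :* (K :* L)) :* (K :* (L :* M))
        := (x :* (L :* M) :+ (y :* M :+ z :* L) :* K) :* ((K :* L) :* M)) ≈-refl

    ⊗-assoc : ∀ x y z → ((x ⊗ y) ⊗ z) ≃ (x ⊗ (y ⊗ z))
    ⊗-assoc (x /s^ k) (y /s^ l) (z /s^ m) = cross (begin
      ((x * y) * z) * s ^ (k ℕ.+ (l ℕ.+ m))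
        ≈⟨ *-congˡ (≈-trans (^-homo-* s k (l ℕ.+ m)) (*-congˡ (^-homo-* s l m))) ⟩
      ((x * y) * z) * (s ^ k * (s ^ l * s ^ m))
        ≈⟨ r x y z (s ^ k) (s ^ l) (s ^ m) ⟩
      (x * (y * z)) * ((s ^ k * s ^ l) * s ^ m)
        ≈⟨ *-congˡ (≈-trans (^-homo-* s (k ℕ.+ l) m) (*-congʳ (^-homo-* s k l))) ⟨
      (x * (y * z)) * s ^ ((k ℕ.+ l) ℕ.+ m) ∎)
      where
      r : ∀ x y z K L M → ((x * y) * z) * (K * (L * M)) ≈ (x * (y * z)) * ((K * L) * M)
      r = solve 6 (λ x y z K L M →
        ((x :* y) :* z) :* (K :* (L :* M))
        := (x :* (y :* z)) :* ((K :* L) :* M)) ≈-refl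

    ⊕-comm : ∀ x y → (x ⊕ y) ≃ (y ⊕ x)
    ⊕-comm (x /s^ k) (y /s^ l) = cross (begin
      (x * s ^ l + y * s ^ k) * s ^ (l ℕ.+ k)     ≈⟨ *-congˡ (^-homo-* s l k) ⟩
      (x * s ^ l + y * s ^ k) * (s ^ l * s ^ k)   ≈⟨ r x y (s ^ k) (s ^ l) ⟩
      (y * s ^ k + x * s ^ l) * (s ^ k * s ^ l)   ≈⟨ *-congˡ (^-homo-* s k l) ⟨
      (y * s ^ k + x * s ^ l) * s ^ (k ℕ.+ l)     ∎)
      where
      r : ∀ x y K L → (x * L + y * K) * (L * K) ≈ (y * K + x * L) * (K * L)
      r = solve 4 (λ x y K L →
        (x :* L :+ y :* K) :* (L :* K)
        := (y :* K :+ x :* L) :* (K :* L)) ≈-refl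

    ⊗-comm : ∀ x y → (x ⊗ y) ≃ (y ⊗ x)
    ⊗-comm (x /s^ k) (y /s^ l) = cross (begin
      (x * y) * s ^ (l ℕ.+ k)     ≈⟨ *-congˡ (^-homo-* s l k) ⟩
      (x * y) * (s ^ l * s ^ k)   ≈⟨ r x y (s ^ k) (s ^ l) ⟩
      (y * x) * (s ^ k * s ^ l)   ≈⟨ *-congˡ (^-homo-* s k l) ⟨
      (y * x) * s ^ (k ℕ.+ l)     ∎)
      where
      r : ∀ x y K L → (x * y) * (L * K) ≈ (y * x) * (K * L)
      r = solve 4 (λ x y K L →
        (x :* y) :* (L :* K)
        := (y :* x) :* (K :* L)) ≈-refl

    ⊕-identityˡ : ∀ x → ((0# /s^ 0) ⊕ x) ≃ x
    ⊕-identityˡ (x /s^ k) = cross (*-congʳ (begin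
      0# * s ^ k + x * 1#   ≈⟨ +-cong (zeroˡ (s ^ k)) (*-identityʳ x) ⟩
      0# + x                ≈⟨ +-identityˡ x ⟩
      x                     ∎))

    ⊗-identityˡ : ∀ x → ((1# /s^ 0) ⊗ x) ≃ x
    ⊗-identityˡ (x /s^ k) = cross (*-congʳ (*-identityˡ x))

    ⊖-inverseˡ : ∀ x → ((⊖ x) ⊕ x) ≃ (0# /s^ 0)
    ⊖-inverseˡ (x /s^ k) = cross (begin
      (- x * s ^ k + x * s ^ k) * 1#   ≈⟨ *-identityʳ _ ⟩
      - x * s ^ k + x * s ^ k          ≈⟨ distribʳ (s ^ k) (- x) x ⟨
      (- x + x) * s ^ k                ≈⟨ *-congʳ (-‿inverseˡ x) ⟩
      0# * s ^ k                       ≈⟨ zeroˡ (s ^ k) ⟩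
      0#                               ≈⟨ zeroˡ (s ^ (k ℕ.+ k)) ⟨
      0# * s ^ (k ℕ.+ k)               ∎)

    ⊗-distribʳ-⊕ : ∀ x y z → ((y ⊕ z) ⊗ x) ≃ ((y ⊗ x) ⊕ (z ⊗ x))
    ⊗-distribʳ-⊕ (x /s^ k) (y /s^ l) (z /s^ m) = cross (begin
      ((y * s ^ m + z * s ^ l) * x) * s ^ ((l ℕ.+ k) ℕ.+ (m ℕ.+ k))
        ≈⟨ *-congˡ (≈-trans (^-homo-* s (l ℕ.+ k) (m ℕ.+ k))
                            (*-cong (^-homo-* s l k) (^-homo-* s m k))) ⟩
      ((y * s ^ m + z * s ^ l) * x) * ((s ^ l * s ^ k) * (s ^ m * s ^ k))
        ≈⟨ r x y z (s ^ k) (s ^ l) (s ^ m) ⟩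
      ((y * x) * (s ^ m * s ^ k) + (z * x) * (s ^ l * s ^ k)) * ((s ^ l * s ^ m) * s ^ k)
        ≈⟨ *-cong (+-cong (*-congˡ (^-homo-* s m k)) (*-congˡ (^-homo-* s l k)))
                  (≈-trans (^-homo-* s (l ℕ.+ m) k) (*-congʳ (^-homo-* s l m))) ⟨
      ((y * x) * s ^ (m ℕ.+ k) + (z * x) * s ^ (l ℕ.+ k)) * s ^ ((l ℕ.+ m) ℕ.+ k) ∎)
      where
      r : ∀ x y z K L M → ((y * M + z * L) * x) * ((L * K) * (M * K))
          ≈ ((y * x) * (M * K) + (z * x) * (L * K)) * ((L * M) * K)
      r = solve 6 (λ x y z K L M →
        ((y :* M :+ z :* L) :* x) :* ((L :* K) :* (M :* K))
        := ((y :* x) :* (M :* K) :+ (z :* x) :* (L :* K)) :* ((L :* M) :* K)) ≈-refl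

  commutativeRing : CommutativeRing c ℓ
  commutativeRing = record
    { Carrier = Fraction
    ; _≈_ = _≃_
    ; _+_ = _⊕_
    ; _*_ = _⊗_
    ; -_  = ⊖_
    ; 0#  = 0# /s^ 0
    ; 1#  = 1# /s^ 0
    ; isCommutativeRing = record
      { isRing = record
        { +-isAbelianGroup = record
          { isGroup = record
            { isMonoid = record
              { isSemigroup = record
                { isMagma = record
                  { isEquivalence = record
                    { refl = ≃-refl ; sym = ≃-sym ; trans = ≃-trans }
                  ; ∙-cong = ⊕-cong
                  }
                ; assoc = ⊕-assoc
                }
              ; identity = ⊕-identityˡ
                         , λ x → ≃-trans (⊕-comm x (0# /s^ 0)) (⊕-identityˡ x)
              }
            ; inverse = ⊖-inverseˡ
                      , λ x → ≃-trans (⊕-comm x (⊖ x)) (⊖-inverseˡ x)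
            ; ⁻¹-cong = ⊖-cong
            }
          ; comm = ⊕-comm
          }
        ; *-cong = ⊗-cong
        ; *-assoc = ⊗-assoc
        ; *-identity = ⊗-identityˡ
                     , λ x → ≃-trans (⊗-comm x (1# /s^ 0)) (⊗-identityˡ x)
        ; distrib = (λ x y z → ≃-trans (⊗-comm x (y ⊕ z))
                                 (≃-trans (⊗-distribʳ-⊕ x y z)
                                   (⊕-cong (⊗-comm y x) (⊗-comm z x))))
                  , ⊗-distribʳ-⊕
        }
      ; *-comm = ⊗-comm
      }
    }

-- ℤₚ is the inverse limit of the rings ℤ/pⁿ, an element of which is
-- represented by an integer.

module _ (p : ℕ) where

  record Coherent : Set where
    field
      approx   : ℕ → ℤ
      coherent : ∀ n → + (p ℕ.^ n) ∣ approx (suc n) ℤ.- approx n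

  open Coherent

  infix 4 _≋_
  record _≋_ (x y : Coherent) : Set where
    constructor congruent
    field
      at : ∀ n → + (p ℕ.^ n) ∣ approx x n ℤ.- approx y n

  open _≋_

  private
    ∣-resp : ∀ {d i j} → i ≡ j → d ∣ i → d ∣ j
    ∣-resp refl d = d

    ∣0 : ∀ {d} → d ∣ ℤ.0ℤ
    ∣0 = divides ℤ.0ℤ refl

    ∣self : ∀ {d} i → d ∣ i ℤ.- i
    ∣self i = ∣-resp (sym (ℤ-props.+-inverseʳ i)) ∣0

    pointwise : ∀ {x y} → (∀ n → approx x n ≡ approx y n) → x ≋ y
    pointwise {x} {y} eq = congruent λ n →
      ∣-resp (cong (ℤ._- approx y n) (sym (eq n))) (∣self (approx y n))

    +-lemma : ∀ {d} i i′ j j′ → d ∣ i ℤ.- i′ → d ∣ j ℤ.- j′ →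
              d ∣ (i ℤ.+ j) ℤ.- (i′ ℤ.+ j′)
    +-lemma i i′ j j′ e f = ∣-resp (r i i′ j j′) (∣m∣n⇒∣m+n e f)
      where
      r : ∀ i i′ j j′ → (i ℤ.- i′) ℤ.+ (j ℤ.- j′) ≡ (i ℤ.+ j) ℤ.- (i′ ℤ.+ j′)
      r = ℤ-Solver.solve-∀

    *-lemma : ∀ {d} i i′ j j′ → d ∣ i ℤ.- i′ → d ∣ j ℤ.- j′ →
              d ∣ (i ℤ.* j) ℤ.- (i′ ℤ.* j′)
    *-lemma i i′ j j′ e f =
      ∣-resp (r i i′ j j′) (∣m∣n⇒∣m+n (∣m⇒∣m*n j e) (∣n⇒∣m*n i′ f))
      where
      r : ∀ i i′ j j′ →
          (i ℤ.- i′) ℤ.* j ℤ.+ i′ ℤ.* (j ℤ.- j′) ≡ (i ℤ.* j) ℤ.- (i′ ℤ.* j′)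
      r = ℤ-Solver.solve-∀

    neg-lemma : ∀ {d} i i′ → d ∣ i ℤ.- i′ → d ∣ (ℤ.- i) ℤ.- (ℤ.- i′)
    neg-lemma i i′ e = ∣-resp (r i i′) (∣m⇒∣-m e)
      where
      r : ∀ i i′ → ℤ.- (i ℤ.- i′) ≡ (ℤ.- i) ℤ.- (ℤ.- i′)
      r = ℤ-Solver.solve-∀

    sym-lemma : ∀ {d} i j → d ∣ i ℤ.- j → d ∣ j ℤ.- i
    sym-lemma i j e = ∣-resp (r i j) (∣m⇒∣-m e)
      where
      r : ∀ i j → ℤ.- (i ℤ.- j) ≡ j ℤ.- i
      r = ℤ-Solver.solve-∀

    trans-lemma : ∀ {d} i j k → d ∣ i ℤ.- j → d ∣ j ℤ.- k → d ∣ i ℤ.- k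
    trans-lemma i j k e f = ∣-resp (r i j k) (∣m∣n⇒∣m+n e f)
      where
      r : ∀ i j k → (i ℤ.- j) ℤ.+ (j ℤ.- k) ≡ i ℤ.- k
      r = ℤ-Solver.solve-∀

  fromℤ : ℤ → Coherent
  fromℤ i = record { approx = λ _ → i ; coherent = λ _ → ∣self i }

  ℤₚ : CommutativeRing 0ℓ 0ℓ
  ℤₚ = record
    { Carrier = Coherent
    ; _≈_ = _≋_
    ; _+_ = add
    ; _*_ = mul
    ; -_  = neg
    ; 0#  = fromℤ ℤ.0ℤ
    ; 1#  = fromℤ ℤ.1ℤ
    ; isCommutativeRing = record
      { isRing = record
        { +-isAbelianGroup = record
          { isGroup = record
            { isMonoid = record
              { isSemigroup = record
                { isMagma = record
                  { isEquivalence = record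
                    { refl  = λ {x} → congruent λ n → ∣self (approx x n)
                    ; sym   = λ {x} {y} e → congruent λ n → sym-lemma (approx x n) (approx y n) (at e n)
                    ; trans = λ {x} {y} {z} e f → congruent λ n →
                        trans-lemma (approx x n) (approx y n) (approx z n) (at e n) (at f n)
                    }
                  ; ∙-cong = λ {x} {x′} {y} {y′} e f → congruent λ n →
                      +-lemma (approx x n) (approx x′ n) (approx y n) (approx y′ n) (at e n) (at f n)
                  }
                ; assoc = λ x y z → pointwise λ n →
                    ℤ-props.+-assoc (approx x n) (approx y n) (approx z n)
                }
              ; identity = (λ x → pointwise λ n →
                              ℤ-props.+-identityˡ (approx x n))
                         , (λ x → pointwise λ n →
                              ℤ-props.+-identityʳ (approx x n))
              }
            ; inverse = (λ x → pointwise λ n →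
                           ℤ-props.+-inverseˡ (approx x n))
                      , (λ x → pointwise λ n →
                           ℤ-props.+-inverseʳ (approx x n))
            ; ⁻¹-cong = λ {x} {x′} e → congruent λ n → neg-lemma (approx x n) (approx x′ n) (at e n)
            }
          ; comm = λ x y → pointwise λ n →
              ℤ-props.+-comm (approx x n) (approx y n)
          }
        ; *-cong = λ {x} {x′} {y} {y′} e f → congruent λ n →
            *-lemma (approx x n) (approx x′ n) (approx y n) (approx y′ n) (at e n) (at f n)
        ; *-assoc = λ x y z → pointwise λ n →
            ℤ-props.*-assoc (approx x n) (approx y n) (approx z n)
        ; *-identity = (λ x → pointwise λ n →
                          ℤ-props.*-identityˡ (approx x n))
                     , (λ x → pointwise λ n →
                          ℤ-props.*-identityʳ (approx x n))
        ; distrib = (λ x y z → pointwise λ n →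
                       ℤ-props.*-distribˡ-+ (approx x n) (approx y n) (approx z n))
                  , (λ x y z → pointwise λ n →
                       ℤ-props.*-distribʳ-+ (approx x n) (approx y n) (approx z n))
        }
      ; *-comm = λ x y → pointwise λ n →
          ℤ-props.*-comm (approx x n) (approx y n)
      }
    }
    where
    add mul : Coherent → Coherent → Coherent
    add x y = record
      { approx   = λ n → approx x n ℤ.+ approx y n
      ; coherent = λ n → +-lemma (approx x (suc n)) (approx x n) (approx y (suc n)) (approx y n)
                           (coherent x n) (coherent y n)
      }
    mul x y = record
      { approx   = λ n → approx x n ℤ.* approx y n
      ; coherent = λ n → *-lemma (approx x (suc n)) (approx x n) (approx y (suc n)) (approx y n)
                           (coherent x n) (coherent y n)
      }
    neg : Coherent → Coherent
    neg x = record
      { approx   = λ n → ℤ.- approx x n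
      ; coherent = λ n → neg-lemma (approx x (suc n)) (approx x n) (coherent x n)
      }

  -- For p prime, inverting p in ℤₚ gives its field of fractions.
  ℚₚ : CommutativeRing 0ℓ 0ℓ
  ℚₚ = Localisation.commutativeRing ℤₚ (fromℤ (+ p))

-- ⊥₋ stands for the real number 0, and [ q ] for p^q.  Every absolute
-- value on a finite extension of ℚₚ that extends the p-adic one takes
-- values of this form only.  As p > 1, the order is that of exponents.

Value : Set
Value = ℚ ₋

pattern 𝟘    = ⊥₋
pattern p^ q = [ q ]

open NonStrict ℚ._≤_ public using () renaming (_≤₋_ to _≤ᵛ_)
open Strict    ℚ._<_ public using () renaming (_<₋_ to _<ᵛ_)

𝟙 : Value
𝟙 = p^ 0ℚ

infixl 7 _·_
_·_ : Value → Value → Value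
𝟘    · _    = 𝟘
p^ _ · 𝟘    = 𝟘
p^ q · p^ r = p^ (q ℚ.+ r)

-- x HasPadicAbs v  means  |x| = v  for the p-adic absolute value on ℚₚ,
-- normalised by |p| = p⁻¹.  This is a relation because whether a p-adic
-- number vanishes is undecidable.

module _ (p : ℕ) where

  private
    module ℤₚ = CommutativeRing (ℤₚ p)
    module ℚₚ = CommutativeRing (ℚₚ p)
  open Localisation (ℤₚ p) (fromℤ p (+ p)) using (_/s^_)
  open Exp ℤₚ.semiring using (_^_)

  data _HasPadicAbs_ (x : ℚₚ.Carrier) : Value → Set where
    zero-abs : x ℚₚ.≈ ℚₚ.0# → x HasPadicAbs 𝟘
    unit-abs : ∀ n k (u w : ℤₚ.Carrier) → u ℤₚ.* w ℤₚ.≈ ℤₚ.1# →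
               x ℚₚ.≈ (fromℤ p (+ p) ^ n ℤₚ.* u) /s^ k →
               x HasPadicAbs p^ ((+ k ℤ.- + n) ℚ./ 1)

IsField : CommutativeRing c ℓ → Set (c ⊔ ℓ)
IsField R = ¬ (0# ≈ 1#) × (∀ x → ¬ (x ≈ 0#) → ∃ λ y → x * y ≈ 1#)
  where open CommutativeRing R

record IsAbsoluteValue (R : CommutativeRing c ℓ)
                       (∣_∣ : CommutativeRing.Carrier R → Value) : Set (c ⊔ ℓ) where
  open CommutativeRing R
  field
    cong-abs    : ∀ {x y} → x ≈ y → ∣ x ∣ ≡ ∣ y ∣
    abs-0       : ∣ 0# ∣ ≡ 𝟘
    abs≡0⇒≈0    : ∀ x → ∣ x ∣ ≡ 𝟘 → x ≈ 0#
    abs-*       : ∀ x y → ∣ x * y ∣ ≡ ∣ x ∣ · ∣ y ∣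
    ultrametric : ∀ x y → (∣ x + y ∣ ≤ᵛ ∣ x ∣) ⊎ (∣ x + y ∣ ≤ᵛ ∣ y ∣)

module Extension (A : CommutativeRing a ℓ₁) (B : CommutativeRing b ℓ₂)
                 (φ : CommutativeRing.Carrier A → CommutativeRing.Carrier B) where

  private module A = CommutativeRing A
  open CommutativeRing B
  open RawMonoidDefs +-rawMonoid using (sum)

  IsHom : Set (a ⊔ ℓ₁ ⊔ ℓ₂)
  IsHom = RingMorphisms.IsRingHomomorphism A.rawRing rawRing φ

  IsBasis : ∀ {n} → (Fin n → Carrier) → Set (a ⊔ ℓ₁ ⊔ b ⊔ ℓ₂)
  IsBasis {n} u = ∀ x →
    ∃! {A = Fin n → A.Carrier} (λ r s → ∀ i → r i A.≈ s i)
       (λ r → x ≈ sum (λ i → φ (r i) * u i))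

  HasDegree : ℕ → Set (a ⊔ ℓ₁ ⊔ b ⊔ ℓ₂)
  HasDegree n = Σ (Fin n → Carrier) IsBasis

  -- the smallest subfield of B containing the image of A and g
  data Adjoin (g : Carrier) : Carrier → Set (a ⊔ b ⊔ ℓ₂) where
    base : ∀ r → Adjoin g (φ r)
    gen  : Adjoin g g
    add  : ∀ {x y} → Adjoin g x → Adjoin g y → Adjoin g (x + y)
    mul  : ∀ {x y} → Adjoin g x → Adjoin g y → Adjoin g (x * y)
    neg  : ∀ {x} → Adjoin g x → Adjoin g (- x)
    inv  : ∀ {x y} → x * y ≈ 1# → Adjoin g x → Adjoin g y
    resp : ∀ {x y} → x ≈ y → Adjoin g x → Adjoin g y

  GeneratedBy : Carrier → Set (a ⊔ b ⊔ ℓ₂)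
  GeneratedBy g = ∀ x → Adjoin g x

IsPrimitiveRoot : (R : CommutativeRing c ℓ) → ℕ → CommutativeRing.Carrier R → Set ℓ
IsPrimitiveRoot R n x = (x ^ n ≈ 1#) × (∀ k → 0 ℕ.< k → k ℕ.< n → ¬ (x ^ k ≈ 1#))
  where
  open CommutativeRing R
  open Exp semiring using (_^_)

module _ (p : ℕ) where

  private module ℚₚ = CommutativeRing (ℚₚ p)

  record FiniteExtension (c ℓ : Level) : Set (lsuc (c ⊔ ℓ)) where
    field
      ring      : CommutativeRing c ℓ
      isField   : IsField ring
      ι         : ℚₚ.Carrier → CommutativeRing.Carrier ring
      ι-isHom   : Extension.IsHom (ℚₚ p) ring ι
      degree    : ℕ
      hasDegree : Extension.HasDegree (ℚₚ p) ring ι degree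
    open CommutativeRing ring public hiding (ring)

  module _ (F : FiniteExtension c ℓ) (∣_∣ : FiniteExtension.Carrier F → Value) where

    open FiniteExtension F
    open RawMonoidDefs +-rawMonoid using (sum) renaming (_×_ to _•_)

    -- The index of |ℚₚˣ| in |Fˣ| is n: the |t i| are representatives of
    -- the cosets.
    HasRamificationIndex : ℕ → Set (c ⊔ ℓ)
    HasRamificationIndex n = ∃ λ (t : Fin n → Carrier) →
      (∀ i → ¬ (t i ≈ 0#)) ×
      (∀ x → ¬ (x ≈ 0#) →
        ∃! _≡_ λ i → ∃ λ y → ¬ (y ℚₚ.≈ ℚₚ.0#) × ∣ x ∣ ≡ ∣ t i ∣ · ∣ ι y ∣)

    -- The residue field {|x| ≤ 1}/{|x| < 1} has dimension n over 𝔽ₚ: the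
    -- classes of the u i form a basis, where Fin p stands for 𝔽ₚ and acts
    -- by repeated addition.
    HasResidueDegree : ℕ → Set c
    HasResidueDegree n = ∃ λ (u : Fin n → Carrier) →
      (∀ i → ∣ u i ∣ ≤ᵛ 𝟙) ×
      (∀ x → ∣ x ∣ ≤ᵛ 𝟙 →
        ∃! {A = Fin n → Fin p} (λ r s → ∀ i → r i ≡ s i)
           (λ r → ∣ x - sum (λ i → toℕ (r i) • u i) ∣ <ᵛ 𝟙))

  record Setting (c ℓ : Level) : Set (lsuc (c ⊔ ℓ)) where
    field
      K : FiniteExtension c ℓ
    private module K = FiniteExtension K
    field
      ∣_∣             : K.Carrier → Value
      isAbsoluteValue : IsAbsoluteValue K.ring ∣_∣
      extends-padic   : ∀ x → _HasPadicAbs_ p x ∣ K.ι x ∣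

      e f : ℕ
      {{e-nonZero}} : NonZero e
      ramificationIndex : HasRamificationIndex K ∣_∣ e
      residueDegree     : HasResidueDegree K ∣_∣ f

      L : FiniteExtension c ℓ
    private module L = FiniteExtension L
    field
      incl         : L.Carrier → K.Carrier
      incl-isHom   : Extension.IsHom L.ring K.ring incl
      incl-ι       : ∀ x → incl (L.ι x) K.≈ K.ι x
      L-degree     : L.degree ≡ f
      L-unramified : HasRamificationIndex L (λ x → ∣ incl x ∣) 1

      γ           : L.Carrier
      γ-primitive : IsPrimitiveRoot L.ring (p ℕ.^ f ℕ.∸ 1) γ
      L≡ℚₚ⟨γ⟩     : Extension.GeneratedBy (ℚₚ p) L.ring L.ι γ

      β      : K.Carrier
      K≡L⟨β⟩ : Extension.GeneratedBy L.ring K.ring incl β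
      abs-β  : ∣ β ∣ ≡ p^ (+ 1 ℚ./ e)

data DigitSystem (p : ℕ) : Set where
  standard : DigitSystem p
  balanced : ¬ (2 ℕ∣.∣ p) → DigitSystem p

_∈ᴰ_ : ∀ {p} → ℤ → DigitSystem p → Set
_∈ᴰ_ {p} d standard     = (+ 0 ℤ.≤ d) × (d ℤ.≤ + (p ℕ.∸ 1))
_∈ᴰ_ {p} d (balanced _) = (ℤ.- (+ ((p ℕ.∸ 1) ℕ/./ 2)) ℤ.≤ d) × (d ℤ.≤ + ((p ℕ.∸ 1) ℕ/./ 2))

module _ {p : ℕ} (D : DigitSystem p) where

  private
    module ℚₚ = CommutativeRing (ℚₚ p)
    module ℤₚ = CommutativeRing (ℤₚ p)
  open Localisation (ℤₚ p) (fromℤ p (+ p)) using (_/s^_)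
  open Exp ℚₚ.semiring using (_^_)
  open RawMonoidDefs ℚₚ.+-rawMonoid using (sum)

  X : ℚₚ.Carrier → Set
  X x = ∃ λ k → ∃ λ (d : Fin (suc k) → ℤ) → (∀ j → d j ∈ᴰ D) ×
    x ℚₚ.≈ sum (λ j → (fromℤ p (d j) /s^ 0) ℚₚ.* (ℤₚ.1# /s^ 1) ^ toℕ j)

module ContinuedFractions {p : ℕ} (S : Setting p c ℓ) (D : DigitSystem p) where

  open Setting S
  open FiniteExtension K
  open RawMonoidDefs +-rawMonoid using (sum)
  open Exp semiring using (_^_)

  Z : Carrier → Set ℓ
  Z z = ∃ λ (b : Fin e → Fin f → CommutativeRing.Carrier (ℚₚ p)) →
    (∀ i j → X D (b i j)) ×
    z ≈ sum (λ i → sum (λ j → ι (b i j) * incl γ ^ toℕ j * β ^ toℕ i))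

  Z* : Carrier → Set ℓ
  Z* z = Z z × (𝟙 <ᵛ ∣ z ∣)

  -- x ≈[ c₀ ⨾ c₁ , … , cₙ ]:  the continued fraction is defined (no
  -- denominator vanishes) and has value x.
  infix 4 _≈[_⨾_]
  _≈[_⨾_] : Carrier → Carrier → List Carrier → Set (c ⊔ ℓ)
  x ≈[ c₀ ⨾ [] ]      = Lift c (x ≈ c₀)
  x ≈[ c₀ ⨾ c₁ ∷ cs ] = ∃₂ λ y y⁻¹ → y ≈[ c₁ ⨾ cs ] × y * y⁻¹ ≈ 1# × x ≈ c₀ + y⁻¹

  _ConvergesTo_ : (ℕ → Carrier) → Carrier → Set
  s ConvergesTo x = ∀ q → ∃ λ N → ∀ n → N ℕ.≤ n → ∣ s n - x ∣ <ᵛ p^ q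

  data Sequence : Set c where
    finite   : List⁺ Carrier → Sequence
    infinite : (ℕ → Carrier) → Sequence

  data _≈ˢ_ : Sequence → Sequence → Set (c ⊔ ℓ) where
    finite   : ∀ {x y xs ys} → x ≈ y → Pointwise _≈_ xs ys →
               finite (x ∷ xs) ≈ˢ finite (y ∷ ys)
    infinite : ∀ {s t} → (∀ n → s n ≈ t n) → infinite s ≈ˢ infinite t

  Admissible : Sequence → Set (c ⊔ ℓ)
  Admissible (finite (c₀ ∷ cs)) = Z c₀ × All Z* cs
  Admissible (infinite s)       = Lift c (Z (s 0) × (∀ j → Z* (s (suc j))))

  Represents : Sequence → Carrier → Set (c ⊔ ℓ)
  Represents (finite (c₀ ∷ cs)) α = α ≈[ c₀ ⨾ cs ]
  Represents (infinite s)       α = ∃ λ (v : ℕ → Carrier) →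
    (∀ n → v n ≈[ s 0 ⨾ applyUpTo (s ∘ suc) n ]) × v ConvergesTo α

  IsContinuedFractionOf : Carrier → Sequence → Set (c ⊔ ℓ)
  IsContinuedFractionOf α s = Admissible s × Represents s α

module Submission where

open import Defs
open import Algebra.Bundles using (CommutativeRing)
import Algebra.Definitions.RawMonoid as RawMonoidDefs
open import Algebra.Morphism.Structures using (module RingMorphisms)
import Algebra.Properties.CommutativeMonoid.Sum as CommMonoidSum
import Algebra.Properties.CommutativeSemiring.Exp as CommExp
import Algebra.Properties.Group as GroupProperties
import Algebra.Properties.Ring as RingProperties
import Algebra.Properties.Semiring.Exp as Exp
import Algebra.Properties.Semiring.Sum as SemiringSum
import Algebra.Solver.Ring
open import Algebra.Solver.Ring.AlmostCommutativeRing using (fromCommutativeRing; _-Raw-AlmostCommutative⟶_)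
import Algebra.Solver.Ring.NaturalCoefficients.Default as NatSolver
open import Data.Fin.Base as Fin using (Fin; zero; suc; toℕ; punchOut; funToFin; finToFun)
import Data.Fin.Properties as Fin
open import Data.Integer.Base as ℤ using (ℤ; +_; -[1+_])
import Data.Integer.DivMod as ℤ/
import Data.Integer.Divisibility.Signed as ℤ∣
import Data.Integer.Properties as ℤ
import Data.Integer.Tactic.RingSolver as ℤ-Solver
open import Data.List.Base using (List; []; _∷_; applyUpTo)
open import Data.List.NonEmpty.Base using (_∷_)
open import Data.List.Relation.Binary.Pointwise.Base using (Pointwise; []; _∷_)
open import Data.List.Relation.Unary.All using (All; []; _∷_)
import Data.List.Relation.Unary.All.Properties as All
import Data.Maybe.Base as Maybe
open import Data.Nat.Base as ℕ using (ℕ; zero; suc; NonZero)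
import Data.Nat.Coprimality as Coprimality
import Data.Nat.DivMod as ℕ/
import Data.Nat.Divisibility as ℕ∣
import Data.Nat.GCD as GCD
open import Data.Nat.Primality using (Prime; prime⇒nonZero; prime⇒nonTrivial; prime⇒irreducible)
import Data.Nat.Properties as ℕ
open import Data.Product using (∃; ∃₂; ∃!; _×_; _,_; proj₁; proj₂)
open import Data.Rational.Base as ℚ using (mkℚ; 0ℚ)
import Data.Rational.Properties as ℚ
open import Data.Rational.Unnormalised.Base as ℚᵘ using (mkℚᵘ; *≡*; *≤*; *<*)
import Data.Rational.Unnormalised.Properties as ℚᵘ
open import Data.Sum.Base using (_⊎_; inj₁; inj₂)
import Data.Vec.Functional as Vector
open import Function.Base using (_∘_; case_of_)
open import Function.Definitions using (Injective)
open import Level using (Level; _⊔_; lift)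
import Relation.Binary.Construct.Add.Infimum.NonStrict as NonStrict
import Relation.Binary.Construct.Add.Infimum.Strict as Strict
open import Relation.Binary.Definitions using (tri<; tri≈; tri>)
open import Relation.Binary.PropositionalEquality as ≡
  using (_≡_; _≢_; _≗_; cong; cong₂; subst; subst₂)
open import Relation.Nullary using (¬_; Dec; yes; no; contradiction)
open import Relation.Nullary.Construct.Add.Infimum using ([_]; []-injective; ≡-dec)
open import Relation.Nullary.Decidable using (map′; decidable-stable; dec⇒maybe)
open import Relation.Unary using (Decidable)

-- Every x ∈ K has a unique floor: exactly one z ∈ Z satisfies |x - z| < 1.  The
-- two conditions |c₀ - x| < 1 and |c₁| > 1 then force the continued fraction
-- algorithm, and it converges because inversion contracts distances outside
-- the unit ball.
--
-- Floors come from digit expansions in β and 1/p over the basis 1, γ, …, γ^(f-1)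
-- of the residue field.  To see that these powers form a basis, note that the
-- p^f elements 0 and γ^k are incongruent; a linear relation among the first f
-- powers would put all of them in a space with fewer elements.  Ramification
-- gives |Kˣ| = p^(ℤ/e), so expanding in β exhausts each block of e values.
--
-- That |·| is a function with explicit values on ℚₚ makes equality in K decidable
-- and even decides whether a sequence of decidable events ever happens (code the
-- events as a p-adic integer); this tells terminating expansions from infinite ones.

-- The hypotheses supply e coset representatives of the value group and f elements of a residue
-- basis, with no stated relation to β and γ, whereas `Z` is written in β and γ. Counting bridges
-- the gap, as an injective self-map of a finite set is onto. The β^i with i < e lie in distinct
-- cosets because their exponents differ modulo e. The powers γ^k are incongruent because p does not
-- divide p^f - 1: if x^n = 1 and x is congruent to 1, then 1 + x + ... + x^(n-1) is congruent to n,
-- so x ≠ 1 would force p to divide n.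
--
-- Uniqueness of floors rests on a gap in sizes. All digits attached to one power of 1/p form a
-- block of size at most p^((e-1)/e), one step short of |1/p|. Removing the lowest block and
-- multiplying by p therefore turns an expansion of size below 1 into a shorter one of size below 1.
-- Two digits differ by less than p, so congruent digits are equal.

private variable c ℓ : Level

-- Exponents and values

+-/ : ∀ e .{{_ : NonZero e}} a b → (a ℚ./ e) ℚ.+ (b ℚ./ e) ≡ (a ℤ.+ b) ℚ./ e
+-/ (suc e) a b = ℚ.toℚᵘ-injective (begin
  ℚ.toℚᵘ ((a ℚ./ suc e) ℚ.+ (b ℚ./ suc e))
    ≈⟨ ℚ.toℚᵘ-homo-+ (a ℚ./ suc e) (b ℚ./ suc e) ⟩
  ℚ.toℚᵘ (a ℚ./ suc e) ℚᵘ.+ ℚ.toℚᵘ (b ℚ./ suc e)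
    ≈⟨ ℚᵘ.+-cong (ℚ.toℚᵘ-fromℚᵘ (mkℚᵘ a e)) (ℚ.toℚᵘ-fromℚᵘ (mkℚᵘ b e)) ⟩
  mkℚᵘ a e ℚᵘ.+ mkℚᵘ b e
    ≈⟨ *≡* (≡.trans (r a b (+ suc e)) (cong ((a ℤ.+ b) ℤ.*_) (≡.sym (ℤ.pos-* (suc e) (suc e))))) ⟩
  mkℚᵘ (a ℤ.+ b) e
    ≈⟨ ℚ.toℚᵘ-fromℚᵘ (mkℚᵘ (a ℤ.+ b) e) ⟨
  ℚ.toℚᵘ ((a ℤ.+ b) ℚ./ suc e) ∎)
  where
  open ℚᵘ.≃-Reasoning
  r : ∀ a b n → (a ℤ.* n ℤ.+ b ℤ.* n) ℤ.* n ≡ (a ℤ.+ b) ℤ.* (n ℤ.* n)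
  r = ℤ-Solver.solve-∀

/-mono-≤ : ∀ e .{{_ : NonZero e}} {a b} → a ℤ.≤ b → (a ℚ./ e) ℚ.≤ (b ℚ./ e)
/-mono-≤ (suc e) {a} {b} a≤b = ℚ.toℚᵘ-cancel-≤ (begin
  ℚ.toℚᵘ (a ℚ./ suc e) ≃⟨ ℚ.toℚᵘ-fromℚᵘ (mkℚᵘ a e) ⟩
  mkℚᵘ a e             ≤⟨ *≤* (ℤ.*-monoʳ-≤-nonNeg (+ suc e) a≤b) ⟩
  mkℚᵘ b e             ≃⟨ ℚ.toℚᵘ-fromℚᵘ (mkℚᵘ b e) ⟨
  ℚ.toℚᵘ (b ℚ./ suc e) ∎)
  where open ℚᵘ.≤-Reasoning

/-cancel-≤ : ∀ e .{{_ : NonZero e}} {a b} → (a ℚ./ e) ℚ.≤ (b ℚ./ e) → a ℤ.≤ b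
/-cancel-≤ (suc e) {a} {b} le = ℤ.*-cancelʳ-≤-pos a b (+ suc e) (ℚᵘ.drop-*≤* (begin
  mkℚᵘ a e             ≃⟨ ℚ.toℚᵘ-fromℚᵘ (mkℚᵘ a e) ⟨
  ℚ.toℚᵘ (a ℚ./ suc e) ≤⟨ ℚ.toℚᵘ-mono-≤ le ⟩
  ℚ.toℚᵘ (b ℚ./ suc e) ≃⟨ ℚ.toℚᵘ-fromℚᵘ (mkℚᵘ b e) ⟩
  mkℚᵘ b e             ∎))
  where open ℚᵘ.≤-Reasoning

/1≡*/ : ∀ e .{{_ : NonZero e}} a → a ℚ./ 1 ≡ (a ℤ.* + e) ℚ./ e
/1≡*/ (suc e) a = ℚ.fromℚᵘ-cong {mkℚᵘ a 0} {mkℚᵘ (a ℤ.* (+ suc e)) e} (*≡* (≡.sym (ℤ.*-identityʳ _)))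

0/≡0 : ∀ e .{{_ : NonZero e}} → (+ 0) ℚ./ e ≡ 0ℚ
0/≡0 (suc e) = ℚ.fromℚᵘ-cong {mkℚᵘ (+ 0) e} {mkℚᵘ (+ 0) 0} (*≡* ≡.refl)

-- For q = a/d, the choice n = (1 + |a|) e makes -n/e the integer -(1 + |a|), which lies below a/d
-- because |a/d| ≤ |a|.
below : ∀ e .{{_ : NonZero e}} q → ∃ λ n → (ℤ.- (+ n)) ℚ./ e ℚ.< q
below (suc e) q@(mkℚ a d _) = (suc ℤ.∣ a ∣ ℕ.* suc e) , ℚ.toℚᵘ-cancel-< (begin-strict
  ℚ.toℚᵘ ((ℤ.- (+ (suc ℤ.∣ a ∣ ℕ.* suc e))) ℚ./ suc e)
    ≃⟨ ℚ.toℚᵘ-fromℚᵘ (mkℚᵘ (ℤ.- (+ (suc ℤ.∣ a ∣ ℕ.* suc e))) e) ⟩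
  mkℚᵘ (ℤ.- (+ (suc ℤ.∣ a ∣ ℕ.* suc e))) e
    ≃⟨ *≡* (≡.trans (ℤ.*-identityʳ _) (≡.trans (cong ℤ.-_ (ℤ.pos-* (suc ℤ.∣ a ∣) (suc e)))
                                           (ℤ.neg-distribˡ-* (+ suc ℤ.∣ a ∣) (+ suc e)))) ⟩
  mkℚᵘ (ℤ.- (+ suc ℤ.∣ a ∣)) 0
    <⟨ *<* (lemma a) ⟩
  mkℚᵘ a d ∎)
  where
  open ℚᵘ.≤-Reasoning
  lemma : ∀ a → (ℤ.- (+ suc ℤ.∣ a ∣)) ℤ.* + suc d ℤ.< a ℤ.* + 1
  lemma a@(+ n)    = subst ((ℤ.- (+ suc ℤ.∣ a ∣)) ℤ.* + suc d ℤ.<_) (≡.sym (ℤ.*-identityʳ (+ n))) ℤ.-<+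
  lemma a@(-[1+ n ]) = subst ((ℤ.- (+ suc ℤ.∣ a ∣)) ℤ.* + suc d ℤ.<_) (≡.sym (ℤ.*-identityʳ -[1+ n ]))
    (ℤ.-<- (ℕ.≤-trans (ℕ.m≤m*n (suc n) (suc d)) (ℕ.m≤n+m _ d)))

≤ᵛ-trans : ∀ {u v w} → u ≤ᵛ v → v ≤ᵛ w → u ≤ᵛ w
≤ᵛ-trans = NonStrict.≤₋-trans ℚ._≤_ ℚ.≤-trans

≤ᵛ-reflexive : ∀ {v w} → v ≡ w → v ≤ᵛ w
≤ᵛ-reflexive = NonStrict.≤₋-reflexive-≡ ℚ._≤_ ℚ.≤-reflexive

_≤ᵛ?_ : ∀ v w → Dec (v ≤ᵛ w)
_≤ᵛ?_ = NonStrict.≤₋-dec ℚ._≤_ ℚ._≤?_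

_≟ᵛ_ : (v w : Value) → Dec (v ≡ w)
_≟ᵛ_ = ≡-dec ℚ._≟_

<⇒≤ᵛ : ∀ {v w} → v <ᵛ w → v ≤ᵛ w
<⇒≤ᵛ Strict.⊥₋<[ _ ] = NonStrict.⊥₋≤ _
<⇒≤ᵛ Strict.[ v<w ]  = NonStrict.[ ℚ.<⇒≤ v<w ]

≰⇒>ᵛ : ∀ {v w} → ¬ (v ≤ᵛ w) → w <ᵛ v
≰⇒>ᵛ {𝟘} {w} ¬≤ = contradiction (NonStrict.⊥₋≤ w) ¬≤
≰⇒>ᵛ {p^ q} {𝟘} ¬≤ = Strict.⊥₋<[ q ]
≰⇒>ᵛ {p^ q} {p^ r} ¬≤ = Strict.[ ℚ.≰⇒> (λ q≤r → ¬≤ NonStrict.[ q≤r ]) ]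

>⇒≰ᵛ : ∀ {v w} → w <ᵛ v → ¬ (v ≤ᵛ w)
>⇒≰ᵛ Strict.[ w<v ] NonStrict.[ v≤w ] = ℚ.<-irrefl ≡.refl (ℚ.<-≤-trans w<v v≤w)

≤-<-transᵛ : ∀ {u v w} → u ≤ᵛ v → v <ᵛ w → u <ᵛ w
≤-<-transᵛ = Strict.<₋-transʳ ℚ._<_ ℚ.≤-<-trans

·-mono : ∀ {u v w x} → u ≤ᵛ v → w ≤ᵛ x → u · w ≤ᵛ v · x
·-mono (NonStrict.⊥₋≤ _) _                  = NonStrict.⊥₋≤ _
·-mono NonStrict.[ _ ]   (NonStrict.⊥₋≤ _)  = NonStrict.⊥₋≤ _
·-mono NonStrict.[ q≤r ] NonStrict.[ s≤t ]  = NonStrict.[ ℚ.+-mono-≤ q≤r s≤t ]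

-- The p-adic absolute value

module LocalisationProperties {c ℓ} (R : CommutativeRing c ℓ)
                              (s : CommutativeRing.Carrier R) where

  open CommutativeRing R renaming (refl to ≈-refl; sym to ≈-sym; trans to ≈-trans)
  open Localisation R s
  open CommutativeRing commutativeRing using ()
    renaming (sym to ≃-sym; trans to ≃-trans)
  open Exp semiring using (_^_; ^-homo-*)
  open NatSolver commutativeSemiring using (solve; _:=_; _:*_)

  regroup : ∀ t a b y → s ^ t * ((s ^ a * y) * s ^ b) ≈ s ^ (t ℕ.+ (a ℕ.+ b)) * y
  regroup t a b y = ≈-trans
    (solve 4 (λ T A B y → T :* ((A :* y) :* B) := (T :* (A :* B)) :* y) ≈-refl
      (s ^ t) (s ^ a) (s ^ b) y)
    (*-congʳ (≈-sym (≈-trans (^-homo-* s t (a ℕ.+ b)) (*-congˡ (^-homo-* s a b)))))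

  ≃⇒≈ : ∀ {m k n l u v} → ((s ^ m * u) /s^ k) ≃ ((s ^ n * v) /s^ l) →
        ∃ λ t → s ^ (t ℕ.+ (m ℕ.+ l)) * u ≈ s ^ (t ℕ.+ (n ℕ.+ k)) * v
  ≃⇒≈ {m} {k} {n} {l} {u} {v} (equal t e) = t ,
    ≈-trans (≈-sym (regroup t m l u)) (≈-trans e (regroup t n k v))

  -- Zero is written as a multiple of `s ^ suc t` so that `UnitExponent` turns the equation into the
  -- absurd suc t ≤ t.
  ≃0⇒≈ : ∀ {m k u} → ((s ^ m * u) /s^ k) ≃ (0# /s^ 0) →
         ∃ λ t → s ^ suc t * 0# ≈ s ^ t * u
  ≃0⇒≈ {m} {k} {u} (equal t e) = t ℕ.+ (m ℕ.+ 0) ,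
    ≈-trans (zeroʳ _) (≈-trans (≈-sym (zeroʳ (s ^ t)))
      (≈-trans (*-congˡ (≈-sym (zeroˡ (s ^ k)))) (≈-trans (≈-sym e) (regroup t m 0 u))))

  s^0*x≃x : ∀ {x k} → ((s ^ 0 * x) /s^ k) ≃ (x /s^ k)
  s^0*x≃x = equal 0 (*-congˡ (*-congʳ (*-identityˡ _)))

  s^1*1≃s : ((s ^ 1 * 1#) /s^ 0) ≃ (s /s^ 0)
  s^1*1≃s = equal 0 (*-congˡ (*-congʳ (≈-trans (*-identityʳ _) (*-identityʳ s))))

  ≃⇒≈₀ : ∀ {n l u v} → (u /s^ 0) ≃ ((s ^ n * v) /s^ l) →
         ∃ λ t → s ^ (t ℕ.+ l) * u ≈ s ^ (t ℕ.+ (n ℕ.+ 0)) * v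
  ≃⇒≈₀ {n} {l} {u} {v} eq = ≃⇒≈ {0} {0} {n} {l} {u} {v} (≃-trans (s^0*x≃x {u} {0}) eq)

  /s^0-cong : ∀ {x y} → x ≈ y → (x /s^ 0) ≃ (y /s^ 0)
  /s^0-cong x≈y = equal 0 (*-congˡ (*-congʳ x≈y))

  /s^0-homo-+ : ∀ x y z → z ≈ x + y → (z /s^ 0) ≃ ((x /s^ 0) ⊕ (y /s^ 0))
  /s^0-homo-+ x y z z≈x+y = /s^0-cong
    (≈-trans z≈x+y (≈-sym (+-cong (*-identityʳ x) (*-identityʳ y))))

  /s^0-homo-* : ∀ x y z → z ≈ x * y → (z /s^ 0) ≃ ((x /s^ 0) ⊗ (y /s^ 0))
  /s^0-homo-* x y z z≈xy = /s^0-cong z≈xy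

  s*s⁻¹≃1 : ((s /s^ 0) ⊗ (1# /s^ 1)) ≃ (1# /s^ 0)
  s*s⁻¹≃1 = equal 0 (*-congˡ (≈-trans (*-identityʳ _) (≈-trans (*-comm s 1#) (*-congˡ (≈-sym (*-identityʳ s))))))

  -- The s-adic valuation of s^b times a unit is exactly b. With this property, fractions are
  -- compared by exponents, despite the extra power of s in `_≃_` and without cancelling s in the
  -- ring.
  UnitExponent : Set _
  UnitExponent = ∀ a b x y w → y * w ≈ 1# → s ^ a * x ≈ s ^ b * y → a ℕ.≤ b

  module _ (unit-exponent : UnitExponent) where

    exponent-unique : ∀ {m k n l u w u′ w′} → u * w ≈ 1# → u′ * w′ ≈ 1# →
                      ((s ^ m * u) /s^ k) ≃ ((s ^ n * u′) /s^ l) → m ℕ.+ l ≡ n ℕ.+ k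
    exponent-unique {m} {k} {n} {l} {u} {w} {u′} {w′} uw≈1 u′w′≈1 eq
      = let t , e = ≃⇒≈ {m} {k} {n} {l} {u} {u′} eq in
      ℕ.+-cancelˡ-≡ t _ _ (ℕ.≤-antisym
        (unit-exponent (t ℕ.+ (m ℕ.+ l)) (t ℕ.+ (n ℕ.+ k)) u u′ w′ u′w′≈1 e)
        (unit-exponent (t ℕ.+ (n ℕ.+ k)) (t ℕ.+ (m ℕ.+ l)) u′ u w uw≈1 (≈-sym e)))

    s≄0 : ¬ ((s /s^ 0) ≃ (0# /s^ 0))
    s≄0 eq = let t , e = ≃0⇒≈ {1} {0} {1#} (≃-trans s^1*1≃s eq) in
      ℕ.1+n≰n (unit-exponent (suc t) t 0# 1# 1# (*-identityˡ 1#) e)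

    s-exponent : ∀ {n k u w} → u * w ≈ 1# → (s /s^ 0) ≃ ((s ^ n * u) /s^ k) → suc k ≡ n
    s-exponent {n} {k} {u} {w} uw≈1 eq = ≡.trans
      (exponent-unique {1} {0} {n} {k} {1#} {1#} {u} {w} (*-identityˡ 1#) uw≈1 (≃-trans s^1*1≃s eq)) (ℕ.+-identityʳ n)

module Padic (p : ℕ) (1<p : 1 ℕ.< p) where

  private
    module ℤₚ = CommutativeRing (ℤₚ p)
    module ℚₚ = CommutativeRing (ℚₚ p)
  open ℤₚ using () renaming (_*_ to _⊛_; _≈_ to _≋ᶻ_)
  open Coherent
  open Localisation (ℤₚ p) (fromℤ p (+ p)) using (_/s^_; _≃_; equal)
  open Exp ℤₚ.semiring using (_^_; ^-homo-*)
  open LocalisationProperties (ℤₚ p) (fromℤ p (+ p))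

  instance
    p-nonZero : NonZero p
    p-nonZero = ℕ.>-nonZero (ℕ.<-trans ℕ.z<s 1<p)

  P : Coherent p
  P = fromℤ p (+ p)

  approx-^ : ∀ k n → approx (P ^ k) n ≡ + (p ℕ.^ k)
  approx-^ zero    n = ≡.refl
  approx-^ (suc k) n = ≡.trans (cong (+ p ℤ.*_) (approx-^ k n)) (≡.sym (ℤ.pos-* p (p ℕ.^ k)))

  ^-∣-^ : ∀ {a b} → a ℕ.≤ b → + (p ℕ.^ a) ℤ∣.∣ + (p ℕ.^ b)
  ^-∣-^ {a} {b} a≤b = ℤ∣.divides (+ (p ℕ.^ (b ℕ.∸ a)))
    (≡.trans (cong +_ (≡.trans (cong (p ℕ.^_) (≡.sym (ℕ.m∸n+n≡m a≤b)))
                           (ℕ.^-distribˡ-+-* p (b ℕ.∸ a) a)))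
           (ℤ.pos-* (p ℕ.^ (b ℕ.∸ a)) (p ℕ.^ a)))

  suc-^-∤-^ : ∀ a → ¬ (+ (p ℕ.^ suc a) ℤ∣.∣ + (p ℕ.^ a))
  suc-^-∤-^ a d = ℕ.<⇒≱ (ℕ.^-monoʳ-< p 1<p (ℕ.n<1+n a))
    (ℕ∣.∣⇒≤ {{ℕ.m^n≢0 p a}} (ℤ∣.∣⇒∣ᵤ d))

  -- Multiplying by the inverse w would make p^(b+1) divide p^b.
  unit-∤ : ∀ b {y w : Coherent p} → (y ⊛ w) ≋ᶻ ℤₚ.1# →
           ¬ (+ (p ℕ.^ suc b) ℤ∣.∣ + (p ℕ.^ b) ℤ.* approx y (suc b))
  unit-∤ b {y} {w} (congruent yw≈1) d = suc-^-∤-^ b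
    (subst (+ (p ℕ.^ suc b) ℤ∣.∣_) (r (+ (p ℕ.^ b)) (approx y (suc b)) (approx w (suc b)))
      (ℤ∣.∣m∣n⇒∣m-n (ℤ∣.∣m⇒∣m*n (approx w (suc b)) d) (ℤ∣.∣n⇒∣m*n (+ (p ℕ.^ b)) (yw≈1 (suc b)))))
    where
    r : ∀ q y w → (q ℤ.* y) ℤ.* w ℤ.- q ℤ.* (y ℤ.* w ℤ.- + 1) ≡ q
    r = ℤ-Solver.solve-∀

  -- If b < a, the left side vanishes modulo p^(b+1) and the right side does not, so the
  -- approximations at index b + 1 settle the matter.
  unit-exponent : UnitExponent
  unit-exponent a b x y w yw≈1 (congruent e) = ℕ.≮⇒≥ λ b<a →
    unit-∤ b {y} {w} yw≈1 (subst (+ (p ℕ.^ suc b) ℤ∣.∣_) (r pᵃx pᵇy)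
      (ℤ∣.∣m∣n⇒∣m-n (ℤ∣.∣m⇒∣m*n (approx x (suc b)) (^-∣-^ b<a))
        (subst (+ (p ℕ.^ suc b) ℤ∣.∣_)
          (cong₂ (λ u v → u ℤ.* approx x (suc b) ℤ.- v ℤ.* approx y (suc b))
                 (approx-^ a (suc b)) (approx-^ b (suc b))) (e (suc b)))))
    where
    pᵃx = + (p ℕ.^ a) ℤ.* approx x (suc b)
    pᵇy = + (p ℕ.^ b) ℤ.* approx y (suc b)
    r : ∀ u v → u ℤ.- (u ℤ.- v) ≡ v
    r = ℤ-Solver.solve-∀

  abs-p : ∀ {v} → _HasPadicAbs_ p (P /s^ 0) v → v ≡ p^ (ℤ.- (+ 1) ℚ./ 1)
  abs-p (zero-abs p≈0) = contradiction p≈0 (s≄0 unit-exponent)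
  abs-p (unit-abs n k u w uw≈1 p≈) = cong (λ i → p^ (i ℚ./ 1)) (≡.trans
      (cong (λ j → + k ℤ.- + j) (≡.sym (s-exponent unit-exponent {n} {k} {u} {w} uw≈1 p≈)))
      (≡.trans (cong (λ j → + k ℤ.- j) (ℤ.pos-+ 1 k)) (r (+ k))))
    where
    r : ∀ x → x ℤ.- (+ 1 ℤ.+ x) ≡ ℤ.- (+ 1)
    r = ℤ-Solver.solve-∀

  private
    fromℤ-cong : ∀ i {x : Coherent p} → (∀ n → i ≡ approx x n) → fromℤ p i ≋ᶻ x
    fromℤ-cong i eq = congruent λ n →
      ℤ∣.divides (+ 0) (≡.trans (cong (λ j → i ℤ.- j) (≡.sym (eq n))) (ℤ.+-inverseʳ i))

  ℤ→ℚₚ : ℤ → ℚₚ.Carrier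
  ℤ→ℚₚ i = fromℤ p i /s^ 0

  ℤ→ℚₚ-homo-+ : ∀ i j → ℤ→ℚₚ (i ℤ.+ j) ℚₚ.≈ ℤ→ℚₚ i ℚₚ.+ ℤ→ℚₚ j
  ℤ→ℚₚ-homo-+ i j = /s^0-homo-+ (fromℤ p i) (fromℤ p j) (fromℤ p (i ℤ.+ j))
    (fromℤ-cong (i ℤ.+ j) {fromℤ p i ℤₚ.+ fromℤ p j} λ _ → ≡.refl)

  ℤ→ℚₚ-homo-* : ∀ i j → ℤ→ℚₚ (i ℤ.* j) ℚₚ.≈ ℤ→ℚₚ i ℚₚ.* ℤ→ℚₚ j
  ℤ→ℚₚ-homo-* i j = /s^0-homo-* (fromℤ p i) (fromℤ p j) (fromℤ p (i ℤ.* j))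
    (fromℤ-cong (i ℤ.* j) {fromℤ p i ℤₚ.* fromℤ p j} λ _ → ≡.refl)

  ℤ→ℚₚ-homo-neg : ∀ i → ℤ→ℚₚ (ℤ.- i) ℚₚ.≈ ℚₚ.- ℤ→ℚₚ i
  ℤ→ℚₚ-homo-neg i = /s^0-cong (fromℤ-cong (ℤ.- i) {ℤₚ.- fromℤ p i} λ _ → ≡.refl)

  1/p : ℚₚ.Carrier
  1/p = ℤₚ.1# /s^ 1

  p*1/p≈1 : ℤ→ℚₚ (+ p) ℚₚ.* 1/p ℚₚ.≈ ℚₚ.1#
  p*1/p≈1 = s*s⁻¹≃1

  -- The p-adic integer p^i, where i is the least index with Q i, or 0 if
  -- there is none: knowing its absolute value decides which.
  module Search {q} {Q : ℕ → Set q} (Q? : Decidable Q) where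

    Found : ℕ → Set q
    Found n = ∃ λ i → i ℕ.< n × Q i

    search : ∀ n → Found n ⊎ (∀ i → i ℕ.< n → ¬ Q i)
    search zero = inj₂ λ i ()
    search (suc n) with search n
    ... | inj₁ (i , i<n , Qi) = inj₁ (i , ℕ.m<n⇒m<1+n i<n , Qi)
    ... | inj₂ none with Q? n
    ...   | yes Qn = inj₁ (n , ℕ.n<1+n n , Qn)
    ...   | no ¬Qn = inj₂ λ i i<1+n Qi → step i (ℕ.m<1+n⇒m<n∨m≡n i<1+n) Qi
      where
      step : ∀ i → (i ℕ.< n) ⊎ (i ≡ n) → ¬ Q i
      step i (inj₁ i<n) = none i i<n
      step i (inj₂ ≡.refl) = ¬Qn

    encode : ∀ {n} → Found n ⊎ (∀ i → i ℕ.< n → ¬ Q i) → ℤ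
    encode (inj₁ (i , _)) = + (p ℕ.^ i)
    encode (inj₂ _)       = + 0

    encode-coherent : ∀ n → + (p ℕ.^ n) ℤ∣.∣ encode (search (suc n)) ℤ.- encode (search n)
    encode-coherent n with search n
    ... | inj₁ (i , _) = ℤ∣.divides (+ 0) (ℤ.+-inverseʳ (+ (p ℕ.^ i)))
    ... | inj₂ none with Q? n
    ...   | yes _ = ℤ∣.divides (+ 1) (≡.trans (ℤ.+-identityʳ _) (≡.sym (ℤ.*-identityˡ _)))
    ...   | no _  = ℤ∣.divides (+ 0) ≡.refl

    code : Coherent p
    code = record { approx = λ n → encode (search n) ; coherent = encode-coherent }

    encode-stable : ∀ {i n} → encode (search n) ≡ + (p ℕ.^ i) → ∀ k →
                    encode (search (k ℕ.+ n)) ≡ + (p ℕ.^ i)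
    encode-stable eq zero = eq
    encode-stable {i} {n} eq (suc k) with search (k ℕ.+ n) | encode-stable {i} {n} eq k
    ... | inj₁ _ | eq′ = eq′
    ... | inj₂ _ | eq′ = contradiction (ℕ.m^n≡0⇒m≡0 p i (ℤ.+-injective (≡.sym eq′)))
                                       (ℕ.≢-nonZero⁻¹ p)

    code≈0⇒none : (code /s^ 0) ≃ ℚₚ.0# → ∀ n → ¬ Q n
    code≈0⇒none (equal t (congruent e)) n Qn with search (suc n) in eq
    ... | inj₂ none = none n (ℕ.n<1+n n) Qn
    ... | inj₁ (i , _) = suc-^-∤-^ (t ℕ.+ i) (ℤ∣.∣-trans (^-∣-^ (ℕ.m≤m+n (suc (t ℕ.+ i)) (suc n)))
      (subst (+ (p ℕ.^ N) ℤ∣.∣_) value (e N)))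
      where
      -- The hit p^i comes multiplied by the p^t of `_≃_`, so the precision must exceed t + i; the
      -- summand `suc n` places N beyond the stage at which the search has succeeded.
      N = suc (t ℕ.+ i) ℕ.+ suc n
      open ≡.≡-Reasoning
      r : ∀ x y → x ℤ.* (y ℤ.* + 1) ℤ.- x ℤ.* (+ 0 ℤ.* + 1) ≡ x ℤ.* y
      r = ℤ-Solver.solve-∀
      value : approx (P ^ t) N ℤ.* (encode (search N) ℤ.* + 1)
              ℤ.- approx (P ^ t) N ℤ.* (+ 0 ℤ.* + 1) ≡ + (p ℕ.^ (t ℕ.+ i))
      value = begin
        _                                        ≡⟨ r (approx (P ^ t) N) (encode (search N)) ⟩
        approx (P ^ t) N ℤ.* encode (search N)
          ≡⟨ cong₂ ℤ._*_ (approx-^ t N)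
                   (encode-stable {i} {suc n} (cong encode eq) (suc (t ℕ.+ i))) ⟩
        + (p ℕ.^ t) ℤ.* + (p ℕ.^ i)              ≡⟨ ℤ.pos-* (p ℕ.^ t) (p ℕ.^ i) ⟨
        + (p ℕ.^ t ℕ.* p ℕ.^ i)                  ≡⟨ cong +_ (ℕ.^-distribˡ-+-* p t i) ⟨
        + (p ℕ.^ (t ℕ.+ i))                      ∎

    search-nonzero : ∀ {n} (r : Found n ⊎ (∀ i → i ℕ.< n → ¬ Q i)) →
                     ¬ (encode r ≡ + 0) → ∃ Q
    search-nonzero (inj₁ (i , _ , Qi)) _ = i , Qi
    search-nonzero (inj₂ _) ≢0           = contradiction ≡.refl ≢0

    -- A nonzero absolute value bounds the search: p^b u is nonzero modulo p^(b+1), so the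
    -- approximation of `code` at index b + 1 cannot be 0 and a hit occurs below b + 1.
    code-unit⇒some : ∀ {m k u w} → (u ⊛ w) ≋ᶻ ℤₚ.1# →
                     (code /s^ 0) ≃ (((P ^ m) ⊛ u) /s^ k) → ∃ Q
    code-unit⇒some {m} {k} {u} {w} uw≈1 eq =
      search-nonzero (search (suc b)) λ ≡0 → unit-∤ b {u} {w} uw≈1
        (subst (+ (p ℕ.^ suc b) ℤ∣.∣_)
          (≡.trans (cong (λ z → ℤ.- (approx (P ^ (t ℕ.+ k)) (suc b) ℤ.* z
                                   ℤ.- approx (P ^ b) (suc b) ℤ.* approx u (suc b))) ≡0)
          (≡.trans (r (approx (P ^ (t ℕ.+ k)) (suc b)) (approx (P ^ b) (suc b)) (approx u (suc b)))
                 (cong (ℤ._* approx u (suc b)) (approx-^ b (suc b)))))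
          (ℤ∣.∣m⇒∣-m (_≋_.at e (suc b))))
      where
      te = ≃⇒≈₀ {m} {k} {code} {u} eq
      t = proj₁ te
      e = proj₂ te
      b = t ℕ.+ (m ℕ.+ 0)
      r : ∀ x z u → ℤ.- (x ℤ.* + 0 ℤ.- z ℤ.* u) ≡ z ℤ.* u
      r = ℤ-Solver.solve-∀

    decide : ∀ {v} → _HasPadicAbs_ p (code /s^ 0) v → ∃ Q ⊎ (∀ n → ¬ Q n)
    decide (zero-abs code≈0)             = inj₂ (code≈0⇒none code≈0)
    decide (unit-abs m k u w uw≈1 code≈) = inj₁ (code-unit⇒some {m} {k} {u} {w} uw≈1 code≈)

-- Absolute values on K

-- If y were missed, punching it out of the codomain would inject `Fin (suc n)` into `Fin n`.
injective⇒surjective : ∀ {n} (f : Fin n → Fin n) → Injective _≡_ _≡_ f →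
                       ∀ y → ∃ λ x → f x ≡ y
injective⇒surjective {suc n} f inj y with Fin.any? (λ x → f x Fin.≟ y)
... | yes hit = hit
... | no miss = contradiction (Fin.injective⇒≤ {f = λ x → punchOut (y≢f x)}
        (λ eq → inj (Fin.punchOut-injective (y≢f _) (y≢f _) eq))) ℕ.1+n≰n
  where
  y≢f : ∀ x → y ≢ f x
  y≢f x y≡fx = miss (x , ≡.sym y≡fx)

padic-value : ∀ {p x v} → _HasPadicAbs_ p x v → v ≡ 𝟘 ⊎ ∃ λ m → v ≡ p^ (m ℚ./ 1)
padic-value (zero-abs _)             = inj₁ ≡.refl
padic-value (unit-abs n k _ _ _ _)   = inj₂ (+ k ℤ.- + n , ≡.refl)

module Valued {p} (p-prime : Prime p) (S : Setting p c ℓ) where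

  open Setting S
  open FiniteExtension K hiding (zero) public
  open IsAbsoluteValue isAbsoluteValue
  open Exp semiring using (_^_) public
  open RingProperties (CommutativeRing.ring (FiniteExtension.ring K)) public
    using (-1*x≈-x)
  open GroupProperties +-group public using (⁻¹-involutive; x∙y⁻¹≈ε⇒x≈y) renaming (ε⁻¹≈ε to -0#≈0#)

  private
    module ℚₚ = CommutativeRing (ℚₚ p)

  1<p : 1 ℕ.< p
  1<p = ℕ.nonTrivial⇒n>1 p {{prime⇒nonTrivial p-prime}}

  open Padic p 1<p using (abs-p; 1/p; p*1/p≈1; ℤ→ℚₚ;
    ℤ→ℚₚ-homo-+; ℤ→ℚₚ-homo-*; ℤ→ℚₚ-homo-neg; module Search)
  module ι = RingMorphisms.IsRingHomomorphism ι-isHom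

  ⟦_⟧ : ℤ → Carrier
  ⟦ i ⟧ = ι (ℤ→ℚₚ i)

  ⟦⟧-homo-+ : ∀ i j → ⟦ i ℤ.+ j ⟧ ≈ ⟦ i ⟧ + ⟦ j ⟧
  ⟦⟧-homo-+ i j = trans (ι.⟦⟧-cong (ℤ→ℚₚ-homo-+ i j)) (ι.+-homo (ℤ→ℚₚ i) (ℤ→ℚₚ j))

  ⟦⟧-homo-* : ∀ i j → ⟦ i ℤ.* j ⟧ ≈ ⟦ i ⟧ * ⟦ j ⟧
  ⟦⟧-homo-* i j = trans (ι.⟦⟧-cong (ℤ→ℚₚ-homo-* i j)) (ι.*-homo (ℤ→ℚₚ i) (ℤ→ℚₚ j))

  ⟦⟧-homo-neg : ∀ i → ⟦ ℤ.- i ⟧ ≈ - ⟦ i ⟧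
  ⟦⟧-homo-neg i = trans (ι.⟦⟧-cong (ℤ→ℚₚ-homo-neg i)) (ι.-‿homo (ℤ→ℚₚ i))

  ⟦⟧-homo-- : ∀ i j → ⟦ i ℤ.- j ⟧ ≈ ⟦ i ⟧ - ⟦ j ⟧
  ⟦⟧-homo-- i j = trans (⟦⟧-homo-+ i (ℤ.- j)) (+-congˡ (⟦⟧-homo-neg j))

  ⟦⟧-homo-0 : ⟦ + 0 ⟧ ≈ 0#
  ⟦⟧-homo-0 = ι.0#-homo

  ⟦⟧-homo-1 : ⟦ + 1 ⟧ ≈ 1#
  ⟦⟧-homo-1 = ι.1#-homo

  p⁻¹ : Carrier
  p⁻¹ = ι 1/p

  p*p⁻¹≈1 : ⟦ + p ⟧ * p⁻¹ ≈ 1#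
  p*p⁻¹≈1 = trans (sym (ι.*-homo (ℤ→ℚₚ (+ p)) 1/p)) (trans (ι.⟦⟧-cong p*1/p≈1) ι.1#-homo)

  private
    ℤ⟶K : ℤ.+-*-rawRing -Raw-AlmostCommutative⟶ fromCommutativeRing (FiniteExtension.ring K)
    ℤ⟶K = record { ⟦_⟧ = ⟦_⟧ ; +-homo = ⟦⟧-homo-+ ; *-homo = ⟦⟧-homo-* ; -‿homo = ⟦⟧-homo-neg
                 ; 0-homo = ⟦⟧-homo-0 ; 1-homo = ⟦⟧-homo-1 }

    ⟦⟧-≈? : ∀ i j → Maybe.Maybe (⟦ i ⟧ ≈ ⟦ j ⟧)
    ⟦⟧-≈? i j = Maybe.map (λ i≡j → reflexive (cong ⟦_⟧ i≡j)) (dec⇒maybe (i ℤ.≟ j))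

  module Solver = Algebra.Solver.Ring ℤ.+-*-rawRing (fromCommutativeRing (FiniteExtension.ring K)) ℤ⟶K ⟦⟧-≈?

  _≈0? : ∀ x → Dec (x ≈ 0#)
  x ≈0? with ∣ x ∣ ≟ᵛ 𝟘
  ... | yes ≡0 = yes (abs≡0⇒≈0 x ≡0)
  ... | no ≢0  = no λ x≈0 → ≢0 (≡.trans (cong-abs x≈0) abs-0)

  inverse : ∀ {x} → ¬ (x ≈ 0#) → ∃ λ y → x * y ≈ 1#
  inverse {x} = proj₂ isField x

  1≉0 : ¬ (1# ≈ 0#)
  1≉0 1≈0 = proj₁ isField (sym 1≈0)

  lpo : ∀ {q} {Q : ℕ → Set q} → Decidable Q → ∃ Q ⊎ (∀ n → ¬ Q n)
  lpo Q? = Search.decide Q? (extends-padic _)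

  -- Exponents in units of 1/e: |β| is `pe 1`, |p| is `pe (- e)`, and comparisons become comparisons
  -- of integers.
  pe : ℤ → Value
  pe n = p^ (n ℚ./ e)

  pe-* : ∀ m n → pe m · pe n ≡ pe (m ℤ.+ n)
  pe-* m n = cong [_] (+-/ e m n)

  pe-mono : ∀ {m n} → m ℤ.≤ n → pe m ≤ᵛ pe n
  pe-mono m≤n = NonStrict.[ /-mono-≤ e m≤n ]

  pe-cancel : ∀ {m n} → pe m ≤ᵛ pe n → m ℤ.≤ n
  pe-cancel NonStrict.[ m≤n ] = /-cancel-≤ e m≤n

  pe-injective : ∀ {m n} → pe m ≡ pe n → m ≡ n
  pe-injective eq = ℤ.≤-antisym (pe-cancel (≤ᵛ-reflexive eq)) (pe-cancel (≤ᵛ-reflexive (≡.sym eq)))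

  pe-0 : pe (+ 0) ≡ 𝟙
  pe-0 = cong [_] (0/≡0 e)

  pe-e : ∀ m → p^ (m ℚ./ 1) ≡ pe (m ℤ.* + e)
  pe-e m = cong [_] (/1≡*/ e m)

  private
    ·-cancelˡ-𝟙 : ∀ {v} → v ≢ 𝟘 → v · v ≡ v → v ≡ 𝟙
    ·-cancelˡ-𝟙 {𝟘}    v≢𝟘 _    = contradiction ≡.refl v≢𝟘
    ·-cancelˡ-𝟙 {p^ q} _   qq≡q = cong [_] (x+x≈x⇒x≈0 q ([]-injective qq≡q))
      where open RingProperties ℚ.+-*-ring using (x+x≈x⇒x≈0)

    ·-square-𝟙 : ∀ {v} → v · v ≡ 𝟙 → v ≡ 𝟙
    ·-square-𝟙 {p^ q} qq≡0 = cong [_] (double≡0 ([]-injective qq≡0))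
      where
      double≡0 : q ℚ.+ q ≡ 0ℚ → q ≡ 0ℚ
      double≡0 eq with ℚ.<-cmp q 0ℚ
      ... | tri< q<0 _ _ = contradiction eq (ℚ.<⇒≢ (ℚ.+-mono-< q<0 q<0))
      ... | tri≈ _ q≡0 _ = q≡0
      ... | tri> _ _ q>0 = contradiction (≡.sym eq) (ℚ.<⇒≢ (ℚ.+-mono-< q>0 q>0))

  abs-1 : ∣ 1# ∣ ≡ 𝟙
  abs-1 = ·-cancelˡ-𝟙 (λ ≡𝟘 → 1≉0 (abs≡0⇒≈0 1# ≡𝟘))
    (≡.trans (≡.sym (abs-* 1# 1#)) (cong-abs (*-identityˡ 1#)))

  -- |-1| squares to 1, and the ordered group of exponents has no 2-torsion.
  abs-neg : ∀ x → ∣ - x ∣ ≡ ∣ x ∣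
  abs-neg x = begin
    ∣ - x ∣            ≡⟨ cong-abs (-1*x≈-x x) ⟨
    ∣ - 1# * x ∣       ≡⟨ abs-* (- 1#) x ⟩
    ∣ - 1# ∣ · ∣ x ∣   ≡⟨ cong (_· ∣ x ∣) (·-square-𝟙 (≡.trans (≡.sym (abs-* (- 1#) (- 1#)))
                            (≡.trans (cong-abs (trans (-1*x≈-x (- 1#)) (⁻¹-involutive 1#))) abs-1))) ⟩
    𝟙 · ∣ x ∣          ≡⟨ cong (_· ∣ x ∣) abs-1 ⟨
    ∣ 1# ∣ · ∣ x ∣     ≡⟨ abs-* 1# x ⟨
    ∣ 1# * x ∣         ≡⟨ cong-abs (*-identityˡ x) ⟩
    ∣ x ∣              ∎
    where open ≡.≡-Reasoning

  abs-ι : ∀ y → ¬ (ι y ≈ 0#) → ∃ λ m → ∣ ι y ∣ ≡ pe (m ℤ.* + e)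
  abs-ι y ιy≉0 with padic-value (extends-padic y)
  ... | inj₁ ≡𝟘       = contradiction (abs≡0⇒≈0 (ι y) ≡𝟘) ιy≉0
  ... | inj₂ (m , eq) = m , ≡.trans eq (pe-e m)

  abs-⟦p⟧ : ∣ ⟦ + p ⟧ ∣ ≡ pe (ℤ.- (+ e))
  abs-⟦p⟧ = ≡.trans (abs-p (extends-padic (ℤ→ℚₚ (+ p))))
    (≡.trans (pe-e (ℤ.- (+ 1))) (cong pe (ℤ.-1*i≡-i (+ e))))

  abs-β^ : ∀ i → ∣ β ^ i ∣ ≡ pe (+ i)
  abs-β^ zero    = ≡.trans abs-1 (≡.sym pe-0)
  abs-β^ (suc i) = ≡.trans (abs-* β (β ^ i))
    (≡.trans (cong₂ _·_ abs-β (abs-β^ i)) (pe-* (+ 1) (+ i)))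

  private
    t : Fin e → Carrier
    t = proj₁ ramificationIndex

    coset : ∀ {x} → ¬ (x ≈ 0#) → Fin e
    coset {x} x≉0 = proj₁ (proj₂ (proj₂ ramificationIndex) x x≉0)

    β^≉0 : ∀ i → ¬ (β ^ i ≈ 0#)
    β^≉0 i β^≈0 with () ← ≡.trans (≡.sym (abs-β^ i)) (≡.trans (cong-abs β^≈0) abs-0)

    abs-coset : ∀ {x} (x≉0 : ¬ (x ≈ 0#)) →
                ∃ λ m → ∣ x ∣ ≡ ∣ t (coset x≉0) ∣ · pe (m ℤ.* + e)
    abs-coset {x} x≉0 =
      let (y , _ , eq) , _ = proj₂ (proj₂ (proj₂ ramificationIndex) x x≉0)
          m , eq′ = abs-ι y λ ιy≈0 → x≉0 (abs≡0⇒≈0 x (≡.trans eq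
            (≡.trans (cong (T ·_) (≡.trans (cong-abs ιy≈0) abs-0)) (·-𝟘 T))))
      in m , ≡.trans eq (cong (T ·_) eq′)
      where
      T : Value
      T = ∣ t (coset x≉0) ∣
      ·-𝟘 : ∀ v → v · 𝟘 ≡ 𝟘
      ·-𝟘 𝟘      = ≡.refl
      ·-𝟘 (p^ _) = ≡.refl

    divide : ∀ {v} m n → pe m ≡ v · pe n → v ≡ pe (m ℤ.- n)
    divide {p^ q} m n eq = cong [_] (begin
      q                                              ≡⟨ ℚ.+-identityʳ q ⟨
      q ℚ.+ 0ℚ                                       ≡⟨ cong (q ℚ.+_) (0/≡0 e) ⟨
      q ℚ.+ (+ 0) ℚ./ e                              ≡⟨ cong (λ i → q ℚ.+ i ℚ./ e) (ℤ.+-inverseʳ n) ⟨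
      q ℚ.+ (n ℤ.- n) ℚ./ e                          ≡⟨ cong (q ℚ.+_) (+-/ e n (ℤ.- n)) ⟨
      q ℚ.+ (n ℚ./ e ℚ.+ (ℤ.- n) ℚ./ e)              ≡⟨ ℚ.+-assoc q (n ℚ./ e) ((ℤ.- n) ℚ./ e) ⟨
      (q ℚ.+ n ℚ./ e) ℚ.+ (ℤ.- n) ℚ./ e              ≡⟨ cong (ℚ._+ (ℤ.- n) ℚ./ e) ([]-injective eq) ⟨
      m ℚ./ e ℚ.+ (ℤ.- n) ℚ./ e                      ≡⟨ +-/ e m (ℤ.- n) ⟩
      (m ℤ.- n) ℚ./ e                                ∎)
      where open ≡.≡-Reasoning

    -- Equality would make e divide j - i, although 0 < j - i < e.
    incongruent : ∀ {i j} m n → i ℕ.< j → j ℕ.< e →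
                  + i ℤ.- m ℤ.* + e ≢ + j ℤ.- n ℤ.* + e
    incongruent {i} {j} m n i<j j<e eq = ℕ.<⇒≱ (ℕ.≤-<-trans (ℕ.m∸n≤m j i) j<e)
      (ℕ∣.∣⇒≤ {{ℕ.>-nonZero (ℕ.m<n⇒0<n∸m i<j)}} (ℤ∣.∣⇒∣ᵤ (ℤ∣.divides (n ℤ.- m) (begin
        + (j ℕ.∸ i)                   ≡⟨ ≡.trans (ℤ.m-n≡m⊖n j i) (ℤ.⊖-≥ (ℕ.<⇒≤ i<j)) ⟨
        + j ℤ.- + i                   ≡⟨ r (+ i) (+ j) (m ℤ.* + e) (n ℤ.* + e) ⟩
        (+ j ℤ.- n ℤ.* + e) ℤ.- (+ i ℤ.- m ℤ.* + e) ℤ.+ (n ℤ.* + e ℤ.- m ℤ.* + e)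
          ≡⟨ cong (λ z → z ℤ.- (+ i ℤ.- m ℤ.* + e) ℤ.+ (n ℤ.* + e ℤ.- m ℤ.* + e)) eq ⟨
        (+ i ℤ.- m ℤ.* + e) ℤ.- (+ i ℤ.- m ℤ.* + e) ℤ.+ (n ℤ.* + e ℤ.- m ℤ.* + e)
          ≡⟨ r′ (+ i ℤ.- m ℤ.* + e) n m (+ e) ⟩
        (n ℤ.- m) ℤ.* + e             ∎))))
      where
      open ≡.≡-Reasoning
      r : ∀ i j m n → j ℤ.- i ≡ (j ℤ.- n) ℤ.- (i ℤ.- m) ℤ.+ (n ℤ.- m)
      r = ℤ-Solver.solve-∀
      r′ : ∀ a n m e → a ℤ.- a ℤ.+ (n ℤ.* e ℤ.- m ℤ.* e) ≡ (n ℤ.- m) ℤ.* e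
      r′ = ℤ-Solver.solve-∀

    βcoset : Fin e → Fin e
    βcoset i = coset (β^≉0 (toℕ i))

    βcoset-value : ∀ i → ∃ λ m → ∣ t (βcoset i) ∣ ≡ pe (+ toℕ i ℤ.- m ℤ.* + e)
    βcoset-value i = let m , eq = abs-coset (β^≉0 (toℕ i)) in
      m , divide (+ toℕ i) (m ℤ.* + e) (≡.trans (≡.sym (abs-β^ (toℕ i))) eq)

    same : ∀ i j → βcoset i ≡ βcoset j →
           + toℕ i ℤ.- proj₁ (βcoset-value i) ℤ.* + e ≡ + toℕ j ℤ.- proj₁ (βcoset-value j) ℤ.* + e
    same i j eq = pe-injective (≡.trans (≡.sym (proj₂ (βcoset-value i)))
      (≡.trans (cong (λ k → ∣ t k ∣) eq) (proj₂ (βcoset-value j))))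

    βcoset-injective : Injective _≡_ _≡_ βcoset
    βcoset-injective {i} {j} eq with ℕ.<-cmp (toℕ i) (toℕ j)
    ... | tri≈ _ i≡j _ = Fin.toℕ-injective i≡j
    ... | tri< i<j _ _ = contradiction (same i j eq) (incongruent (proj₁ (βcoset-value i)) (proj₁ (βcoset-value j)) i<j (Fin.toℕ<n j))
    ... | tri> _ _ i>j = contradiction (same j i (≡.sym eq)) (incongruent (proj₁ (βcoset-value j)) (proj₁ (βcoset-value i)) i>j (Fin.toℕ<n i))

  -- The e powers of β occupy e distinct cosets of |ℚₚˣ|, hence all of them. So x shares a coset
  -- with some β^i, and |x| differs from |β^i| by an integral power of p.
  abs-discrete : ∀ {x} → ¬ (x ≈ 0#) → ∃ λ n → ∣ x ∣ ≡ pe n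
  abs-discrete {x} x≉0 =
    let i , βi≡x = injective⇒surjective βcoset βcoset-injective (coset x≉0)
        k , eq   = βcoset-value i
        m , eq′  = abs-coset x≉0
    in (+ toℕ i ℤ.- k ℤ.* + e) ℤ.+ m ℤ.* + e , ≡.trans eq′ (≡.trans
      (cong (λ j → ∣ t j ∣ · pe (m ℤ.* + e)) (≡.sym βi≡x))
      (≡.trans (cong (_· pe (m ℤ.* + e)) eq) (pe-* (+ toℕ i ℤ.- k ℤ.* + e) (m ℤ.* + e))))

bezout : ∀ {p i} → Prime p → ¬ (+ p ℤ∣.∣ i) → ∃₂ λ u v → u ℤ.* i ≡ + 1 ℤ.+ v ℤ.* + p
bezout {p} {i} p-prime p∤i = scale (identity (Coprimality.coprime-Bézout coprime)) (unsign i)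
  where
  open ≡.≡-Reasoning

  coprime : Coprimality.Coprime ℤ.∣ i ∣ p
  coprime {d} (d∣i , d∣p) with prime⇒irreducible p-prime d∣p
  ... | inj₁ d≡1 = d≡1
  ... | inj₂ ≡.refl = contradiction (ℤ∣.∣ᵤ⇒∣ d∣i) p∤i

  identity : GCD.Bézout.Identity 1 ℤ.∣ i ∣ p →
             ∃₂ λ u v → u ℤ.* + ℤ.∣ i ∣ ≡ + 1 ℤ.+ v ℤ.* + p
  identity (GCD.Bézout.+- x y eq) = + x , + y , (begin
    + x ℤ.* + ℤ.∣ i ∣       ≡⟨ ℤ.pos-* x ℤ.∣ i ∣ ⟨
    + (x ℕ.* ℤ.∣ i ∣)       ≡⟨ cong +_ eq ⟨
    + (1 ℕ.+ y ℕ.* p)       ≡⟨ ℤ.pos-+ 1 (y ℕ.* p) ⟩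
    + 1 ℤ.+ + (y ℕ.* p)     ≡⟨ cong (λ z → + 1 ℤ.+ z) (ℤ.pos-* y p) ⟩
    + 1 ℤ.+ + y ℤ.* + p     ∎)
  identity (GCD.Bézout.-+ x y eq) = ℤ.- (+ x) , ℤ.- (+ y) , (begin
    ℤ.- (+ x) ℤ.* + ℤ.∣ i ∣                        ≡⟨ r (+ x) (+ ℤ.∣ i ∣) ⟩
    + 1 ℤ.- (+ 1 ℤ.+ + x ℤ.* + ℤ.∣ i ∣)            ≡⟨ cong (λ z → + 1 ℤ.- (+ 1 ℤ.+ z)) (ℤ.pos-* x ℤ.∣ i ∣) ⟨
    + 1 ℤ.- (+ 1 ℤ.+ + (x ℕ.* ℤ.∣ i ∣))            ≡⟨ cong (λ z → + 1 ℤ.- z) (ℤ.pos-+ 1 (x ℕ.* ℤ.∣ i ∣)) ⟨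
    + 1 ℤ.- + (1 ℕ.+ x ℕ.* ℤ.∣ i ∣)                ≡⟨ cong (λ z → + 1 ℤ.- + z) eq ⟩
    + 1 ℤ.- + (y ℕ.* p)                            ≡⟨ cong (λ z → + 1 ℤ.- z) (ℤ.pos-* y p) ⟩
    + 1 ℤ.- + y ℤ.* + p                            ≡⟨ cong (λ z → + 1 ℤ.+ z) (ℤ.neg-distribˡ-* (+ y) (+ p)) ⟩
    + 1 ℤ.+ ℤ.- (+ y) ℤ.* + p                      ∎)
    where
    r : ∀ x i → ℤ.- x ℤ.* i ≡ + 1 ℤ.- (+ 1 ℤ.+ x ℤ.* i)
    r = ℤ-Solver.solve-∀

  unsign : ∀ i → ∃ λ s → + ℤ.∣ i ∣ ≡ s ℤ.* i
  unsign (+ n)    = + 1 , ≡.sym (ℤ.*-identityˡ (+ n))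
  unsign -[1+ n ] = ℤ.- (+ 1) , ≡.sym (ℤ.-1*i≡-i -[1+ n ])

  scale : (∃₂ λ u v → u ℤ.* + ℤ.∣ i ∣ ≡ + 1 ℤ.+ v ℤ.* + p) →
          (∃ λ s → + ℤ.∣ i ∣ ≡ s ℤ.* i) → ∃₂ λ u v → u ℤ.* i ≡ + 1 ℤ.+ v ℤ.* + p
  scale (u , v , eq) (s , eq′) = u ℤ.* s , v ,
    ≡.trans (ℤ.*-assoc u s i) (≡.trans (cong (u ℤ.*_) (≡.sym eq′)) eq)

-- The filtration of K by fractional ideals

module Filtered {p} (p-prime : Prime p) (S : Setting p c ℓ) where

  open Setting S
  open IsAbsoluteValue isAbsoluteValue
  open Valued p-prime S
  open import Relation.Binary.Reasoning.Setoid setoid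

  -- The fractional ideal generated by β^n: `𝔪 (+ 0)` is the valuation ring and `𝔪 (- 1)` its
  -- maximal ideal. The record, unlike the bare inequality, lets unification recover n.
  record 𝔪 (n : ℤ) (x : Carrier) : Set where
    constructor bound
    field abs≤ : ∣ x ∣ ≤ᵛ pe n

  open 𝔪 public

  𝔪-resp : ∀ {n x y} → x ≈ y → 𝔪 n x → 𝔪 n y
  𝔪-resp x≈y (bound x≤) = bound (subst (_≤ᵛ _) (cong-abs x≈y) x≤)

  𝔪-cast : ∀ {m n x} → m ≡ n → 𝔪 m x → 𝔪 n x
  𝔪-cast ≡.refl x∈ = x∈

  𝔪-mono : ∀ {m n x} → m ℤ.≤ n → 𝔪 m x → 𝔪 n x
  𝔪-mono m≤n (bound x≤) = bound (≤ᵛ-trans x≤ (pe-mono m≤n))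

  𝔪-0 : ∀ {n} → 𝔪 n 0#
  𝔪-0 = bound (subst (_≤ᵛ _) (≡.sym abs-0) (NonStrict.⊥₋≤ _))

  𝔪-+ : ∀ {n x y} → 𝔪 n x → 𝔪 n y → 𝔪 n (x + y)
  𝔪-+ {x = x} {y} (bound x≤) (bound y≤) with ultrametric x y
  ... | inj₁ ≤x = bound (≤ᵛ-trans ≤x x≤)
  ... | inj₂ ≤y = bound (≤ᵛ-trans ≤y y≤)

  𝔪-neg : ∀ {n x} → 𝔪 n x → 𝔪 n (- x)
  𝔪-neg (bound x≤) = bound (subst (_≤ᵛ _) (≡.sym (abs-neg _)) x≤)

  𝔪-- : ∀ {n x y} → 𝔪 n x → 𝔪 n y → 𝔪 n (x - y)
  𝔪-- x∈ y∈ = 𝔪-+ x∈ (𝔪-neg y∈)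

  𝔪-* : ∀ {m n x y} → 𝔪 m x → 𝔪 n y → 𝔪 (m ℤ.+ n) (x * y)
  𝔪-* {m} {n} {x} {y} (bound x≤) (bound y≤) = bound
    (subst₂ _≤ᵛ_ (≡.sym (abs-* x y)) (pe-* m n) (·-mono x≤ y≤))

  𝔪? : ∀ n x → Dec (𝔪 n x)
  𝔪? n x = map′ bound abs≤ (∣ x ∣ ≤ᵛ? pe n)

  1∈𝔪 : 𝔪 (+ 0) 1#
  1∈𝔪 = bound (≤ᵛ-reflexive (≡.trans abs-1 (≡.sym pe-0)))

  1∉𝔪 : ¬ 𝔪 (ℤ.- (+ 1)) 1#
  1∉𝔪 (bound 1≤) with () ← pe-cancel {+ 0} {ℤ.- (+ 1)} (subst (_≤ᵛ pe (ℤ.- (+ 1))) (≡.trans abs-1 (≡.sym pe-0)) 1≤)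

  β∈𝔪 : 𝔪 (+ 1) β
  β∈𝔪 = bound (≤ᵛ-reflexive abs-β)

  p∈𝔪 : 𝔪 (ℤ.- (+ e)) ⟦ + p ⟧
  p∈𝔪 = bound (≤ᵛ-reflexive abs-⟦p⟧)

  ≤𝟙⇒𝔪 : ∀ {x} → ∣ x ∣ ≤ᵛ 𝟙 → 𝔪 (+ 0) x
  ≤𝟙⇒𝔪 {x} x≤ = bound (subst (∣ x ∣ ≤ᵛ_) (≡.sym pe-0) x≤)

  𝔪⇒≤𝟙 : ∀ {x} → 𝔪 (+ 0) x → ∣ x ∣ ≤ᵛ 𝟙
  𝔪⇒≤𝟙 {x} (bound x≤) = subst (∣ x ∣ ≤ᵛ_) pe-0 x≤

  -- Values are discrete, so a strict inequality gains a full step of 1/e.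
  <pe⇒𝔪 : ∀ {x} n → ∣ x ∣ <ᵛ pe n → 𝔪 (ℤ.pred n) x
  <pe⇒𝔪 {x} n x< with x ≈0?
  ... | yes x≈0 = 𝔪-resp (sym x≈0) 𝔪-0
  ... | no x≉0  = let m , eq = abs-discrete x≉0 in bound (≤ᵛ-trans (≤ᵛ-reflexive eq)
    (pe-mono {m} (ℤ.i<j⇒i≤pred[j] (ℤ.≰⇒> {n} {m} λ n≤m →
      >⇒≰ᵛ x< (≤ᵛ-trans (pe-mono {n} n≤m) (≤ᵛ-reflexive (≡.sym eq)))))))

  <𝟙⇒𝔪 : ∀ {x} → ∣ x ∣ <ᵛ 𝟙 → 𝔪 (ℤ.- (+ 1)) x
  <𝟙⇒𝔪 {x} x< = <pe⇒𝔪 (+ 0) (subst (∣ x ∣ <ᵛ_) (≡.sym pe-0) x<)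

  𝔪-exhaust : ∀ x → ∃ λ n → 𝔪 (+ n) x
  𝔪-exhaust x with x ≈0?
  ... | yes x≈0 = 0 , 𝔪-resp (sym x≈0) 𝔪-0
  ... | no x≉0  = let n , eq = abs-discrete x≉0
                  in ℤ.∣ n ∣ , bound (≤ᵛ-trans (≤ᵛ-reflexive eq) (pe-mono (i≤∣i∣ n)))
    where
    i≤∣i∣ : ∀ n → n ℤ.≤ + ℤ.∣ n ∣
    i≤∣i∣ (+ n)    = ℤ.≤-refl
    i≤∣i∣ -[1+ n ] = ℤ.-≤+

  inverse-abs : ∀ {x y} n → x * y ≈ 1# → ∣ x ∣ ≡ pe n → ∣ y ∣ ≡ pe (ℤ.- n)
  inverse-abs {x} {y} n xy≈1 eq =
    let m , eq′ = abs-discrete (λ y≈0 → 1≉0 (trans (sym xy≈1) (trans (*-congˡ y≈0) (zeroʳ x))))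
    in ≡.trans eq′ (cong pe (cancel m (pe-injective {n ℤ.+ m} {+ 0} (≡.trans (≡.sym (pe-* n m))
         (≡.trans (cong₂ _·_ (≡.sym eq) (≡.sym eq′))
         (≡.trans (≡.sym (abs-* x y)) (≡.trans (cong-abs xy≈1) (≡.trans abs-1 (≡.sym pe-0)))))))))
    where
    cancel : ∀ m → n ℤ.+ m ≡ + 0 → m ≡ ℤ.- n
    cancel m n+m≡0 = ≡.trans (r n m) (≡.trans (cong (ℤ._- n) n+m≡0) (ℤ.+-identityˡ (ℤ.- n)))
      where
      r : ∀ n m → m ≡ (n ℤ.+ m) ℤ.- n
      r = ℤ-Solver.solve-∀

  -- By discreteness, an element outside `𝔪 n` has value at least `pe (1 + n)`.
  ∉𝔪⇒inverse∈𝔪 : ∀ {x y n} → x * y ≈ 1# → ¬ 𝔪 n x → 𝔪 (ℤ.- (+ 1) ℤ.- n) y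
  ∉𝔪⇒inverse∈𝔪 {x} {y} {n} xy≈1 x∉ =
    let m , eq = abs-discrete (λ x≈0 → x∉ (𝔪-resp (sym x≈0) 𝔪-0))
        n<m = ℤ.≰⇒> {m} {n} λ m≤n → x∉ (bound (≤ᵛ-trans (≤ᵛ-reflexive eq) (pe-mono m≤n)))
    in bound (≤ᵛ-trans (≤ᵛ-reflexive (inverse-abs m xy≈1 eq))
        (pe-mono {ℤ.- m} (subst (ℤ.- m ℤ.≤_) (ℤ.neg-distrib-+ (+ 1) n) (ℤ.neg-mono-≤ (ℤ.i<j⇒suc[i]≤j n<m)))))

  p⁻¹∈𝔪 : 𝔪 (+ e) p⁻¹
  p⁻¹∈𝔪 = bound (≤ᵛ-reflexive (≡.trans (inverse-abs (ℤ.- (+ e)) p*p⁻¹≈1 abs-⟦p⟧)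
    (cong pe (ℤ.neg-involutive (+ e)))))

  β⁻¹ : Carrier
  β⁻¹ = proj₁ (inverse (λ β≈0 → case ≡.trans (≡.sym abs-β) (≡.trans (cong-abs β≈0) abs-0) of λ ()))

  β*β⁻¹≈1 : β * β⁻¹ ≈ 1#
  β*β⁻¹≈1 = proj₂ (inverse _)

  β⁻¹∈𝔪 : 𝔪 (ℤ.- (+ 1)) β⁻¹
  β⁻¹∈𝔪 = bound (≤ᵛ-reflexive (inverse-abs (+ 1) β*β⁻¹≈1 abs-β))

  ⟦⟧∈𝔪 : ∀ i → 𝔪 (+ 0) ⟦ i ⟧
  ⟦⟧∈𝔪 (+ n)    = ℕ∈𝔪 n
    where
    ℕ∈𝔪 : ∀ n → 𝔪 (+ 0) ⟦ + n ⟧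
    ℕ∈𝔪 zero    = 𝔪-resp (sym ⟦⟧-homo-0) 𝔪-0
    ℕ∈𝔪 (suc n) = 𝔪-resp (sym (trans (⟦⟧-homo-+ (+ 1) (+ n)) (+-congʳ ⟦⟧-homo-1)))
                    (𝔪-+ 1∈𝔪 (ℕ∈𝔪 n))
  ⟦⟧∈𝔪 -[1+ n ] = 𝔪-resp (sym (⟦⟧-homo-neg (+ suc n))) (𝔪-neg (⟦⟧∈𝔪 (+ suc n)))

  p∣⇒⟦⟧∈𝔪 : ∀ {i} → + p ℤ∣.∣ i → 𝔪 (ℤ.- (+ e)) ⟦ i ⟧
  p∣⇒⟦⟧∈𝔪 (ℤ∣.divides q ≡.refl) = 𝔪-resp (sym (⟦⟧-homo-* q (+ p)))
    (𝔪-cast (ℤ.+-identityˡ (ℤ.- (+ e))) (𝔪-* (⟦⟧∈𝔪 q) p∈𝔪))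

  -e≤-1 : ℤ.- (+ e) ℤ.≤ ℤ.- (+ 1)
  -e≤-1 = ℤ.neg-mono-≤ (ℤ.+≤+ (ℕ.>-nonZero⁻¹ e))

  -- Otherwise a Bézout identity 1 = u i - v p would put 1 into the maximal ideal.
  ⟦⟧∈𝔪⇒p∣ : ∀ {i} → 𝔪 (ℤ.- (+ 1)) ⟦ i ⟧ → + p ℤ∣.∣ i
  ⟦⟧∈𝔪⇒p∣ {i} i∈ = decidable-stable (+ p ℤ∣.∣? i) λ p∤i →
    let u , v , eq = bezout p-prime p∤i in
    1∉𝔪 (𝔪-resp (begin
      ⟦ u ⟧ * ⟦ i ⟧ - ⟦ v ⟧ * ⟦ + p ⟧     ≈⟨ +-cong (⟦⟧-homo-* u i) (-‿cong (⟦⟧-homo-* v (+ p))) ⟨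
      ⟦ u ℤ.* i ⟧ - ⟦ v ℤ.* + p ⟧         ≈⟨ +-congˡ (⟦⟧-homo-neg (v ℤ.* + p)) ⟨
      ⟦ u ℤ.* i ⟧ + ⟦ ℤ.- (v ℤ.* + p) ⟧   ≈⟨ ⟦⟧-homo-+ (u ℤ.* i) (ℤ.- (v ℤ.* + p)) ⟨
      ⟦ u ℤ.* i ℤ.- v ℤ.* + p ⟧           ≡⟨ cong (λ j → ⟦ j ℤ.- v ℤ.* + p ⟧) eq ⟩
      ⟦ + 1 ℤ.+ v ℤ.* + p ℤ.- v ℤ.* + p ⟧ ≡⟨ cong ⟦_⟧ (r (v ℤ.* + p)) ⟩
      ⟦ + 1 ⟧                             ≈⟨ ⟦⟧-homo-1 ⟩
      1#                                  ∎)
    (𝔪-- (𝔪-* (⟦⟧∈𝔪 u) i∈) (𝔪-* (⟦⟧∈𝔪 v) (𝔪-mono -e≤-1 p∈𝔪))))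
    where
    r : ∀ x → + 1 ℤ.+ x ℤ.- x ≡ + 1
    r = ℤ-Solver.solve-∀

-- The residue field

module Homomorphism {a ℓ₁ b ℓ₂} (A : CommutativeRing a ℓ₁) (B : CommutativeRing b ℓ₂)
  (φ : CommutativeRing.Carrier A → CommutativeRing.Carrier B)
  (φ-isHom : Extension.IsHom A B φ) where

  private
    module A = CommutativeRing A
    module φ = RingMorphisms.IsRingHomomorphism φ-isHom
  open CommutativeRing B hiding (zero)
  open Exp A.semiring using () renaming (_^_ to _^ᴬ_)
  open Exp semiring using (_^_)
  open RawMonoidDefs A.+-rawMonoid using () renaming (sum to sumᴬ)
  open CommMonoidSum +-commutativeMonoid using (sum; sum-cong-≋)

  ^-homo : ∀ x n → φ (x ^ᴬ n) ≈ φ x ^ n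
  ^-homo x zero    = φ.1#-homo
  ^-homo x (suc n) = trans (φ.*-homo x (x ^ᴬ n)) (*-congˡ (^-homo x n))

  sum-homo : ∀ {n} (v : Fin n → A.Carrier) → φ (sumᴬ v) ≈ sum (φ ∘ v)
  sum-homo {zero}  v = φ.0#-homo
  sum-homo {suc n} v = trans (φ.+-homo (v zero) (sumᴬ (v ∘ suc))) (+-congˡ (sum-homo (v ∘ suc)))

residue : ∀ p .{{_ : NonZero p}} → ℤ → Fin p
residue p i = Fin.fromℕ< (ℤ/.n%ℕd<d i p)

residue-∣ : ∀ p .{{_ : NonZero p}} i → + p ℤ∣.∣ i ℤ.- + toℕ (residue p i)
residue-∣ p i = ℤ∣.divides (i ℤ/./ℕ p) (begin
  i ℤ.- + toℕ (residue p i)                       ≡⟨ cong (λ r → i ℤ.- + r) (Fin.toℕ-fromℕ< (ℤ/.n%ℕd<d i p)) ⟩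
  i ℤ.- + (i ℤ/.%ℕ p)                           ≡⟨ cong (ℤ._- + (i ℤ/.%ℕ p)) (ℤ/.a≡a%ℕn+[a/ℕn]*n i p) ⟩
  + (i ℤ/.%ℕ p) ℤ.+ (i ℤ/./ℕ p) ℤ.* + p ℤ.- + (i ℤ/.%ℕ p)
    ≡⟨ r (+ (i ℤ/.%ℕ p)) ((i ℤ/./ℕ p) ℤ.* + p) ⟩
  (i ℤ/./ℕ p) ℤ.* + p                           ∎)
  where
  open ≡.≡-Reasoning
  r : ∀ x y → x ℤ.+ y ℤ.- x ≡ y
  r = ℤ-Solver.solve-∀

∣-residue-injective : ∀ p .{{_ : NonZero p}} i j → residue p i ≡ residue p j → + p ℤ∣.∣ i ℤ.- j
∣-residue-injective p i j eq = subst (+ p ℤ∣.∣_) (r i j (+ toℕ (residue p j)))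
  (ℤ∣.∣m∣n⇒∣m-n (subst (λ k → + p ℤ∣.∣ i ℤ.- + toℕ k) eq (residue-∣ p i)) (residue-∣ p j))
  where
  r : ∀ i j r → (i ℤ.- r) ℤ.- (j ℤ.- r) ≡ i ℤ.- j
  r = ℤ-Solver.solve-∀

∣-∣-∣<⇒≡ : ∀ {p i j} → + p ℤ∣.∣ i ℤ.- j → ℤ.∣ i ℤ.- j ∣ ℕ.< p → i ≡ j
∣-∣-∣<⇒≡ {p} {i} {j} p∣i-j <p with ℤ.∣ i ℤ.- j ∣ ℕ.≟ 0
... | yes ≡0 = ℤ.i-j≡0⇒i≡j i j (ℤ.∣i∣≡0⇒i≡0 ≡0)
... | no ≢0  = contradiction (ℕ∣.∣⇒≤ {{ℕ.≢-nonZero ≢0}} (ℤ∣.∣⇒∣ᵤ p∣i-j)) (ℕ.<⇒≱ <p)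

Fin-∣⇒≡ : ∀ {p} {r s : Fin p} → + p ℤ∣.∣ + toℕ r ℤ.- + toℕ s → r ≡ s
Fin-∣⇒≡ {p} {r} {s} p∣ = Fin.toℕ-injective (ℤ.+-injective (∣-∣-∣<⇒≡ p∣
  (ℕ.≤-<-trans (subst (λ i → ℤ.∣ i ∣ ℕ.≤ toℕ r ℕ.⊔ toℕ s) (≡.sym (ℤ.m-n≡m⊖n (toℕ r) (toℕ s)))
                 (ℤ.∣m⊝n∣≤m⊔n (toℕ r) (toℕ s)))
               (ℕ.⊔-pres-<m (Fin.toℕ<n r) (Fin.toℕ<n s)))))

module Residues {p} (p-prime : Prime p) (S : Setting p c ℓ) where

  open Setting S
  open Valued p-prime S
  open Filtered p-prime S
  open Solver using (solve; _:=_; _:+_; _:*_; _:-_; :-_)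
  open import Relation.Binary.Reasoning.Setoid setoid
  open Exp semiring using (^-homo-*; ^-assocʳ; ^-congˡ)
  open CommExp commutativeSemiring using (^-distrib-*)

  open RawMonoidDefs +-rawMonoid using () renaming (_×_ to _•_)
  open CommMonoidSum +-commutativeMonoid using (sum; sum-cong-≗)

  instance
    p≢0 : NonZero p
    p≢0 = prime⇒nonZero p-prime

  -- Horner form exposes the constant coefficient, which is how expansions in γ, β and 1/p are all
  -- taken apart; `sum≈poly` links it to the sums that define `X` and `Z`.
  poly : ∀ {n} → Carrier → (Fin n → Carrier) → Carrier
  poly {zero}  x a = 0#
  poly {suc n} x a = a zero + x * poly x (a ∘ suc)

  poly-cong : ∀ {n} x {a b : Fin n → Carrier} → (∀ i → a i ≈ b i) → poly x a ≈ poly x b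
  poly-cong {zero}  x a≈b = refl
  poly-cong {suc n} x a≈b = +-cong (a≈b zero) (*-congˡ (poly-cong x (a≈b ∘ suc)))

  poly-+ : ∀ {n} x (a b : Fin n → Carrier) → poly x (λ i → a i + b i) ≈ poly x a + poly x b
  poly-+ {zero}  x a b = sym (+-identityˡ 0#)
  poly-+ {suc n} x a b = trans (+-congˡ (*-congˡ (poly-+ x (a ∘ suc) (b ∘ suc))))
    (solve 5 (λ x a b c d → a :+ b :+ x :* (c :+ d) := (a :+ x :* c) :+ (b :+ x :* d)) refl
      x (a zero) (b zero) (poly x (a ∘ suc)) (poly x (b ∘ suc)))

  poly-* : ∀ {n} x k (a : Fin n → Carrier) → poly x (λ i → k * a i) ≈ k * poly x a
  poly-* {zero}  x k a = sym (zeroʳ k)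
  poly-* {suc n} x k a = trans (+-congˡ (*-congˡ (poly-* x k (a ∘ suc))))
    (solve 4 (λ x k a c → k :* a :+ x :* (k :* c) := k :* (a :+ x :* c)) refl
      x k (a zero) (poly x (a ∘ suc)))

  poly-neg : ∀ {n} x (a : Fin n → Carrier) → poly x (λ i → - a i) ≈ - poly x a
  poly-neg x a = trans (poly-cong x (λ i → sym (-1*x≈-x (a i))))
    (trans (poly-* x (- 1#) a) (-1*x≈-x (poly x a)))

  poly-- : ∀ {n} x (a b : Fin n → Carrier) → poly x (λ i → a i - b i) ≈ poly x a - poly x b
  poly-- x a b = trans (poly-+ x a (λ i → - b i)) (+-congˡ (poly-neg x b))

  poly-𝔪 : ∀ {n m x} → 𝔪 (+ 0) x → {a : Fin n → Carrier} → (∀ i → 𝔪 m (a i)) → 𝔪 m (poly x a)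
  poly-𝔪 {zero}  x∈ a∈ = 𝔪-0
  poly-𝔪 {suc n} x∈ a∈ = 𝔪-+ (a∈ zero)
    (𝔪-cast (ℤ.+-identityˡ _) (𝔪-* x∈ (poly-𝔪 x∈ (a∈ ∘ suc))))

  infix 4 _∼_
  -- Congruence modulo the maximal ideal; by discreteness it amounts to |x - y| < 1.
  record _∼_ (x y : Carrier) : Set where
    constructor close
    field difference : 𝔪 (ℤ.- (+ 1)) (x - y)

  open _∼_ public

  ∼-reflexive : ∀ {x y} → x ≈ y → x ∼ y
  ∼-reflexive {x} {y} x≈y = close (𝔪-resp
    (sym (trans (+-congʳ x≈y) (-‿inverseʳ y))) 𝔪-0)

  ∼-sym : ∀ {x y} → x ∼ y → y ∼ x
  ∼-sym {x} {y} (close x-y) = close (𝔪-resp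
    (solve 2 (λ x y → :- (x :- y) := y :- x) refl x y) (𝔪-neg x-y))

  ∼-trans : ∀ {x y z} → x ∼ y → y ∼ z → x ∼ z
  ∼-trans {x} {y} {z} (close x-y) (close y-z) = close (𝔪-resp
    (solve 3 (λ x y z → (x :- y) :+ (y :- z) := x :- z) refl x y z) (𝔪-+ x-y y-z))

  ∼-+ : ∀ {x y z w} → x ∼ y → z ∼ w → x + z ∼ y + w
  ∼-+ {x} {y} {z} {w} (close x-y) (close z-w) = close (𝔪-resp
    (solve 4 (λ x y z w → (x :- y) :+ (z :- w) := (x :+ z) :- (y :+ w)) refl x y z w) (𝔪-+ x-y z-w))

  ∼-*ˡ : ∀ {x y z} → 𝔪 (+ 0) z → x ∼ y → z * x ∼ z * y
  ∼-*ˡ {x} {y} {z} z∈ (close x-y) = close (𝔪-resp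
    (solve 3 (λ x y z → z :* (x :- y) := z :* x :- z :* y) refl x y z) (𝔪-* z∈ x-y))

  ∼0⇒∈𝔪 : ∀ {x} → x ∼ 0# → 𝔪 (ℤ.- (+ 1)) x
  ∼0⇒∈𝔪 {x} (close x-0) = 𝔪-resp (trans (+-congˡ -0#≈0#) (+-identityʳ x)) x-0

  ∈𝔪⇒∼0 : ∀ {x} → 𝔪 (ℤ.- (+ 1)) x → x ∼ 0#
  ∈𝔪⇒∼0 {x} x∈ = close (𝔪-resp (sym (trans (+-congˡ -0#≈0#) (+-identityʳ x))) x∈)

  1≁0 : ¬ (1# ∼ 0#)
  1≁0 1∼0 = 1∉𝔪 (∼0⇒∈𝔪 1∼0)

  ∼-⟦⟧ : ∀ {i j} → + p ℤ∣.∣ i ℤ.- j → ⟦ i ⟧ ∼ ⟦ j ⟧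
  ∼-⟦⟧ {i} {j} p∣ = close (𝔪-resp (⟦⟧-homo-- i j) (𝔪-mono -e≤-1 (p∣⇒⟦⟧∈𝔪 p∣)))

  poly-∼ : ∀ {n x} → 𝔪 (+ 0) x → {a b : Fin n → Carrier} → (∀ i → a i ∼ b i) → poly x a ∼ poly x b
  poly-∼ {zero}  x∈ a∼b = ∼-reflexive refl
  poly-∼ {suc n} x∈ a∼b = ∼-+ (a∼b zero) (∼-*ˡ x∈ (poly-∼ x∈ (a∼b ∘ suc)))

  ^-𝔪 : ∀ {x m} → 𝔪 (+ 0) x → 𝔪 (+ 0) (x ^ m)
  ^-𝔪 {m = zero}  x∈ = 1∈𝔪
  ^-𝔪 {m = suc m} x∈ = 𝔪-* x∈ (^-𝔪 {m = m} x∈)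

  1^ : ∀ n → 1# ^ n ≈ 1#
  1^ zero    = refl
  1^ (suc n) = trans (*-identityˡ _) (1^ n)

  -- If |x| > 1, the inverse of x lies in the maximal ideal, and so would its power 1.
  rootOfUnity∈𝔪 : ∀ {x} n → x ^ suc n ≈ 1# → 𝔪 (+ 0) x
  rootOfUnity∈𝔪 {x} n x^n≈1 with 𝔪? (+ 0) x
  ... | yes x∈ = x∈
  ... | no x∉  = contradiction (𝔪-resp (trans (sym (^-distrib-* x y (suc n))) (trans (^-congˡ (suc n) xy≈1) (1^ (suc n))))
        (𝔪-resp (trans (sym (*-identityˡ _)) (*-congʳ (sym x^n≈1)))
          (𝔪-* y∈ (^-𝔪 {m = n} (𝔪-mono ℤ.-≤+ y∈))))) 1∉𝔪
    where
    x≉0 : ¬ (x ≈ 0#)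
    x≉0 x≈0 = x∉ (𝔪-resp (sym x≈0) 𝔪-0)
    y = proj₁ (inverse x≉0)
    xy≈1 = proj₂ (inverse x≉0)
    y∈ : 𝔪 (ℤ.- (+ 1)) y
    y∈ = ∉𝔪⇒inverse∈𝔪 xy≈1 x∉

  geometric : ℕ → Carrier → Carrier
  geometric zero    x = 0#
  geometric (suc n) x = 1# + x * geometric n x

  geometric-sum : ∀ n x → (x - 1#) * geometric n x ≈ x ^ n - 1#
  geometric-sum zero    x = trans (zeroʳ (x - 1#)) (sym (-‿inverseʳ 1#))
  geometric-sum (suc n) x = begin
    (x - 1#) * (1# + x * geometric n x)           ≈⟨ distribˡ (x - 1#) 1# _ ⟩
    (x - 1#) * 1# + (x - 1#) * (x * geometric n x) ≈⟨ +-cong (*-identityʳ _) (solve 3 (λ o x g →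
        (x :- o) :* (x :* g) := x :* ((x :- o) :* g)) refl 1# x (geometric n x)) ⟩
    (x - 1#) + x * ((x - 1#) * geometric n x)     ≈⟨ +-congˡ (*-congˡ (geometric-sum n x)) ⟩
    (x - 1#) + x * (x ^ n - 1#)                   ≈⟨ solve 3 (λ o x y →
        (x :- o) :+ x :* (y :- o) := (x :* y :- o) :+ (x :- x :* o)) refl 1# x (x ^ n) ⟩
    (x * x ^ n - 1#) + (x - x * 1#)               ≈⟨ +-congˡ (trans (+-congˡ (-‿cong (*-identityʳ x))) (-‿inverseʳ x)) ⟩
    (x * x ^ n - 1#) + 0#                         ≈⟨ +-identityʳ _ ⟩
    x * x ^ n - 1#                                ∎

  geometric-∼ : ∀ n {x} → 𝔪 (+ 0) x → x ∼ 1# → geometric n x ∼ ⟦ + n ⟧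
  geometric-∼ zero    x∈ x∼1 = ∼-reflexive (sym ⟦⟧-homo-0)
  geometric-∼ (suc n) {x} x∈ x∼1 = ∼-trans (∼-+ (∼-reflexive (sym ⟦⟧-homo-1))
      (∼-trans (∼-*ˡ x∈ (geometric-∼ n x∈ x∼1))
      (∼-trans (∼-reflexive (*-comm x _)) (∼-trans (∼-*ˡ (⟦⟧∈𝔪 (+ n)) x∼1) (∼-reflexive (*-identityʳ _))))))
    (∼-reflexive (sym (⟦⟧-homo-+ (+ 1) (+ n))))

  -- If x ≠ 1, dividing x^(n+1) - 1 = 0 by x - 1 shows that the geometric sum is 0. For x congruent
  -- to 1 that sum is congruent to n + 1, which p does not divide.
  rootOfUnity∼1⇒≈1 : ∀ {x} n → ¬ (p ℕ∣.∣ suc n) → x ^ suc n ≈ 1# → x ∼ 1# → x ≈ 1#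
  rootOfUnity∼1⇒≈1 {x} n p∤n x^n≈1 x∼1 with (x - 1#) ≈0?
  ... | yes x-1≈0 = x∙y⁻¹≈ε⇒x≈y x 1# x-1≈0
  ... | no x-1≉0  = contradiction (ℤ∣.∣⇒∣ᵤ (⟦⟧∈𝔪⇒p∣ (∼0⇒∈𝔪
      (∼-trans (∼-sym (geometric-∼ (suc n) (rootOfUnity∈𝔪 n x^n≈1) x∼1)) (∼-reflexive (begin
        geometric (suc n) x                          ≈⟨ *-identityˡ _ ⟨
        1# * geometric (suc n) x                     ≈⟨ *-congʳ (proj₂ (inverse x-1≉0)) ⟨
        (x - 1#) * y * geometric (suc n) x           ≈⟨ solve 3 (λ a b c → a :* b :* c := b :* (a :* c)) refl (x - 1#) y _ ⟩
        y * ((x - 1#) * geometric (suc n) x)         ≈⟨ *-congˡ (geometric-sum (suc n) x) ⟩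
        y * (x ^ suc n - 1#)                         ≈⟨ *-congˡ (trans (+-congʳ x^n≈1) (-‿inverseʳ 1#)) ⟩
        y * 0#                                       ≈⟨ zeroʳ y ⟩
        0#                                           ∎)))))) p∤n
    where
    y = proj₁ (inverse x-1≉0)

  private
    module L = FiniteExtension L
    module Lˣ = Exp L.semiring
    module incl = RingMorphisms.IsRingHomomorphism incl-isHom

  -- The double negation arises because `isField` inverts x only once x is assumed nonzero; the
  -- refutation in `g^≉1` can work with it.
  incl-injective₀ : ∀ {x} → incl x ≈ 0# → ¬ ¬ (x L.≈ L.0#)
  incl-injective₀ {x} ≈0 x≉0 = let y , xy≈1 = proj₂ L.isField x x≉0 in 1≉0 (begin
    1#              ≈⟨ incl.1#-homo ⟨
    incl L.1#       ≈⟨ incl.⟦⟧-cong xy≈1 ⟨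
    incl (x L.* y)  ≈⟨ incl.*-homo x y ⟩
    incl x * incl y ≈⟨ *-congʳ ≈0 ⟩
    0# * incl y     ≈⟨ zeroˡ _ ⟩
    0#              ∎)

  g : Carrier
  g = incl γ

  incl-^ : ∀ x n → incl (x Lˣ.^ n) ≈ incl x ^ n
  incl-^ x zero    = incl.1#-homo
  incl-^ x (suc n) = trans (incl.*-homo x (x Lˣ.^ n)) (*-congˡ (incl-^ x n))

  residueDegree≢0 : ∀ n → HasResidueDegree p K ∣_∣ n → n ≢ 0
  residueDegree≢0 zero (u , _ , reduce) _ =
    let _ , 1<1 , _ = reduce 1# (𝔪⇒≤𝟙 1∈𝔪)
    in 1≁0 (close (<𝟙⇒𝔪 1<1))

  -- With this offset γ has order `suc N` and inverse `g ^ N`, and the p^f elements 0 and γ^-k are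
  -- indexed by `Fin (suc (suc N))`.
  N : ℕ
  N = p ℕ.^ f ℕ.∸ 2

  2+N≡p^f : suc (suc N) ≡ p ℕ.^ f
  2+N≡p^f = ℕ.m+[n∸m]≡n (ℕ.≤-trans (subst (2 ℕ.≤_) (≡.sym (ℕ.^-identityʳ p)) 1<p)
    (ℕ.^-monoʳ-≤ p (ℕ.n≢0⇒n>0 (residueDegree≢0 f residueDegree))))

  1+N≡p^f∸1 : suc N ≡ p ℕ.^ f ℕ.∸ 1
  1+N≡p^f∸1 = cong (ℕ._∸ 1) 2+N≡p^f

  p∤1+N : ¬ (p ℕ∣.∣ suc N)
  p∤1+N p∣1+N = ℕ.<⇒≱ 1<p (ℕ∣.∣⇒≤ (ℕ∣.∣m+n∣m⇒∣n (subst (p ℕ∣.∣_)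
    (≡.trans (≡.sym 2+N≡p^f) (ℕ.+-comm 1 (suc N))) (p∣p^ f (residueDegree≢0 f residueDegree))) p∣1+N))
    where
    p∣p^ : ∀ n → n ≢ 0 → p ℕ∣.∣ p ℕ.^ n
    p∣p^ zero    n≢0 = contradiction ≡.refl n≢0
    p∣p^ (suc n) _   = ℕ∣.m∣m*n (p ℕ.^ n)

  g^[1+N]≈1 : g ^ suc N ≈ 1#
  g^[1+N]≈1 = trans (sym (incl-^ γ (suc N))) (trans (incl.⟦⟧-cong
    (subst (λ n → γ Lˣ.^ n L.≈ L.1#) (≡.sym 1+N≡p^f∸1) (proj₁ γ-primitive))) incl.1#-homo)

  g^≉1 : ∀ k → 0 ℕ.< k → k ℕ.< suc N → ¬ (g ^ k ≈ 1#)
  g^≉1 k 0<k k≤N g^k≈1 = incl-injective₀ (begin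
      incl (γ Lˣ.^ k L.- L.1#)        ≈⟨ incl.+-homo _ _ ⟩
      incl (γ Lˣ.^ k) + incl (L.- L.1#) ≈⟨ +-cong (trans (incl-^ γ k) g^k≈1)
                                               (trans (incl.-‿homo L.1#) (-‿cong incl.1#-homo)) ⟩
      1# - 1#                         ≈⟨ -‿inverseʳ 1# ⟩
      0#                              ∎)
    λ eq → proj₂ γ-primitive k 0<k (subst (k ℕ.<_) 1+N≡p^f∸1 k≤N)
             (GroupProperties.x∙y⁻¹≈ε⇒x≈y L.+-group (γ Lˣ.^ k) L.1# eq)

  g∈𝔪 : 𝔪 (+ 0) g
  g∈𝔪 = rootOfUnity∈𝔪 N g^[1+N]≈1

  g⁻¹ : Carrier
  g⁻¹ = g ^ N

  g⁻¹∈𝔪 : 𝔪 (+ 0) g⁻¹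
  g⁻¹∈𝔪 = ^-𝔪 {m = N} g∈𝔪

  g^*g⁻¹^≈1 : ∀ k → g ^ k * g⁻¹ ^ k ≈ 1#
  g^*g⁻¹^≈1 k = trans (sym (^-distrib-* g g⁻¹ k)) (trans (^-congˡ k g^[1+N]≈1) (1^ k))

  -- The quotient γ^(j-i) would be a root of unity congruent to 1, hence equal to 1, against the
  -- primitivity of γ.
  g^-distinct : ∀ {i j} → i ℕ.< j → j ℕ.< suc N → ¬ (g ^ i ∼ g ^ j)
  g^-distinct {i} {j} i<j j≤N g^i∼g^j = g^≉1 k (ℕ.m<n⇒0<n∸m i<j) (ℕ.≤-<-trans (ℕ.m∸n≤m j i) j≤N)
    (rootOfUnity∼1⇒≈1 N p∤1+N
      (begin
        (g ^ k) ^ suc N     ≈⟨ ^-assocʳ g k (suc N) ⟩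
        g ^ (k ℕ.* suc N)   ≡⟨ cong (g ^_) (ℕ.*-comm k (suc N)) ⟩
        g ^ (suc N ℕ.* k)   ≈⟨ ^-assocʳ g (suc N) k ⟨
        (g ^ suc N) ^ k     ≈⟨ ^-congˡ k g^[1+N]≈1 ⟩
        1# ^ k              ≈⟨ 1^ k ⟩
        1#                  ∎)
      (∼-trans (∼-reflexive (begin
        g ^ k                         ≈⟨ *-identityˡ _ ⟨
        1# * g ^ k                    ≈⟨ *-congʳ (g^*g⁻¹^≈1 i) ⟨
        g ^ i * g⁻¹ ^ i * g ^ k       ≈⟨ solve 3 (λ a b c → a :* b :* c := b :* (a :* c)) refl (g ^ i) (g⁻¹ ^ i) (g ^ k) ⟩
        g⁻¹ ^ i * (g ^ i * g ^ k)     ≈⟨ *-congˡ (^-homo-* g i k) ⟨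
        g⁻¹ ^ i * g ^ (i ℕ.+ k)       ≡⟨ cong (λ n → g⁻¹ ^ i * g ^ n) (ℕ.m+[n∸m]≡n (ℕ.<⇒≤ i<j)) ⟩
        g⁻¹ ^ i * g ^ j               ∎))
      (∼-trans (∼-*ˡ (^-𝔪 {m = i} g⁻¹∈𝔪) (∼-sym g^i∼g^j))
        (∼-reflexive (trans (*-comm _ _) (g^*g⁻¹^≈1 i))))))
    where
    k = j ℕ.∸ i

  combination : ∀ {n} → (Fin n → ℤ) → Carrier
  combination d = poly g (⟦_⟧ ∘ d)

  -- The 𝔽ₚ-span of 1, γ, ..., γ^(n-1) in the residue field, with integers standing for their
  -- classes modulo p.
  Span : ℕ → Carrier → Set
  Span n x = ∃ λ (d : Fin n → ℤ) → x ∼ combination d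

  combination-+ : ∀ {n} (c d : Fin n → ℤ) →
                  combination (λ i → c i ℤ.+ d i) ≈ combination c + combination d
  combination-+ c d = trans (poly-cong g λ i → ⟦⟧-homo-+ (c i) (d i)) (poly-+ g (⟦_⟧ ∘ c) (⟦_⟧ ∘ d))

  combination-* : ∀ {n} k (d : Fin n → ℤ) → combination (λ i → k ℤ.* d i) ≈ ⟦ k ⟧ * combination d
  combination-* k d = trans (poly-cong g λ i → ⟦⟧-homo-* k (d i)) (poly-* g ⟦ k ⟧ (⟦_⟧ ∘ d))

  combination-∼ : ∀ {n} {c d : Fin n → ℤ} → (∀ i → + p ℤ∣.∣ c i ℤ.- d i) → combination c ∼ combination d
  combination-∼ p∣ = poly-∼ g∈𝔪 (∼-⟦⟧ ∘ p∣)

  Span-∼ : ∀ {n x y} → x ∼ y → Span n y → Span n x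
  Span-∼ x∼y (d , y∼) = d , ∼-trans x∼y y∼

  Span-+ : ∀ {n x y} → Span n x → Span n y → Span n (x + y)
  Span-+ (c , x∼) (d , y∼) = _ , ∼-trans (∼-+ x∼ y∼) (∼-reflexive (sym (combination-+ c d)))

  Span-* : ∀ {n x} k → Span n x → Span n (⟦ k ⟧ * x)
  Span-* k (d , x∼) = _ , ∼-trans (∼-*ˡ (⟦⟧∈𝔪 k) x∼) (∼-reflexive (sym (combination-* k d)))

  Span-0 : ∀ n → Span n 0#
  Span-0 n = (λ _ → + 0) , ∼-reflexive (sym (trans (combination-* {n} (+ 0) (λ _ → + 0))
    (trans (*-congʳ ⟦⟧-homo-0) (zeroˡ _))))

  Span-shift : ∀ {n x} k → Span n x → Span (suc n) (⟦ k ⟧ + g * x)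
  Span-shift k (d , x∼) = (λ { zero → k ; (suc i) → d i }) ,
    ∼-+ (∼-reflexive refl) (∼-*ˡ g∈𝔪 x∼)

  Span-mono : ∀ {n x} → Span n x → Span (suc n) x
  Span-mono {zero}  (d , x∼) = Span-∼ x∼ (Span-0 1)
  Span-mono {suc n} (d , x∼) =
    Span-∼ x∼ (Span-shift (d zero) (Span-mono (d ∘ suc , ∼-reflexive refl)))

  -- Multiplication by γ⁻¹ lowers each power by one and sends the constant term to a multiple of
  -- γ⁻¹, which is spanned by assumption. Using γ⁻¹ in place of γ suits the Horner form, where the
  -- lowest coefficient is the exposed one.
  g⁻¹*Span : ∀ {n x} → Span n g⁻¹ → Span n x → Span n (g⁻¹ * x)
  g⁻¹*Span {zero} _ (d , x∼) = Span-∼ (∼-trans (∼-*ˡ g⁻¹∈𝔪 x∼) (∼-reflexive (zeroʳ g⁻¹))) (Span-0 0)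
  g⁻¹*Span {suc n} {x} g⁻¹∈ (d , x∼) = Span-∼
    (∼-trans (∼-*ˡ g⁻¹∈𝔪 x∼) (∼-reflexive (begin
      g⁻¹ * (⟦ d zero ⟧ + g * y)             ≈⟨ solve 4 (λ g h d y → h :* (d :+ g :* y) := d :* h :+ (g :* h) :* y)
                                                 refl g g⁻¹ ⟦ d zero ⟧ y ⟩
      ⟦ d zero ⟧ * g⁻¹ + (g * g⁻¹) * y       ≈⟨ +-congˡ (trans (*-congʳ g^[1+N]≈1) (*-identityˡ y)) ⟩
      ⟦ d zero ⟧ * g⁻¹ + y                   ∎)))
    (Span-+ (Span-* (d zero) g⁻¹∈) (Span-mono (d ∘ suc , ∼-reflexive refl)))
    where
    y = combination (d ∘ suc)

  Span-1 : ∀ {n} → Span n g⁻¹ → Span n 1#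
  Span-1 {zero} (d , g⁻¹∼0) = contradiction
    (∼-trans (∼-reflexive (sym g^[1+N]≈1)) (∼-trans (∼-*ˡ g∈𝔪 g⁻¹∼0) (∼-reflexive (zeroʳ g)))) 1≁0
  Span-1 {suc n} _ = Span-∼ (∼-reflexive (sym (trans (+-cong ⟦⟧-homo-1 (zeroʳ g)) (+-identityʳ 1#))))
    (Span-shift (+ 1) (Span-0 n))

  Span-g⁻¹^ : ∀ {n} → Span n g⁻¹ → ∀ k → Span n (g⁻¹ ^ k)
  Span-g⁻¹^ g⁻¹∈ zero    = Span-1 g⁻¹∈
  Span-g⁻¹^ g⁻¹∈ (suc k) = g⁻¹*Span g⁻¹∈ (Span-g⁻¹^ g⁻¹∈ k)

  code : ∀ {n x} → Span n x → Fin (p ℕ.^ n)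
  code (d , _) = funToFin (residue p ∘ d)

  code-∼ : ∀ {n x y} (x∈ : Span n x) (y∈ : Span n y) → code x∈ ≡ code y∈ → x ∼ y
  code-∼ (c , x∼) (d , y∼) eq = ∼-trans x∼ (∼-trans (combination-∼ λ i →
      ∣-residue-injective p (c i) (d i) (≡.trans (≡.sym (Fin.finToFun-funToFin (residue p ∘ c) i))
        (≡.trans (cong (λ k → finToFun k i) eq) (Fin.finToFun-funToFin (residue p ∘ d) i))))
    (∼-sym y∼))

  g⁻¹^-distinct : ∀ {i j} → i ℕ.< j → j ℕ.< suc N → ¬ (g⁻¹ ^ i ∼ g⁻¹ ^ j)
  g⁻¹^-distinct {i} {j} i<j j≤N h^i∼h^j = g^-distinct i<j j≤N
    (∼-trans (∼-reflexive (side (g^*g⁻¹^≈1 j)))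
    (∼-trans (∼-*ˡ (𝔪-* (^-𝔪 {m = i} g∈𝔪) (^-𝔪 {m = j} g∈𝔪)) (∼-sym h^i∼h^j))
             (∼-reflexive (trans (*-congʳ (*-comm (g ^ i) (g ^ j))) (sym (side (g^*g⁻¹^≈1 i)))))))
    where
    side : ∀ {x y z} → y * z ≈ 1# → x ≈ x * y * z
    side {x} {y} {z} yz≈1 = sym (trans (*-assoc x y z) (trans (*-congˡ yz≈1) (*-identityʳ x)))

  -- If γ⁻¹ were a combination of n < f powers of γ, so would be all the
  -- p^f incongruent elements 0 and γ^-k.
  g⁻¹∉Span : ∀ {n} → n ℕ.< f → ¬ Span n g⁻¹
  g⁻¹∉Span {n} n<f g⁻¹∈ =
    let i , j , i<j , eq = Fin.pigeonhole (subst (p ℕ.^ n ℕ.<_) (≡.sym 2+N≡p^f) (ℕ.^-monoʳ-< p 1<p n<f))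
                             (λ i → code (spanned i))
    in distinct i j i<j (code-∼ (spanned i) (spanned j) eq)
    where
    element : Fin (suc (suc N)) → Carrier
    element zero    = 0#
    element (suc i) = g⁻¹ ^ toℕ i

    spanned : ∀ i → Span n (element i)
    spanned zero    = Span-0 n
    spanned (suc i) = Span-g⁻¹^ g⁻¹∈ (toℕ i)

    distinct : ∀ i j → i Fin.< j → ¬ (element i ∼ element j)
    distinct zero (suc j) _ 0∼ = 1≁0 (∼-trans (∼-reflexive (sym (g^*g⁻¹^≈1 (toℕ j))))
      (∼-trans (∼-*ˡ (^-𝔪 {m = toℕ j} g∈𝔪) (∼-sym 0∼)) (∼-reflexive (zeroʳ _))))
    distinct (suc i) (suc j) (ℕ.s≤s i<j) ∼ = g⁻¹^-distinct i<j (Fin.toℕ<n j) ∼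

  -- A relation c₀ + γ y ∼ 0 with c₀ prime to p can be solved for γ⁻¹ as a combination of n < f
  -- powers, which is excluded. If p divides c₀, cancelling γ leaves a shorter relation.
  independent : ∀ {n} → n ℕ.≤ f → (c : Fin n → ℤ) → combination c ∼ 0# → ∀ i → + p ℤ∣.∣ c i
  independent {suc n} n<f c c∼0 = case + p ℤ∣.∣? c zero of λ where
      (yes p∣c₀) → λ where
        zero    → p∣c₀
        (suc i) → independent (ℕ.<⇒≤ n<f) (c ∘ suc) (tail∼0 p∣c₀) i
      (no p∤c₀)  → contradiction (g⁻¹-spanned p∤c₀) (g⁻¹∉Span n<f)
    where
    y = combination (c ∘ suc)

    y∼-g⁻¹c₀ : y ∼ - (g⁻¹ * ⟦ c zero ⟧)
    y∼-g⁻¹c₀ = close (𝔪-resp (begin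
        g⁻¹ * (⟦ c zero ⟧ + g * y)        ≈⟨ solve 4 (λ g h c y → h :* (c :+ g :* y) := (g :* h) :* y :- :- (h :* c))
                                              refl g g⁻¹ ⟦ c zero ⟧ y ⟩
        (g * g⁻¹) * y - - (g⁻¹ * ⟦ c zero ⟧) ≈⟨ +-congʳ (trans (*-congʳ g^[1+N]≈1) (*-identityˡ y)) ⟩
        y - - (g⁻¹ * ⟦ c zero ⟧)          ∎)
      (𝔪-* g⁻¹∈𝔪 (∼0⇒∈𝔪 c∼0)))

    tail∼0 : + p ℤ∣.∣ c zero → y ∼ 0#
    tail∼0 p∣c₀ = ∼-trans y∼-g⁻¹c₀
      (∈𝔪⇒∼0 (𝔪-neg (𝔪-* g⁻¹∈𝔪 (𝔪-mono -e≤-1 (p∣⇒⟦⟧∈𝔪 p∣c₀)))))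

    g⁻¹-spanned : ¬ (+ p ℤ∣.∣ c zero) → Span n g⁻¹
    g⁻¹-spanned p∤c₀ = let u , v , uc≡1+vp = bezout p-prime p∤c₀ in
      Span-∼ (∼-trans (∼-reflexive (sym (trans (*-congˡ ⟦⟧-homo-1) (*-identityʳ g⁻¹))))
             (∼-trans (∼-*ˡ g⁻¹∈𝔪 (∼-⟦⟧ (ℤ∣.divides (ℤ.- v)
                (≡.trans (cong (λ z → + 1 ℤ.- z) uc≡1+vp) (r v (+ p))))))
             (∼-trans (∼-reflexive (begin
               g⁻¹ * ⟦ u ℤ.* c zero ⟧                ≈⟨ *-congˡ (⟦⟧-homo-* u (c zero)) ⟩
               g⁻¹ * (⟦ u ⟧ * ⟦ c zero ⟧)            ≈⟨ solve 3 (λ h u c → h :* (u :* c) := :- u :* :- (h :* c))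
                                                          refl g⁻¹ ⟦ u ⟧ ⟦ c zero ⟧ ⟩
               - ⟦ u ⟧ * - (g⁻¹ * ⟦ c zero ⟧)        ≈⟨ *-congʳ (⟦⟧-homo-neg u) ⟨
               ⟦ ℤ.- u ⟧ * - (g⁻¹ * ⟦ c zero ⟧)      ∎))
             (∼-*ˡ (⟦⟧∈𝔪 (ℤ.- u)) (∼-sym y∼-g⁻¹c₀)))))
        (Span-* (ℤ.- u) (c ∘ suc , ∼-reflexive refl))
      where
      r : ∀ v p → + 1 ℤ.- (+ 1 ℤ.+ v ℤ.* p) ≡ ℤ.- v ℤ.* p
      r = ℤ-Solver.solve-∀

  coordinates : ∀ {x} → 𝔪 (+ 0) x → Fin (p ℕ.^ f)
  coordinates {x} x∈ = funToFin (proj₁ (proj₂ (proj₂ residueDegree) x (𝔪⇒≤𝟙 x∈)))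

  coordinates-∼ : ∀ {x y} (x∈ : 𝔪 (+ 0) x) (y∈ : 𝔪 (+ 0) y) → coordinates x∈ ≡ coordinates y∈ → x ∼ y
  coordinates-∼ {x} {y} x∈ y∈ eq =
    let r , x-r , _ = proj₂ (proj₂ residueDegree) x (𝔪⇒≤𝟙 x∈)
        s , y-s , _ = proj₂ (proj₂ residueDegree) y (𝔪⇒≤𝟙 y∈)
    in ∼-trans (close (<𝟙⇒𝔪 x-r)) (∼-trans (∼-reflexive (reflexive (sum-cong-≗ λ i →
         cong (λ k → toℕ k • proj₁ residueDegree i)
           (≡.trans (≡.sym (Fin.finToFun-funToFin r i))
             (≡.trans (cong (λ k → finToFun k i) eq) (Fin.finToFun-funToFin s i))))))
       (∼-sym (close (<𝟙⇒𝔪 y-s))))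

  digits : Fin (p ℕ.^ f) → Fin f → ℤ
  digits k i = + toℕ (finToFun {p} {f} k i)

  evaluate : Fin (p ℕ.^ f) → Carrier
  evaluate k = combination (digits k)

  combination∈𝔪 : ∀ {n} (c : Fin n → ℤ) → 𝔪 (+ 0) (combination c)
  combination∈𝔪 c = poly-𝔪 g∈𝔪 (⟦⟧∈𝔪 ∘ c)

  evaluate∈𝔪 : ∀ k → 𝔪 (+ 0) (evaluate k)
  evaluate∈𝔪 k = combination∈𝔪 (digits k)

  combination-- : ∀ {n} (c d : Fin n → ℤ) →
                  combination (λ i → c i ℤ.- d i) ≈ combination c - combination d
  combination-- c d = trans (poly-cong g λ i → ⟦⟧-homo-- (c i) (d i)) (poly-- g (⟦_⟧ ∘ c) (⟦_⟧ ∘ d))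

  evaluate-injective : ∀ {k l} → evaluate k ∼ evaluate l → k ≡ l
  evaluate-injective {k} {l} (close k-l) =
    ≡.trans (≡.sym (Fin.funToFin-finToFin {f} {p} k))
      (≡.trans (funToFin-cong equal-digits) (Fin.funToFin-finToFin {f} {p} l))
    where
    equal-digits : finToFun {p} {f} k ≗ finToFun l
    equal-digits i = Fin-∣⇒≡ (independent ℕ.≤-refl (λ i → digits k i ℤ.- digits l i)
      (∈𝔪⇒∼0 (𝔪-resp (sym (combination-- (digits k) (digits l))) k-l)) i)
    funToFin-cong : ∀ {m} {r s : Fin m → Fin p} → r ≗ s → funToFin r ≡ funToFin s
    funToFin-cong {zero}  r≗s = ≡.refl
    funToFin-cong {suc m} r≗s = cong₂ Fin.combine (r≗s zero) (funToFin-cong (r≗s ∘ suc))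

  -- Distinct coefficient vectors modulo p give incongruent combinations, and coordinates in the
  -- given residue basis separate congruence classes. Evaluation followed by coordinates is thus an
  -- injective self-map of `Fin (p ^ f)`, and it attains the coordinates of x.
  spanning : ∀ {x} → 𝔪 (+ 0) x → Span f x
  spanning {x} x∈ =
    let k , eq = injective⇒surjective (λ k → coordinates (evaluate∈𝔪 k))
                   (λ {k} {l} eq → evaluate-injective (coordinates-∼ (evaluate∈𝔪 k) (evaluate∈𝔪 l) eq))
                   (coordinates x∈)
    in digits k , coordinates-∼ x∈ (evaluate∈𝔪 k) (≡.sym eq)

-- Floors

odd⇒half : ∀ {p} → ¬ (2 ℕ∣.∣ suc p) → p ℕ/./ 2 ℕ.+ p ℕ/./ 2 ≡ p
odd⇒half {p} 2∤1+p with p ℕ/.% 2 in eq | ℕ/.m≡m%n+[m/n]*n p 2 | ℕ/.m%n<n p 2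
... | 0 | p≡ | _ = ≡.trans (cong (p ℕ/./ 2 ℕ.+_) (≡.sym (ℕ.+-identityʳ (p ℕ/./ 2))))
                     (≡.trans (ℕ.*-comm 2 (p ℕ/./ 2)) (≡.sym p≡))
... | 1 | p≡ | _ = contradiction (ℕ∣.divides (suc (p ℕ/./ 2)) (cong suc p≡)) 2∤1+p
... | suc (suc _) | _ | ℕ.s≤s (ℕ.s≤s ())

module _ {p : ℕ} {{_ : NonZero p}} where

  private
    ∣∣≤ : ∀ {d q} → ℤ.- (+ q) ℤ.≤ d → d ℤ.≤ + q → ℤ.∣ d ∣ ℕ.≤ q
    ∣∣≤ {+ n}      _  (ℤ.+≤+ n≤q) = n≤q
    ∣∣≤ { -[1+ n ]} {q} lo _ = ℤ.drop‿+≤+ (subst (+ suc n ℤ.≤_) (ℤ.neg-involutive (+ q)) (ℤ.neg-mono-≤ lo))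

    1+[p∸1]≡p : suc (p ℕ.∸ 1) ≡ p
    1+[p∸1]≡p = ℕ.suc-pred p

  0∈ᴰ : (D : DigitSystem p) → (+ 0) ∈ᴰ D
  0∈ᴰ standard     = ℤ.≤-refl , ℤ.+≤+ ℕ.z≤n
  0∈ᴰ (balanced _) = ℤ.neg-mono-≤ (ℤ.+≤+ ℕ.z≤n) , ℤ.+≤+ ℕ.z≤n

  digit : (D : DigitSystem p) (c : ℤ) → ∃ λ d → d ∈ᴰ D × (+ p ℤ∣.∣ (c ℤ.- d))
  digit standard c = + toℕ (residue p c) ,
    (ℤ.+≤+ ℕ.z≤n , ℤ.+≤+ (ℕ.<⇒≤pred (Fin.toℕ<n (residue p c)))) , residue-∣ p c
  -- Shifting by q carries the interval from -q to q onto the residues 0, ..., p - 1, because 2q = p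
  -- - 1 for odd p.
  digit (balanced 2∤p) c = r ℤ.- + q , (lower , upper) ,
    subst (+ p ℤ∣.∣_) (s c (+ q) r) (residue-∣ p (c ℤ.+ + q))
    where
    q = (p ℕ.∸ 1) ℕ/./ 2
    r = + toℕ (residue p (c ℤ.+ + q))
    s : ∀ c q r → (c ℤ.+ q) ℤ.- r ≡ c ℤ.- (r ℤ.- q)
    s = ℤ-Solver.solve-∀
    lower : ℤ.- (+ q) ℤ.≤ r ℤ.- + q
    lower = subst (ℤ._≤ r ℤ.- + q) (ℤ.+-identityˡ (ℤ.- (+ q))) (ℤ.+-monoˡ-≤ (ℤ.- (+ q)) (ℤ.+≤+ ℕ.z≤n))
    q+q≡p∸1 : q ℕ.+ q ≡ p ℕ.∸ 1
    q+q≡p∸1 = odd⇒half (subst (λ n → ¬ (2 ℕ∣.∣ n)) (≡.sym 1+[p∸1]≡p) 2∤p)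
    upper : r ℤ.- + q ℤ.≤ + q
    upper = subst (r ℤ.- + q ℤ.≤_) (t (+ q)) (ℤ.+-monoˡ-≤ (ℤ.- (+ q))
      (subst (r ℤ.≤_) (≡.trans (cong +_ (≡.sym q+q≡p∸1)) (ℤ.pos-+ q q))
        (ℤ.+≤+ (ℕ.<⇒≤pred (Fin.toℕ<n (residue p (c ℤ.+ + q)))))))
      where
      t : ∀ q → (q ℤ.+ q) ℤ.- q ≡ q
      t = ℤ-Solver.solve-∀

  -- In either system two digits differ by at most p - 1.
  digit-unique : (D : DigitSystem p) → ∀ {c d} → c ∈ᴰ D → d ∈ᴰ D → + p ℤ∣.∣ c ℤ.- d → c ≡ d
  digit-unique standard {+ c} {+ d} (_ , ℤ.+≤+ c≤) (_ , ℤ.+≤+ d≤) p∣ = ∣-∣-∣<⇒≡ p∣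
    (ℕ.≤-<-trans (subst (λ i → ℤ.∣ i ∣ ℕ.≤ c ℕ.⊔ d) (≡.sym (ℤ.m-n≡m⊖n c d)) (ℤ.∣m⊝n∣≤m⊔n c d))
      (ℕ.≤-<-trans (ℕ.⊔-lub c≤ d≤) (ℕ.≤-reflexive 1+[p∸1]≡p)))
  digit-unique (balanced _) {c} {d} (c≥ , c≤) (d≥ , d≤) p∣ = ∣-∣-∣<⇒≡ p∣
    (ℕ.≤-<-trans (ℤ.∣i-j∣≤∣i∣+∣j∣ c d)
    (ℕ.≤-<-trans (ℕ.+-mono-≤ (∣∣≤ c≥ c≤) (∣∣≤ d≥ d≤))
    (ℕ.≤-<-trans (ℕ.≤-trans (ℕ.≤-reflexive (≡.trans (cong (q ℕ.+_) (≡.sym (ℕ.+-identityʳ q))) (ℕ.*-comm 2 q)))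
                   (ℕ/.m/n*n≤m (p ℕ.∸ 1) 2)) (ℕ.≤-reflexive 1+[p∸1]≡p))))
    where
    q = (p ℕ.∸ 1) ℕ/./ 2

bounded : ∀ {n} (k : Fin n → ℕ) → ∃ λ m → ∀ i → k i ℕ.≤ m
bounded {zero}  k = 0 , λ ()
bounded {suc n} k = let m , k≤m = bounded (k ∘ suc) in k zero ℕ.⊔ m , λ where
  zero    → ℕ.m≤m⊔n (k zero) m
  (suc i) → ℕ.≤-trans (k≤m i) (ℕ.m≤n⊔m (k zero) m)

-- Digit expansions in β and 1/p, and their uniqueness

module Expansions {p} (p-prime : Prime p) (S : Setting p c ℓ) (D : DigitSystem p) where

  open Setting S
  open Valued p-prime S
  open Filtered p-prime S
  open Residues p-prime S
  open Solver using (solve; _:=_; _:+_; _:*_; _:-_; :-_)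
  open import Relation.Binary.Reasoning.Setoid setoid
  open CommMonoidSum +-commutativeMonoid using (sum; sum-cong-≋)
  open SemiringSum semiring using (*-distribʳ-sum; *-distribˡ-sum)

  private
    module ℚₚ = CommutativeRing (ℚₚ p)
    module ℤₚ = CommutativeRing (ℤₚ p)
    module ι-homs = Homomorphism (ℚₚ p) (FiniteExtension.ring K) ι ι-isHom
  open Exp ℤₚ.semiring using () renaming (_^_ to _^ℤₚ_)
  open Exp ℚₚ.semiring using () renaming (_^_ to _^ℚₚ_)
  open RawMonoidDefs ℚₚ.+-rawMonoid using () renaming (sum to sumℚₚ)

  private
    ℤ→ℚₚ = Padic.ℤ→ℚₚ p 1<p
    1/p = Padic.1/p p 1<p

  sum≈poly : ∀ {n} x (a : Fin n → Carrier) → sum (λ i → a i * x ^ toℕ i) ≈ poly x a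
  sum≈poly {zero}  x a = refl
  sum≈poly {suc n} x a = +-cong (*-identityʳ (a zero)) (begin
    sum (λ i → a (suc i) * (x * x ^ toℕ i))     ≈⟨ sum-cong-≋ (λ i → solve 3 (λ a x y → a :* (x :* y) := x :* (a :* y))
                                                     refl (a (suc i)) x (x ^ toℕ i)) ⟩
    sum (λ i → x * (a (suc i) * x ^ toℕ i))     ≈⟨ *-distribˡ-sum {n} x (λ i → a (suc i) * x ^ toℕ i) ⟨
    x * sum (λ i → a (suc i) * x ^ toℕ i)       ≈⟨ *-congˡ (sum≈poly x (a ∘ suc)) ⟩
    x * poly x (a ∘ suc)                        ∎)

  open Localisation (ℤₚ p) (fromℤ p (+ p)) using (Fraction; _≃_; equal)
  open Fraction
  open Coherent

  private
    cross : Fraction → Fraction → Coherent p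
    cross x y = (fromℤ p (+ p) ^ℤₚ 0) ℤₚ.* (numerator x ℤₚ.* (fromℤ p (+ p) ^ℤₚ exponent y))

    infix 4 _≐_
    _≐_ : Fraction → Fraction → Set
    x ≐ y = ∀ n → approx (cross x y) n ≡ approx (cross y x) n

    ≐⇒≃ : ∀ {x y} → x ≐ y → x ≃ y
    ≐⇒≃ {x} {y} eq = equal 0 (congruent λ n → ℤ∣.divides (+ 0)
      (≡.trans (cong (ℤ._- approx (cross y x) n) (eq n)) (ℤ.+-inverseʳ (approx (cross y x) n))))

    term : ∀ {m} → (Fin m → ℤ) → Fin m → Fraction
    term d j = ℤ→ℚₚ (d j) ℚₚ.* 1/p ^ℚₚ toℕ j

    ι-term : ∀ {m} (d : Fin m → ℤ) j → ι (term d j) ≈ ⟦ d j ⟧ * p⁻¹ ^ toℕ j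
    ι-term d j = trans (ι.*-homo (ℤ→ℚₚ (d j)) (1/p ^ℚₚ toℕ j)) (*-congˡ (ι-homs.^-homo 1/p (toℕ j)))

    -- The sum y of X's definition is compared with sums of terms through
    -- integer approximations only: a comparison of elements of ℚₚ would
    -- unfold the coherence proofs in them.  The unused equation of
    -- exponents lets unification read off the summands v of the tail of y.
    ι-digitSum : ∀ {x y m} (d : Fin (suc m) → ℤ) → x ≃ y →
                 (v : Fin m → Fraction) → exponent y ≡ exponent (sumℚₚ v) →
                 y ≐ term d zero ℚₚ.+ sumℚₚ v → (∀ j → v j ≐ term d (suc j)) →
                 ι x ≈ poly p⁻¹ (⟦_⟧ ∘ d)
    ι-digitSum {x} {y} d x≃y v _ y≐ v≐ = begin
      ι x                                       ≈⟨ ι.⟦⟧-cong x≃y ⟩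
      ι y                                       ≈⟨ ι.⟦⟧-cong (≐⇒≃ {y} {term d zero ℚₚ.+ sumℚₚ v} y≐) ⟩
      ι (term d zero ℚₚ.+ sumℚₚ v)              ≈⟨ ι.+-homo (term d zero) (sumℚₚ v) ⟩
      ι (term d zero) + ι (sumℚₚ v)             ≈⟨ +-congˡ (ι-homs.sum-homo v) ⟩
      ι (term d zero) + sum (ι ∘ v)             ≈⟨ +-cong (ι-term d zero) (sum-cong-≋ λ j →
                                                     trans (ι.⟦⟧-cong (≐⇒≃ {v j} {term d (suc j)} (v≐ j))) (ι-term d (suc j))) ⟩
      sum (λ j → ⟦ d j ⟧ * p⁻¹ ^ toℕ j)         ≈⟨ sum≈poly p⁻¹ (⟦_⟧ ∘ d) ⟩
      poly p⁻¹ (⟦_⟧ ∘ d)                        ∎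

  X-value : ∀ {x} (x∈ : X D x) → ι x ≈ poly p⁻¹ (⟦_⟧ ∘ proj₁ (proj₂ x∈))
  X-value (m , d , d∈ , x≃) = ι-digitSum d x≃ _ ≡.refl (λ n → ≡.refl) (λ j n → ≡.refl)

  digits⇒X : ∀ {m} (d : Fin (suc m) → ℤ) → (∀ j → d j ∈ᴰ D) → ∃ λ x → X D x × ι x ≈ poly p⁻¹ (⟦_⟧ ∘ d)
  digits⇒X {m} d d∈ = _ , x∈ , X-value x∈
    where
    x∈ : X D _
    x∈ = m , d , d∈ , ℚₚ.refl

  poly-≈0 : ∀ {n} x {a : Fin n → Carrier} → (∀ i → a i ≈ 0#) → poly x a ≈ 0#
  poly-≈0 {zero}  x a≈0 = refl
  poly-≈0 {suc n} x a≈0 = trans (+-cong (a≈0 zero) (trans (*-congˡ (poly-≈0 x (a≈0 ∘ suc))) (zeroʳ x)))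
    (+-identityʳ 0#)

  -- `Z` has the powers of 1/p innermost, but the size estimates peel off one power of 1/p at a
  -- time; this interchange passes between the two.
  poly-comm : ∀ {m n} x y (a : Fin m → Fin n → Carrier) →
              poly x (λ i → poly y (a i)) ≈ poly y (λ j → poly x (λ i → a i j))
  poly-comm {zero} {n} x y a = sym (poly-≈0 {n} y {λ _ → 0#} λ _ → refl)
  poly-comm {suc m} x y a = begin
    poly y (a zero) + x * poly x (λ i → poly y (a (suc i)))
      ≈⟨ +-congˡ (*-congˡ (poly-comm x y (a ∘ suc))) ⟩
    poly y (a zero) + x * poly y (λ j → poly x (λ i → a (suc i) j))
      ≈⟨ +-congˡ (poly-* y x (λ j → poly x (λ i → a (suc i) j))) ⟨
    poly y (a zero) + poly y (λ j → x * poly x (λ i → a (suc i) j))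
      ≈⟨ poly-+ y (a zero) (λ j → x * poly x (λ i → a (suc i) j)) ⟨
    poly y (λ j → a zero j + x * poly x (λ i → a (suc i) j)) ∎

  poly-β-𝔪 : ∀ {n m} {a : Fin n → Carrier} → (∀ i → 𝔪 m (a i)) → 𝔪 (m ℤ.+ ℤ.pred (+ n)) (poly β a)
  poly-β-𝔪 {zero}  a∈ = 𝔪-0
  poly-β-𝔪 {suc n} {m} a∈ = 𝔪-+ (𝔪-mono (ℤ.i≤i+j m (+ n)) (a∈ zero))
    (𝔪-cast (r m (+ n)) (𝔪-* β∈𝔪 (poly-β-𝔪 (a∈ ∘ suc))))
    where
    r : ∀ m n → + 1 ℤ.+ (m ℤ.+ (ℤ.- (+ 1) ℤ.+ n)) ≡ m ℤ.+ n
    r = ℤ-Solver.solve-∀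

  -- A block collects the digits attached to one power of 1/p.
  block : ∀ {n} → (Fin n → Fin f → ℤ) → Carrier
  block c = poly β (combination ∘ c)

  value : ∀ {m} → (Fin m → Fin e → Fin f → ℤ) → Carrier
  value d = poly p⁻¹ (block ∘ d)

  -- Write the block as c₀ + β y. As c₀ is integral, so is β y; hence y ∼ 0, and by induction p
  -- divides the digits of y. Then β y has exponent at most n - e ≤ -1, which is where n < e enters,
  -- so c₀ ∼ 0 as well.
  block-∼0 : ∀ {n} → n ℕ.≤ e → (c : Fin n → Fin f → ℤ) → block c ∼ 0# → ∀ i j → + p ℤ∣.∣ c i j
  block-∼0 {suc n} n<e c c∼0 = λ where
      zero    → independent ℕ.≤-refl (c zero) head∼0
      (suc i) → p∣tail i
    where
    y = block (c ∘ suc)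

    tail∼0 : y ∼ 0#
    tail∼0 = ∈𝔪⇒∼0 (𝔪-resp (begin
        β⁻¹ * (combination (c zero) + β * y - combination (c zero)) ≈⟨ solve 4 (λ b b′ x y →
          b′ :* ((x :+ b :* y) :- x) := (b :* b′) :* y) refl β β⁻¹ (combination (c zero)) y ⟩
        (β * β⁻¹) * y                                              ≈⟨ *-congʳ β*β⁻¹≈1 ⟩
        1# * y                                                     ≈⟨ *-identityˡ y ⟩
        y                                                          ∎)
      (𝔪-* β⁻¹∈𝔪 (𝔪-- (𝔪-mono ℤ.-≤+ (∼0⇒∈𝔪 c∼0)) (combination∈𝔪 (c zero)))))

    p∣tail : ∀ i j → + p ℤ∣.∣ c (suc i) j
    p∣tail = block-∼0 (ℕ.<⇒≤ n<e) (c ∘ suc) tail∼0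

    βy∈𝔪 : 𝔪 (ℤ.- (+ 1)) (β * y)
    βy∈𝔪 = 𝔪-mono (subst (ℤ._≤ ℤ.- (+ 1)) (r (+ e) (+ n)) (ℤ.+-monoˡ-≤ (ℤ.- (+ 1)) (ℤ.i≤j⇒i-j≤0 (ℤ.+≤+ n<e))))
      (𝔪-* β∈𝔪 (poly-β-𝔪 (λ i → poly-𝔪 g∈𝔪 (λ j → p∣⇒⟦⟧∈𝔪 (p∣tail i j)))))
      where
      r : ∀ e n → (+ 1 ℤ.+ n) ℤ.- e ℤ.- + 1 ≡ + 1 ℤ.+ (ℤ.- e ℤ.+ (ℤ.- (+ 1) ℤ.+ n))
      r = ℤ-Solver.solve-∀

    head∼0 : combination (c zero) ∼ 0#
    head∼0 = ∈𝔪⇒∼0 (𝔪-resp (solve 2 (λ x y → (x :+ y) :- y := x) refl (combination (c zero)) (β * y))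
      (𝔪-- (∼0⇒∈𝔪 c∼0) βy∈𝔪))

  block∈𝔪 : (c : Fin e → Fin f → ℤ) → 𝔪 (ℤ.pred (+ e)) (block c)
  block∈𝔪 c = 𝔪-cast (ℤ.+-identityˡ (ℤ.pred (+ e))) (poly-β-𝔪 {e} {+ 0} (combination∈𝔪 ∘ c))

  p-shift : ∀ {x y w} → x ≈ y + p⁻¹ * w → ⟦ + p ⟧ * (x - y) ≈ w
  p-shift {x} {y} {w} x≈ = begin
    ⟦ + p ⟧ * (x - y)                  ≈⟨ *-congˡ (+-congʳ x≈) ⟩
    ⟦ + p ⟧ * (y + p⁻¹ * w - y)        ≈⟨ solve 4 (λ P Q y w → P :* ((y :+ Q :* w) :- y) := (P :* Q) :* w)
                                            refl ⟦ + p ⟧ p⁻¹ y w ⟩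
    (⟦ + p ⟧ * p⁻¹) * w                ≈⟨ trans (*-congʳ p*p⁻¹≈1) (*-identityˡ w) ⟩
    w                                  ∎

  -- Solving for the tail multiplies the head block by p, which brings it from `𝔪 (e - 1)` into the
  -- maximal ideal; so the tail is congruent to 0. The induction has to deliver that its digits
  -- vanish: divisibility by p alone would be lost when the tail is scaled by 1/p again.
  value-∼0 : ∀ {m} (d : Fin m → Fin e → Fin f → ℤ) → (∀ k i j → + p ℤ∣.∣ d k i j → d k i j ≡ + 0) →
             value d ∼ 0# → ∀ k i j → d k i j ≡ + 0
  value-∼0 {suc m} d small d∼0 = λ where
      zero i j    → small zero i j (block-∼0 ℕ.≤-refl (d zero) head∼0 i j)
      (suc k) i j → tail≡0 k i j
    where
    y = value (d ∘ suc)

    tail≡0 : ∀ k i j → d (suc k) i j ≡ + 0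
    tail≡0 = value-∼0 (d ∘ suc) (small ∘ suc) (∈𝔪⇒∼0 (𝔪-resp (p-shift refl)
      (𝔪-cast (r (+ e)) (𝔪-* p∈𝔪 (𝔪-- (𝔪-mono (ℤ.pred-mono {+ 0} {+ e} (ℤ.+≤+ ℕ.z≤n)) (∼0⇒∈𝔪 d∼0)) (block∈𝔪 (d zero)))))))
      where
      r : ∀ e → ℤ.- e ℤ.+ (ℤ.- (+ 1) ℤ.+ e) ≡ ℤ.- (+ 1)
      r = ℤ-Solver.solve-∀

    y≈0 : y ≈ 0#
    y≈0 = poly-≈0 p⁻¹ λ k → poly-≈0 β λ i → poly-≈0 g λ j →
      trans (reflexive (cong ⟦_⟧ (tail≡0 k i j))) ⟦⟧-homo-0

    head∼0 : block (d zero) ∼ 0#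
    head∼0 = ∼-trans (∼-reflexive (sym (trans (+-congˡ (trans (*-congˡ y≈0) (zeroʳ p⁻¹))) (+-identityʳ _)))) d∼0

  Expansion : ℕ → Carrier → Set ℓ
  Expansion m z = ∃ λ (d : Fin m → Fin e → Fin f → ℤ) → (∀ k i j → d k i j ∈ᴰ D) × z ≈ value d

  Expansion-unique : ∀ {m y z} → Expansion m y → Expansion m z → y ∼ z → y ≈ z
  Expansion-unique {m} {y} {z} (c , c∈ , y≈) (d , d∈ , z≈) y∼z = begin
      y        ≈⟨ y≈ ⟩
      value c  ≈⟨ poly-cong p⁻¹ (λ k → poly-cong β λ i → poly-cong g λ j →
                    reflexive (cong ⟦_⟧ (ℤ.i-j≡0⇒i≡j _ _ (δ≡0 k i j)))) ⟩
      value d  ≈⟨ z≈ ⟨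
      z        ∎
    where
    δ : Fin m → Fin e → Fin f → ℤ
    δ k i j = c k i j ℤ.- d k i j

    value-δ : value δ ≈ y - z
    value-δ = begin
      value δ
        ≈⟨ poly-cong p⁻¹ (λ k → trans (poly-cong β λ i → combination-- (c k i) (d k i))
                                      (poly-- β (combination ∘ c k) (combination ∘ d k))) ⟩
      poly p⁻¹ (λ k → block (c k) - block (d k))
        ≈⟨ poly-- p⁻¹ (block ∘ c) (block ∘ d) ⟩
      value c - value d   ≈⟨ +-cong y≈ (-‿cong z≈) ⟨
      y - z               ∎

    δ≡0 : ∀ k i j → δ k i j ≡ + 0
    δ≡0 = value-∼0 δ
      (λ k i j p∣ → ℤ.i≡j⇒i-j≡0 (digit-unique D (c∈ k i j) (d∈ k i j) p∣))
      (∈𝔪⇒∼0 (𝔪-resp (sym value-δ) (difference y∼z)))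

-- Existence and uniqueness of floors

module Floors {p} (p-prime : Prime p) (S : Setting p c ℓ) (D : DigitSystem p) where

  open Setting S
  open Valued p-prime S
  open Filtered p-prime S
  open Residues p-prime S
  open Expansions p-prime S D
  open ContinuedFractions S D using (Z)
  open Solver using (solve; _:=_; _:+_; _:*_; _:-_; :-_)
  open import Relation.Binary.Reasoning.Setoid setoid
  open CommMonoidSum +-commutativeMonoid using (sum; sum-cong-≋)
  open SemiringSum semiring using (*-distribʳ-sum)

  doubleSum≈poly : ∀ {m n} x y (a : Fin m → Fin n → Carrier) →
    sum (λ i → sum (λ j → a i j * y ^ toℕ j * x ^ toℕ i)) ≈ poly x (λ i → poly y (a i))
  doubleSum≈poly x y a = trans
    (sum-cong-≋ λ i → trans (sym (*-distribʳ-sum (x ^ toℕ i) (λ j → a i j * y ^ toℕ j)))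
                            (*-congʳ (sum≈poly y (a i))))
    (sum≈poly x (λ i → poly y (a i)))

  value-comm : ∀ {m} (d : Fin m → Fin e → Fin f → ℤ) →
               value d ≈ poly β (λ i → poly g (λ j → poly p⁻¹ (λ k → ⟦ d k i j ⟧)))
  value-comm d = trans (poly-comm p⁻¹ β (λ k i → combination (d k i)))
    (poly-cong β λ i → poly-comm p⁻¹ g (λ k j → ⟦ d k i j ⟧))

  Expansion⇒Z : ∀ {m z} → Expansion (suc m) z → Z z
  Expansion⇒Z {m} {z} (d , d∈ , z≈) =
    let b = λ i j → digits⇒X (λ k → d k i j) (λ k → d∈ k i j)
    in (λ i j → proj₁ (b i j)) , (λ i j → proj₁ (proj₂ (b i j))) , (begin
      z                                                                ≈⟨ z≈ ⟩
      value d                                                          ≈⟨ value-comm d ⟩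
      poly β (λ i → poly g (λ j → poly p⁻¹ (λ k → ⟦ d k i j ⟧)))       ≈⟨ poly-cong β (λ i → poly-cong g λ j →
                                                                            proj₂ (proj₂ (b i j))) ⟨
      poly β (λ i → poly g (λ j → ι (proj₁ (b i j))))                  ≈⟨ doubleSum≈poly β g (λ i j → ι (proj₁ (b i j))) ⟨
      sum (λ i → sum (λ j → ι (proj₁ (b i j)) * g ^ toℕ j * β ^ toℕ i)) ∎)

  DigitPoly : ℕ → Carrier → Set ℓ
  DigitPoly m x = ∃ λ (d : Fin m → ℤ) → (∀ k → d k ∈ᴰ D) × x ≈ poly p⁻¹ (⟦_⟧ ∘ d)

  -- Padding with zero digits: the coefficients of an element of `Z` may have different lengths.
  DigitPoly-mono : ∀ {m n x} → m ℕ.≤ n → DigitPoly m x → DigitPoly n x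
  DigitPoly-mono {n = n} ℕ.z≤n (_ , _ , x≈) = (λ _ → + 0) , (λ _ → 0∈ᴰ D) ,
    trans x≈ (sym (poly-≈0 {n} p⁻¹ (λ _ → ⟦⟧-homo-0)))
  DigitPoly-mono (ℕ.s≤s m≤n) (d , d∈ , x≈) =
    let d′ , d′∈ , y≈ = DigitPoly-mono m≤n (d ∘ suc , d∈ ∘ suc , refl) in
      (λ { zero → d zero ; (suc k) → d′ k })
    , (λ { zero → d∈ zero ; (suc k) → d′∈ k })
    , trans x≈ (+-congˡ (*-congˡ y≈))

  X⇒DigitPoly : ∀ {x} → X D x → ∃ λ m → DigitPoly m (ι x)
  X⇒DigitPoly x∈@(m , d , d∈ , _) = suc m , d , d∈ , X-value x∈

  -- All lengths from m on are offered, so that two elements of `Z` can be compared at a common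
  -- length.
  Z⇒Expansion : ∀ {z} → Z z → ∃ λ m → ∀ {n} → m ℕ.≤ n → Expansion n z
  Z⇒Expansion {z} (b , b∈ , z≈) =
    let row   = λ i → bounded (λ j → proj₁ (X⇒DigitPoly (b∈ i j)))
        m , ≤m = bounded (λ i → proj₁ (row i))
    in m , λ m≤n →
      let digits = λ i j → DigitPoly-mono (ℕ.≤-trans (ℕ.≤-trans (proj₂ (row i) j) (≤m i)) m≤n)
                                          (proj₂ (X⇒DigitPoly (b∈ i j)))
          d = λ k i j → proj₁ (digits i j) k
      in d , (λ k i j → proj₁ (proj₂ (digits i j)) k) , (begin
        z                                                            ≈⟨ z≈ ⟩
        sum (λ i → sum (λ j → ι (b i j) * g ^ toℕ j * β ^ toℕ i))    ≈⟨ doubleSum≈poly β g (λ i j → ι (b i j)) ⟩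
        poly β (λ i → poly g (λ j → ι (b i j)))                      ≈⟨ poly-cong β (λ i → poly-cong g λ j →
                                                                          proj₂ (proj₂ (digits i j))) ⟩
        poly β (λ i → poly g (λ j → poly p⁻¹ (λ k → ⟦ d k i j ⟧)))   ≈⟨ value-comm d ⟨
        value d                                                      ∎)

  Z-unique : ∀ {y z} → Z y → Z z → y ∼ z → y ≈ z
  Z-unique y∈ z∈ = let m , y-exp = Z⇒Expansion y∈
                       n , z-exp = Z⇒Expansion z∈
                   in Expansion-unique (y-exp (ℕ.m≤m⊔n m n)) (z-exp (ℕ.m≤n⊔m m n))

  toDigits : ∀ {n x} → Span n x → ∃ λ (d : Fin n → ℤ) → (∀ j → d j ∈ᴰ D) × x ∼ combination d
  toDigits (c , x∼) = (λ j → proj₁ (digit D (c j))) , (λ j → proj₁ (proj₂ (digit D (c j)))) ,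
    ∼-trans x∼ (combination-∼ λ j → proj₂ (proj₂ (digit D (c j))))

  ∷-all : ∀ {a q n} {A : Set a} (Q : A → Set q) {x : A} {xs : Fin n → A} →
          Q x → (∀ i → Q (xs i)) → ∀ i → Q ((x Vector.∷ xs) i)
  ∷-all Q x∈ xs∈ zero    = x∈
  ∷-all Q x∈ xs∈ (suc i) = xs∈ i

  Block : ℕ → Carrier → Set
  Block n x = ∃ λ (d : Fin n → Fin f → ℤ) → (∀ i j → d i j ∈ᴰ D) × x ∼ block d

  ∼-+-intro : ∀ {x y z} → x - z ∼ y → x ∼ y + z
  ∼-+-intro {x} {y} {z} (close x-z-y) = close (𝔪-resp
    (solve 3 (λ x y z → (x :- z) :- y := x :- (y :+ z)) refl x y z) x-z-y)

  -- An expansion of x/β with error in the maximal ideal, scaled back by β, has an integral error,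
  -- which the constant coefficient absorbs.
  block-exists : ∀ n {x} → 𝔪 (ℤ.pred (+ n)) x → Block n x
  block-exists zero x∈ = (λ ()) , (λ ()) , ∈𝔪⇒∼0 x∈
  block-exists (suc n) {x} x∈ = extend (block-exists n (𝔪-* β⁻¹∈𝔪 x∈))
    where
    remainder : ∀ {y} → β⁻¹ * x ∼ y → 𝔪 (+ 0) (x - β * y)
    remainder {y} x/β∼y = 𝔪-resp (begin
      β * (β⁻¹ * x - y)        ≈⟨ solve 4 (λ b b′ x y → b :* (b′ :* x :- y) := (b :* b′) :* x :- b :* y) refl β β⁻¹ x y ⟩
      (β * β⁻¹) * x - β * y    ≈⟨ +-congʳ (trans (*-congʳ β*β⁻¹≈1) (*-identityˡ x)) ⟩
      x - β * y                ∎) (𝔪-* β∈𝔪 (difference x/β∼y))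

    cons : ∀ {d : Fin n → Fin f → ℤ} → (∀ i j → d i j ∈ᴰ D) →
           (∃ λ (d₀ : Fin f → ℤ) → (∀ j → d₀ j ∈ᴰ D) × x - β * block d ∼ combination d₀) → Block (suc n) x
    cons {d} d∈ (d₀ , d₀∈ , rest∼) = (d₀ Vector.∷ d) , ∷-all (λ (c : Fin f → ℤ) → ∀ j → c j ∈ᴰ D) {d₀} {d} d₀∈ d∈ , ∼-+-intro rest∼

    extend : Block n (β⁻¹ * x) → Block (suc n) x
    extend (d , d∈ , x/β∼) = cons d∈ (toDigits (spanning (remainder x/β∼)))

  -- The same descent with 1/p in the role of β: an error of p x in the maximal ideal becomes, after
  -- division by p, an element of `𝔪 (e - 1)`, exactly the range of one block.
  Expansion-exists : ∀ m {x} → 𝔪 (+ m ℤ.* + e ℤ.+ ℤ.pred (+ e)) x →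
                     ∃ λ z → Expansion (suc m) z × x ∼ z
  Expansion-exists zero {x} x∈ = single (block-exists e (𝔪-cast (ℤ.+-identityˡ (ℤ.pred (+ e))) x∈))
    where
    single : Block e x → ∃ λ z → Expansion 1 z × x ∼ z
    single (d , d∈ , x∼) = block d + p⁻¹ * 0# , ((λ _ → d) , (λ _ → d∈) , refl) ,
      ∼-trans x∼ (∼-reflexive (sym (trans (+-congˡ (zeroʳ p⁻¹)) (+-identityʳ (block d)))))
  Expansion-exists (suc m) {x} x∈ = extend (Expansion-exists m (𝔪-cast (r (+ m) (+ e)) (𝔪-* p∈𝔪 x∈)))
    where
    r : ∀ m e → ℤ.- e ℤ.+ ((+ 1 ℤ.+ m) ℤ.* e ℤ.+ (ℤ.- (+ 1) ℤ.+ e)) ≡ m ℤ.* e ℤ.+ (ℤ.- (+ 1) ℤ.+ e)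
    r = ℤ-Solver.solve-∀

    remainder : ∀ {z} → ⟦ + p ⟧ * x ∼ z → 𝔪 (ℤ.pred (+ e)) (x - p⁻¹ * z)
    remainder {z} px∼z = 𝔪-cast (ℤ.+-comm (+ e) (ℤ.- (+ 1))) (𝔪-resp (begin
      p⁻¹ * (⟦ + p ⟧ * x - z)         ≈⟨ solve 4 (λ P Q x z → Q :* (P :* x :- z) := (P :* Q) :* x :- Q :* z)
                                           refl ⟦ + p ⟧ p⁻¹ x z ⟩
      (⟦ + p ⟧ * p⁻¹) * x - p⁻¹ * z   ≈⟨ +-congʳ (trans (*-congʳ p*p⁻¹≈1) (*-identityˡ x)) ⟩
      x - p⁻¹ * z                     ∎) (𝔪-* p⁻¹∈𝔪 (difference px∼z)))

    cons : ∀ {z} → Expansion (suc m) z → Block e (x - p⁻¹ * z) → ∃ λ z → Expansion (suc (suc m)) z × x ∼ z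
    cons {z} (d , d∈ , z≈) (d₀ , d₀∈ , rest∼) = block d₀ + p⁻¹ * z ,
      ((d₀ Vector.∷ d) , ∷-all (λ (c : Fin e → Fin f → ℤ) → ∀ i j → c i j ∈ᴰ D) {d₀} {d} d₀∈ d∈ , +-congˡ (*-congˡ z≈)) , ∼-+-intro rest∼

    extend : (∃ λ z → Expansion (suc m) z × ⟦ + p ⟧ * x ∼ z) → ∃ λ z → Expansion (suc (suc m)) z × x ∼ z
    extend (z , z∈ , px∼z) = cons z∈ (block-exists e (remainder px∼z))

  floor : ∀ x → ∃ λ z → Z z × x ∼ z
  floor x = let n , x∈ = 𝔪-exhaust x
                z , z∈ , x∼z = Expansion-exists n (𝔪-mono (n≤ n) x∈)
            in z , Expansion⇒Z z∈ , x∼z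
    where
    n≤ : ∀ n → + n ℤ.≤ + n ℤ.* + e ℤ.+ ℤ.pred (+ e)
    n≤ n = subst (ℤ._≤ + n ℤ.* + e ℤ.+ ℤ.pred (+ e)) (ℤ.+-identityʳ (+ n))
      (ℤ.+-mono-≤ (subst (+ n ℤ.≤_) (ℤ.pos-* n e) (ℤ.+≤+ (ℕ.m≤m*n n e)))
                  (ℤ.pred-mono (ℤ.+≤+ (ℕ.>-nonZero⁻¹ e))))

-- Continued fractions

module ContinuedFraction {p} (p-prime : Prime p) (S : Setting p c ℓ) (D : DigitSystem p) where

  open Setting S
  open Valued p-prime S
  open Filtered p-prime S
  open Residues p-prime S
  open Floors p-prime S D
  open ContinuedFractions S D
  open Solver using (solve; _:=_; _:+_; _:*_; _:-_; :-_)
  open import Relation.Binary.Reasoning.Setoid setoid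

  ∉𝔪⇒>𝟙 : ∀ {x} → ¬ 𝔪 (+ 0) x → 𝟙 <ᵛ ∣ x ∣
  ∉𝔪⇒>𝟙 x∉ = ≰⇒>ᵛ (x∉ ∘ ≤𝟙⇒𝔪)

  >𝟙⇒∉𝔪 : ∀ {x} → 𝟙 <ᵛ ∣ x ∣ → ¬ 𝔪 (+ 0) x
  >𝟙⇒∉𝔪 x> x∈ = >⇒≰ᵛ x> (𝔪⇒≤𝟙 x∈)

  ∼-∈𝔪 : ∀ {n x y} → x ∼ y → 𝔪 (+ n) y → 𝔪 (+ n) x
  ∼-∈𝔪 {n} {x} {y} (close x-y) y∈ = 𝔪-resp (solve 2 (λ x y → (x :- y) :+ y := x) refl x y)
    (𝔪-+ (𝔪-mono ℤ.-≤+ x-y) y∈)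

  ∉𝔪⇒≉0 : ∀ {n x} → ¬ 𝔪 n x → ¬ (x ≈ 0#)
  ∉𝔪⇒≉0 x∉ x≈0 = x∉ (𝔪-resp (sym x≈0) 𝔪-0)

  inverse∉𝔪 : ∀ {x y} → x * y ≈ 1# → 𝔪 (ℤ.- (+ 1)) x → ¬ 𝔪 (+ 0) y
  inverse∉𝔪 xy≈1 x∈ y∈ = 1∉𝔪 (𝔪-resp xy≈1 (𝔪-* x∈ y∈))

  inverse-unique : ∀ {a b x y} → a ≈ b → a * x ≈ 1# → b * y ≈ 1# → x ≈ y
  inverse-unique {a} {b} {x} {y} a≈b ax≈1 by≈1 = begin
    x             ≈⟨ *-identityˡ x ⟨
    1# * x        ≈⟨ *-congʳ by≈1 ⟨
    b * y * x     ≈⟨ *-congʳ (*-congʳ a≈b) ⟨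
    a * y * x     ≈⟨ solve 3 (λ a x y → a :* y :* x := y :* (a :* x)) refl a x y ⟩
    y * (a * x)   ≈⟨ trans (*-congˡ ax≈1) (*-identityʳ y) ⟩
    y             ∎

  -- 1/y - 1/v = (v - y)/(v y), so inversion contracts differences outside the unit ball.
  inverse-difference : ∀ {y t v w} → y * t ≈ 1# → v * w ≈ 1# → w - t ≈ w * t * (y - v)
  inverse-difference {y} {t} {v} {w} yt≈1 vw≈1 = sym (begin
    w * t * (y - v)                ≈⟨ solve 4 (λ y t v w → w :* t :* (y :- v) := w :* (y :* t) :- (v :* w) :* t) refl y t v w ⟩
    w * (y * t) - (v * w) * t      ≈⟨ +-cong (trans (*-congˡ yt≈1) (*-identityʳ w))
                                             (-‿cong (trans (*-congʳ vw≈1) (*-identityˡ t))) ⟩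
    w - t                          ∎)

  ⌊_⌋ : Carrier → Carrier
  ⌊ x ⌋ = proj₁ (floor x)

  ⌊_⌋∈Z : ∀ x → Z ⌊ x ⌋
  ⌊ x ⌋∈Z = proj₁ (proj₂ (floor x))

  ∼⌊_⌋ : ∀ x → x ∼ ⌊ x ⌋
  ∼⌊ x ⌋ = proj₂ (proj₂ (floor x))

  Ends : Carrier → Set ℓ
  Ends x = x - ⌊ x ⌋ ≈ 0#

  ends? : ∀ x → Dec (Ends x)
  ends? x = (x - ⌊ x ⌋) ≈0?

  -- With the junk value 1/0 = 0.
  reciprocal : ∀ {x} → Dec (x ≈ 0#) → Carrier
  reciprocal (yes _)  = 0#
  reciprocal (no x≉0) = proj₁ (inverse x≉0)

  reciprocal-inverse : ∀ {x} (x≈0? : Dec (x ≈ 0#)) → ¬ (x ≈ 0#) → x * reciprocal x≈0? ≈ 1#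
  reciprocal-inverse (yes x≈0) x≉0 = contradiction x≈0 x≉0
  reciprocal-inverse (no x≉0)  _   = proj₂ (inverse x≉0)

  next : Carrier → Carrier
  next x = reciprocal (ends? x)

  next-inverse : ∀ x → ¬ Ends x → (x - ⌊ x ⌋) * next x ≈ 1#
  next-inverse x = reciprocal-inverse (ends? x)

  next∉𝔪 : ∀ x → ¬ Ends x → ¬ 𝔪 (+ 0) (next x)
  next∉𝔪 x ¬end = inverse∉𝔪 (next-inverse x ¬end) (difference ∼⌊ x ⌋)

  ⌊next⌋∈Z* : ∀ x → ¬ Ends x → Z* ⌊ next x ⌋
  ⌊next⌋∈Z* x ¬end = ⌊ next x ⌋∈Z , ∉𝔪⇒>𝟙 λ ∈ → next∉𝔪 x ¬end (∼-∈𝔪 ∼⌊ next x ⌋ ∈)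

  iter : ℕ → Carrier → Carrier
  iter zero    x = x
  iter (suc n) x = iter n (next x)

  finite-expansion : ∀ n x → Ends (iter n x) → ∃ λ cs → All Z* cs × x ≈[ ⌊ x ⌋ ⨾ cs ]
  finite-expansion zero x end = [] , [] , lift (x∙y⁻¹≈ε⇒x≈y x ⌊ x ⌋ end)
  finite-expansion (suc n) x end = case ends? x of λ where
    -- The index n need not be the least at which the algorithm ends; going on from here would feed
    -- in the junk value of `next`.
    (yes x≈⌊x⌋) → [] , [] , lift (x∙y⁻¹≈ε⇒x≈y x ⌊ x ⌋ x≈⌊x⌋)
    (no ¬end)    → let cs , cs∈ , next≈ = finite-expansion n (next x) end in
      ⌊ next x ⌋ ∷ cs , ⌊next⌋∈Z* x ¬end ∷ cs∈ ,
      (next x , x - ⌊ x ⌋ , next≈ , trans (*-comm _ _) (next-inverse x ¬end)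
      , solve 2 (λ x z → x := z :+ (x :- z)) refl x ⌊ x ⌋)

  digit-sequence : Carrier → ℕ → Carrier
  digit-sequence x n = ⌊ iter n x ⌋

  digit-sequence∈Z* : ∀ n x → (∀ n → ¬ Ends (iter n x)) → Z* (digit-sequence x (suc n))
  digit-sequence∈Z* zero    x ¬end = ⌊next⌋∈Z* x (¬end 0)
  digit-sequence∈Z* (suc n) x ¬end = digit-sequence∈Z* n (next x) (¬end ∘ suc)

  -- The convergents of x arise from those of `next x` by v ↦ ⌊x⌋ + 1/v. As v and `next x` both lie
  -- outside the unit ball, each step multiplies the error by at most p^(-2/e); a gain of p^(-1/e)
  -- per step is enough.
  convergent : ∀ n x → (∀ n → ¬ Ends (iter n x)) →
    ∃ λ v → v ≈[ ⌊ x ⌋ ⨾ applyUpTo (digit-sequence x ∘ suc) n ] × 𝔪 (ℤ.- (+ suc n)) (v - x)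
  convergent zero x ¬end = ⌊ x ⌋ , lift refl , difference (∼-sym ∼⌊ x ⌋)
  convergent (suc n) x ¬end = extend (convergent n (next x) (¬end ∘ suc))
    where
    t = x - ⌊ x ⌋

    extend : (∃ λ v → v ≈[ ⌊ next x ⌋ ⨾ applyUpTo (digit-sequence (next x) ∘ suc) n ]
                    × 𝔪 (ℤ.- (+ suc n)) (v - next x)) →
             ∃ λ v → v ≈[ ⌊ x ⌋ ⨾ applyUpTo (digit-sequence x ∘ suc) (suc n) ] × 𝔪 (ℤ.- (+ suc (suc n))) (v - x)
    extend (v , v≈ , v-next∈) = ⌊ x ⌋ + w , (v , w , v≈ , vw≈1 , refl) ,
      𝔪-resp (begin
          w * t * - (v - next x)      ≈⟨ *-congˡ (solve 2 (λ v y → :- (v :- y) := y :- v) refl v (next x)) ⟩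
          w * t * (next x - v)        ≈⟨ inverse-difference (trans (*-comm _ _) (next-inverse x (¬end 0))) vw≈1 ⟨
          w - t                       ≈⟨ solve 3 (λ w x z → w :- (x :- z) := (z :+ w) :- x) refl w x ⌊ x ⌋ ⟩
          ⌊ x ⌋ + w - x               ∎)
        (𝔪-mono (ℤ.-≤- (ℕ.n≤1+n (suc n)))
          (𝔪-* (𝔪-* (∉𝔪⇒inverse∈𝔪 vw≈1 v∉) (difference ∼⌊ x ⌋)) (𝔪-neg v-next∈)))
      where
      v∉ : ¬ 𝔪 (+ 0) v
      v∉ v∈ = next∉𝔪 x (¬end 0) (∼-∈𝔪 (∼-sym (close (𝔪-mono (ℤ.neg-mono-≤ (ℤ.+≤+ (ℕ.s≤s ℕ.z≤n))) v-next∈))) v∈)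
      w = proj₁ (inverse (∉𝔪⇒≉0 v∉))
      vw≈1 = proj₂ (inverse (∉𝔪⇒≉0 v∉))

  𝔪⇒converges : ∀ {v x} → (∀ n → 𝔪 (ℤ.- (+ suc n)) (v n - x)) → v ConvergesTo x
  𝔪⇒converges v-x∈ q = let N , pe-N<q = below e q in
    N , λ n N≤n → ≤-<-transᵛ
      (abs≤ (𝔪-mono (ℤ.neg-mono-≤ (ℤ.+≤+ (ℕ.m≤n⇒m≤1+n N≤n))) (v-x∈ n))) Strict.[ pe-N<q ]

  expansion : ∀ x → ∃ (IsContinuedFractionOf x)
  expansion x = case lpo (λ n → ends? (iter n x)) of λ where
    (inj₁ (n , end)) → let cs , cs∈ , x≈ = finite-expansion n x end in
      finite (⌊ x ⌋ ∷ cs) , (⌊ x ⌋∈Z , cs∈) , x≈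
    (inj₂ ¬end) → infinite (digit-sequence x) ,
      lift (⌊ x ⌋∈Z , λ n → digit-sequence∈Z* n x ¬end) ,
      ((λ n → proj₁ (convergent n x ¬end)) , (λ n → proj₁ (proj₂ (convergent n x ¬end))) ,
       𝔪⇒converges (λ n → proj₂ (proj₂ (convergent n x ¬end))))

  -- Uniqueness of continued fractions

  head-∼ : ∀ {x c cs} → All Z* cs → x ≈[ c ⨾ cs ] → x ∼ c
  -- Mutual with `head-∼`: a tail is large because it is congruent to its own head, which is large,
  -- and its inverse is therefore in the maximal ideal, which makes the preceding head a floor.
  tail∉𝔪 : ∀ {y c cs} → Z* c → All Z* cs → y ≈[ c ⨾ cs ] → ¬ 𝔪 (+ 0) y

  head-∼ {cs = []}     _ (lift x≈c) = ∼-reflexive x≈c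
  head-∼ {x} {c} {c₁ ∷ cs} (c₁∈ ∷ cs∈) (y , y⁻¹ , y≈ , yy⁻¹≈1 , x≈) = close (𝔪-resp (begin
    y⁻¹                ≈⟨ solve 2 (λ c t → t := (c :+ t) :- c) refl c y⁻¹ ⟩
    c + y⁻¹ - c        ≈⟨ +-congʳ x≈ ⟨
    x - c              ∎) (∉𝔪⇒inverse∈𝔪 yy⁻¹≈1 (tail∉𝔪 c₁∈ cs∈ y≈)))

  tail∉𝔪 (_ , c>𝟙) cs∈ y≈ y∈ = >𝟙⇒∉𝔪 c>𝟙 (∼-∈𝔪 (∼-sym (head-∼ cs∈ y≈)) y∈)

  head-unique : ∀ {x x′ c d} → x ≈ x′ → Z c → Z d → x ∼ c → x′ ∼ d → c ≈ d
  head-unique x≈x′ c∈ d∈ x∼c x′∼d =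
    Z-unique c∈ d∈ (∼-trans (∼-sym x∼c) (∼-trans (∼-reflexive x≈x′) x′∼d))

  inverse≉0 : ∀ {x y} → x * y ≈ 1# → ¬ (y ≈ 0#)
  inverse≉0 {x} xy≈1 y≈0 = 1≉0 (trans (sym xy≈1) (trans (*-congˡ y≈0) (zeroʳ x)))

  x≈c+t⇒x-c≈t : ∀ {x c t} → x ≈ c + t → x - c ≈ t
  x≈c+t⇒x-c≈t {x} {c} {t} x≈ = trans (+-congʳ x≈) (solve 2 (λ c t → (c :+ t) :- c := t) refl c t)

  x≈c⇒x-c≈0 : ∀ {x c} → x ≈ c → x - c ≈ 0#
  x≈c⇒x-c≈0 {x} {c} x≈c = trans (+-congʳ x≈c) (-‿inverseʳ c)

  -- Two values x ≈ x′ appear because the induction continues with tails that are equal only up to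
  -- `_≈_`.
  finite-unique : ∀ {x x′ c d cs ds} → x ≈ x′ → Z c → Z d → All Z* cs → All Z* ds →
                  x ≈[ c ⨾ cs ] → x′ ≈[ d ⨾ ds ] → c ≈ d × Pointwise _≈_ cs ds
  finite-unique {x} {x′} {c} {d} {cs} {ds} x≈x′ c∈ d∈ cs∈ ds∈ x≈ x′≈ = c≈d , tails cs ds cs∈ ds∈ x≈ x′≈
    where
    c≈d : c ≈ d
    c≈d = head-unique x≈x′ c∈ d∈ (head-∼ cs∈ x≈) (head-∼ ds∈ x′≈)

    x-c≈x′-d : x - c ≈ x′ - d
    x-c≈x′-d = +-cong x≈x′ (-‿cong c≈d)

    tails : ∀ cs ds → All Z* cs → All Z* ds → x ≈[ c ⨾ cs ] → x′ ≈[ d ⨾ ds ] → Pointwise _≈_ cs ds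
    tails [] [] _ _ _ _ = []
    -- The expansion that stops makes x - c zero; the one that goes on makes it invertible.
    tails [] (_ ∷ _) _ _ (lift x≈c) (y , t , _ , yt≈1 , x′≈) = contradiction
      (trans (sym (x≈c+t⇒x-c≈t x′≈)) (trans (sym x-c≈x′-d) (x≈c⇒x-c≈0 x≈c))) (inverse≉0 yt≈1)
    tails (_ ∷ _) [] _ _ (y , t , _ , yt≈1 , x≈) (lift x′≈d) = contradiction
      (trans (sym (x≈c+t⇒x-c≈t x≈)) (trans x-c≈x′-d (x≈c⇒x-c≈0 x′≈d))) (inverse≉0 yt≈1)
    tails (c₁ ∷ cs) (d₁ ∷ ds) (c₁∈ ∷ cs∈) (d₁∈ ∷ ds∈) (y , t , y≈ , yt≈1 , x≈) (z , u , z≈ , zu≈1 , x′≈) =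
      let y≈z = inverse-unique (trans (sym (x≈c+t⇒x-c≈t x≈)) (trans x-c≈x′-d (x≈c+t⇒x-c≈t x′≈)))
                  (trans (*-comm t y) yt≈1) (trans (*-comm u z) zu≈1)
          c₁≈d₁ , cs≈ds = finite-unique y≈z (proj₁ c₁∈) (proj₁ d₁∈) cs∈ ds∈ y≈ z≈
      in c₁≈d₁ ∷ cs≈ds

  record Limit (s : ℕ → Carrier) (x : Carrier) : Set (c ⊔ ℓ) where
    field
      partial   : ℕ → Carrier
      partial-≈ : ∀ n → partial n ≈[ s 0 ⨾ applyUpTo (s ∘ suc) n ]
      converges : ∀ k → ∃ λ N → ∀ n → N ℕ.≤ n → 𝔪 (ℤ.- (+ k)) (partial n - x)

  open Limit

  Represents⇒Limit : ∀ {s x} → Represents (infinite s) x → Limit s x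
  Represents⇒Limit (v , v≈ , v→x) = record
    { partial   = v
    ; partial-≈ = v≈
    ; converges = λ k → let N , v< = v→x ((ℤ.- (+ k)) ℚ./ e) in
                    N , λ n N≤n → bound (<⇒≤ᵛ (v< n N≤n))
    }

  tail-Z* : ∀ {s : ℕ → Carrier} → (∀ j → Z* (s (suc j))) → ∀ n → All Z* (applyUpTo (s ∘ suc) n)
  tail-Z* {s} s∈ n = All.applyUpTo⁺₂ (s ∘ suc) n s∈

  limit-head-∼ : ∀ {s x} → (∀ j → Z* (s (suc j))) → Limit s x → x ∼ s 0
  limit-head-∼ {s} s∈ lim = let N , v∼x = converges lim 1 in
    ∼-trans (∼-sym (close (v∼x N ℕ.≤-refl))) (head-∼ (tail-Z* {s} s∈ N) (partial-≈ lim N))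

  -- The tail of a limit is the limit of the tails: partial values have the form s₀ + 1/yₙ with yₙ
  -- bounded, so x ≠ s₀ and yₙ tends to 1/(x - s₀).
  module LimitTail {s x} (s∈ : ∀ j → Z* (s (suc j))) (lim : Limit s x) where

    y y⁻¹ : ℕ → Carrier
    y n   = proj₁ (partial-≈ lim (suc n))
    y⁻¹ n = proj₁ (proj₂ (partial-≈ lim (suc n)))

    y-≈ : ∀ n → y n ≈[ s 1 ⨾ applyUpTo (λ k → s (suc (suc k))) n ]
    y-≈ n = proj₁ (proj₂ (proj₂ (partial-≈ lim (suc n))))

    yy⁻¹≈1 : ∀ n → y n * y⁻¹ n ≈ 1#
    yy⁻¹≈1 n = proj₁ (proj₂ (proj₂ (proj₂ (partial-≈ lim (suc n)))))

    v-s≈y⁻¹ : ∀ n → partial lim (suc n) - s 0 ≈ y⁻¹ n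
    v-s≈y⁻¹ n = x≈c+t⇒x-c≈t (proj₂ (proj₂ (proj₂ (proj₂ (partial-≈ lim (suc n))))))

    m : ℕ
    m = proj₁ (𝔪-exhaust (s 1))

    -- All tails are congruent to the same head `s 1`, hence bounded uniformly in n.
    y∈ : ∀ n → 𝔪 (+ m) (y n)
    y∈ n = ∼-∈𝔪 (head-∼ (tail-Z* {s ∘ suc} (s∈ ∘ suc) n) (y-≈ n)) (proj₂ (𝔪-exhaust (s 1)))

    difference∈ : ∀ n → x - s 0 - y⁻¹ n ≈ - (partial lim (suc n) - x)
    difference∈ n = trans (+-congˡ (-‿cong (sym (v-s≈y⁻¹ n))))
      (solve 3 (λ x s v → (x :- s) :- (v :- s) := :- (v :- x)) refl x (s 0) (partial lim (suc n)))

    -- If x were `s 0`, then 1/yₙ would be the error of a partial value and tend to 0; at precision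
    -- m + 1 this puts 1 = yₙ · 1/yₙ into the maximal ideal.
    x-s≉0 : ¬ (x - s 0 ≈ 0#)
    x-s≉0 x-s≈0 = let N , v-x∈ = converges lim (suc m) in
      1∉𝔪 (𝔪-cast (r (+ m)) (𝔪-resp (trans (*-congˡ (y⁻¹≈ N)) (yy⁻¹≈1 N))
        (𝔪-* (y∈ N) (v-x∈ (suc N) (ℕ.n≤1+n N)))))
      where
      y⁻¹≈ : ∀ n → partial lim (suc n) - x ≈ y⁻¹ n
      y⁻¹≈ n = begin
        partial lim (suc n) - x                    ≈⟨ solve 3 (λ v x s → v :- x := (v :- s) :- (x :- s)) refl (partial lim (suc n)) x (s 0) ⟩
        (partial lim (suc n) - s 0) - (x - s 0)    ≈⟨ +-cong (v-s≈y⁻¹ n) (trans (-‿cong x-s≈0) -0#≈0#) ⟩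
        y⁻¹ n + 0#                                 ≈⟨ +-identityʳ (y⁻¹ n) ⟩
        y⁻¹ n                                      ∎
      r : ∀ m → m ℤ.+ ℤ.- (+ 1 ℤ.+ m) ≡ ℤ.- (+ 1)
      r = ℤ-Solver.solve-∀

    z : Carrier
    z = proj₁ (inverse x-s≉0)

    [x-s]z≈1 : (x - s 0) * z ≈ 1#
    [x-s]z≈1 = proj₂ (inverse x-s≉0)

    y-z≈ : ∀ n → y n * z * - (partial lim (suc n) - x) ≈ y n - z
    y-z≈ n = trans (*-congˡ (sym (difference∈ n)))
      (sym (inverse-difference [x-s]z≈1 (trans (*-comm (y⁻¹ n) (y n)) (yy⁻¹≈1 n))))

    tail : Limit (s ∘ suc) z
    tail = record
      { partial   = y
      ; partial-≈ = y-≈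
      ; converges = λ k →
          let l , z∈ = 𝔪-exhaust z
              -- The factors yₙ and z in `y-z≈` cost at most m and l, so precision k remains.
              N , v-x∈ = converges lim (m ℕ.+ l ℕ.+ k)
          in N , λ n N≤n → 𝔪-cast (r (+ m) (+ l) (+ k))
               (𝔪-resp (y-z≈ n) (𝔪-* (𝔪-* (y∈ n) z∈) (𝔪-neg (v-x∈ (suc n) (ℕ.m≤n⇒m≤1+n N≤n)))))
      }
      where
      r : ∀ m l k → (m ℤ.+ l) ℤ.+ ℤ.- (m ℤ.+ l ℤ.+ k) ≡ ℤ.- k
      r = ℤ-Solver.solve-∀

  infinite-unique : ∀ {s t x x′} → x ≈ x′ → Z (s 0) → Z (t 0) →
                    (∀ j → Z* (s (suc j))) → (∀ j → Z* (t (suc j))) →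
                    Limit s x → Limit t x′ → ∀ n → s n ≈ t n
  infinite-unique x≈x′ s₀∈ t₀∈ s∈ t∈ lim-s lim-t zero =
    head-unique x≈x′ s₀∈ t₀∈ (limit-head-∼ s∈ lim-s) (limit-head-∼ t∈ lim-t)
  infinite-unique {s} {t} x≈x′ s₀∈ t₀∈ s∈ t∈ lim-s lim-t (suc n) =
    infinite-unique {s ∘ suc} {t ∘ suc}
      (inverse-unique (+-cong x≈x′ (-‿cong (infinite-unique x≈x′ s₀∈ t₀∈ s∈ t∈ lim-s lim-t 0)))
                      (LimitTail.[x-s]z≈1 s∈ lim-s) (LimitTail.[x-s]z≈1 t∈ lim-t))
      (proj₁ (s∈ 0)) (proj₁ (t∈ 0)) (s∈ ∘ suc) (t∈ ∘ suc)
      (LimitTail.tail s∈ lim-s) (LimitTail.tail t∈ lim-t) n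

  -- Stripping equal heads shortens the finite side; once it is exhausted, its value equals its
  -- head, which `x-s≉0` forbids for the limit.
  finite≢infinite : ∀ {s c cs x x′} → x ≈ x′ → Z c → Z (s 0) → All Z* cs → (∀ j → Z* (s (suc j))) →
                    x ≈[ c ⨾ cs ] → ¬ Limit s x′
  finite≢infinite {s} {c} {cs} {x} {x′} x≈x′ c∈ s₀∈ cs∈ s∈ x≈ lim = go cs cs∈ x≈
    where
    module Tail = LimitTail s∈ lim

    x-c≈x′-s : x - c ≈ x′ - s 0
    x-c≈x′-s = +-cong x≈x′ (-‿cong (head-unique x≈x′ c∈ s₀∈ (head-∼ cs∈ x≈) (limit-head-∼ s∈ lim)))

    go : ∀ cs → All Z* cs → ¬ (x ≈[ c ⨾ cs ])
    go [] _ (lift x≈c) = Tail.x-s≉0 (trans (sym x-c≈x′-s) (x≈c⇒x-c≈0 x≈c))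
    go (c₁ ∷ cs) (c₁∈ ∷ cs∈) (y , t , y≈ , yt≈1 , x≈) = finite≢infinite {s ∘ suc}
      (inverse-unique (trans (sym (x≈c+t⇒x-c≈t x≈)) x-c≈x′-s) (trans (*-comm t y) yt≈1) Tail.[x-s]z≈1)
      (proj₁ c₁∈) (proj₁ (s∈ 0)) cs∈ (s∈ ∘ suc) y≈ Tail.tail

  expansion-unique : ∀ {x s t} → IsContinuedFractionOf x s → IsContinuedFractionOf x t → s ≈ˢ t
  expansion-unique {s = finite (_ ∷ _)} {finite (_ ∷ _)} ((c∈ , cs∈) , x≈c) ((d∈ , ds∈) , x≈d) =
    let c≈d , cs≈ds = finite-unique refl c∈ d∈ cs∈ ds∈ x≈c x≈d in finite c≈d cs≈ds
  expansion-unique {s = finite (_ ∷ _)} {infinite t} ((c∈ , cs∈) , x≈c) (lift (t₀∈ , t∈) , t→x) =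
    contradiction (Represents⇒Limit {t} t→x) (finite≢infinite {t} refl c∈ t₀∈ cs∈ t∈ x≈c)
  expansion-unique {s = infinite s} {finite (_ ∷ _)} (lift (s₀∈ , s∈) , s→x) ((d∈ , ds∈) , x≈d) =
    contradiction (Represents⇒Limit {s} s→x) (finite≢infinite {s} refl d∈ s₀∈ ds∈ s∈ x≈d)
  expansion-unique {s = infinite s} {infinite t} (lift (s₀∈ , s∈) , s→x) (lift (t₀∈ , t∈) , t→x) =
    infinite (infinite-unique {s} {t} refl s₀∈ t₀∈ s∈ t∈ (Represents⇒Limit {s} s→x) (Represents⇒Limit {t} t→x))

mainTheorem1 : ∀ {c ℓ} (p : ℕ) → Prime p →
    (S : Setting p c ℓ) (D : DigitSystem p) →
    let open ContinuedFractions S D in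
    (α : FiniteExtension.Carrier (Setting.K S)) →
    ∃! _≈ˢ_ (IsContinuedFractionOf α)
mainTheorem1 p p-prime S D α =
  proj₁ (expansion α) , proj₂ (expansion α) , expansion-unique (proj₂ (expansion α))
  where open ContinuedFraction p-prime S D
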